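{- Let $G=(V,E)$ be a cubic, $3$-edge-connected Hamiltonian graph with $n=|V|$, and identify $V$ with the node set $V_n$ of $K_n$. Then the everywhere $\frac67$ vector for $G$ is in $T^n$.
   Context: $K_n=(V_n,E_n)$ is the complete graph on $n$ nodes. For a graph $G=(V,E)$ on $V=V_n$ and $\lambda\in\mathbb{R}$, the everywhere $\lambda$ vector for $G$ is the vector $y\in\mathbb{R}^{E_n}$ with $y_e=\lambda$ for $e\in E$ and $y_e=0$ for all other edges of $K_n$. A tour is a multiset $J$ of edges of $K_n$ such that $(V_n,J)$ is connected with all degrees even; its incidence vector records multiplicities (which may be arbitrarily large); $T^n$ is the convex hull of incidence vectors of all tours of $K_n$. -}

module Defs where

open import Data.Nat as ℕ using (ℕ; zero; suc)
open import Data.Nat.Properties as ℕP using ()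
open import Data.Fin as Fin using (Fin; toℕ)
open import Data.Fin.Properties using (_<?_)
open import Data.Bool using (Bool; true; false; if_then_else_; T)
open import Data.Integer as ℤ using (+_)
open import Data.Rational as ℚ using (ℚ; _/_; 0ℚ; 1ℚ)
open import Data.List using (List; []; _∷_; map; allFin)
open import Data.Nat.ListAction using (sum)
open import Data.List.Relation.Unary.All using (All)
open import Data.Product using (Σ; _×_; _,_; proj₁; proj₂)
open import Data.Sum using (_⊎_)
open import Relation.Nullary using (¬_; yes; no)
open import Relation.Binary.PropositionalEquality using (_≡_)
open import Relation.Binary.Construct.Closure.ReflexiveTransitive using (Star)
open import Function using (Injective)

-- Edges of K_n: unordered pairs {i,j}, i ≠ j, represented as (i , j , i<j).
Edge : ℕ → Set
Edge n = Σ (Fin n) λ i → Σ (Fin n) λ j → i Fin.< j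

src tgt : ∀ {n} → Edge n → Fin n
src e = proj₁ e
tgt e = proj₁ (proj₂ e)

SameEdge : ∀ {n} → Edge n → Edge n → Set
SameEdge e f = src e ≡ src f × tgt e ≡ tgt f

Graph : ℕ → Set
Graph n = Edge n → Bool

Adj : ∀ {n} → (Edge n → Set) → Fin n → Fin n → Set
Adj {n} P u v = (Σ (u Fin.< v) λ p → P (u , v , p)) ⊎ (Σ (v Fin.< u) λ p → P (v , u , p))

Connected : ∀ {n} → (Edge n → Set) → Set
Connected {n} P = (u v : Fin n) → Star (Adj P) u v

-- multiplicity of the pair {u,v} in a multiset J of edges (0 if u = v)
mult : ∀ {n} → (Edge n → ℕ) → Fin n → Fin n → ℕ
mult J u v with u <? v | v <? u
... | yes p | _ = J (u , v , p)
... | no _ | yes q = J (v , u , q)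
... | no _ | no _ = 0

deg : ∀ {n} → (Edge n → ℕ) → Fin n → ℕ
deg {n} J v = sum (map (mult J v) (allFin n))

indicator : ∀ {n} → Graph n → Edge n → ℕ
indicator E e = if E e then 1 else 0

edgeSet : ∀ {n} → Graph n → Edge n → Set
edgeSet E e = T (E e)

Cubic : ∀ {n} → Graph n → Set
Cubic {n} E = (v : Fin n) → deg (indicator E) v ≡ 3

-- k-edge-connected for k = 3: deleting any at most two edges leaves G connected
-- (e₁ = e₂ covers deleting one edge; deleting a non-edge changes nothing).
ThreeEdgeConnected : ∀ {n} → Graph n → Set
ThreeEdgeConnected {n} E =
  (e₁ e₂ : Edge n) → Connected (λ e → T (E e) × ¬ SameEdge e e₁ × ¬ SameEdge e e₂)

Hamiltonian : ∀ {n} → Graph n → Set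
Hamiltonian {n} E = 3 ℕ.≤ n × Σ (Fin n → Fin n) λ c → Injective _≡_ _≡_ c ×
  ((i j : Fin n) → (suc (toℕ i) ≡ toℕ j ⊎ (suc (toℕ i) ≡ n × toℕ j ≡ 0)) →
     Adj (edgeSet E) (c i) (c j))

Even : ℕ → Set
Even m = Σ ℕ λ k → m ≡ k ℕ.+ k

IsTour : ∀ {n} → (Edge n → ℕ) → Set
IsTour {n} J = Connected (λ e → 0 ℕ.< J e) × ((v : Fin n) → Even (deg J v))

incidence : ∀ {n} → (Edge n → ℕ) → Edge n → ℚ
incidence J e = + (J e) / 1

combo : ∀ {n} → List (ℚ × (Edge n → ℕ)) → Edge n → ℚ
combo [] e = 0ℚ
combo ((λ₀ , J) ∷ xs) e = λ₀ ℚ.* incidence J e ℚ.+ combo xs e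

coeffSum : ∀ {n} → List (ℚ × (Edge n → ℕ)) → ℚ
coeffSum [] = 0ℚ
coeffSum ((λ₀ , _) ∷ xs) = λ₀ ℚ.+ coeffSum xs

InTourPolytope : (n : ℕ) → (Edge n → ℚ) → Set
InTourPolytope n y = Σ (List (ℚ × (Edge n → ℕ))) λ xs →
  All (λ p → IsTour (proj₂ p)) xs × All (λ p → 0ℚ ℚ.≤ proj₁ p) xs ×
  coeffSum xs ≡ 1ℚ × ((e : Edge n) → combo xs e ≡ y e)

everywhere : ∀ {n} → ℚ → Graph n → Edge n → ℚ
everywhere λ₀ E e = if E e then λ₀ else 0ℚ

{-# OPTIONS --safe #-}

-- Write H for the Hamiltonian cycle and give the edges of K_n the capacities
-- X = 2 χ_G − χ_H.  An edge cut of G has at least three edges and an even number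
-- of them lie in H, so every cut has X-capacity at least 4.  By Wolsey's analysis of
-- Christofides' algorithm, for all weights w ≥ 0 there is then a tour of weight at
-- most 3/4 w·X: a spanning tree of weight at most 1/2 w·X and a join of its odd
-- vertices of weight at most 1/4 w·X.  As 3 w·χ_H + 4 · 3/4 w·X = 6 w·χ_G, this tour
-- or H has weight at most 6/7 w·χ_G.  By Farkas' lemma a convex combination of
-- tours is at most the everywhere 6/7 vector, and the slack is filled up by
-- doubled edges.
--
-- The bound on joins is proved as in Sebő's proof of Seymour's minimax theorem:
-- with even weights, some cut D satisfies w(F) − |F ∩ δ(D)| ≥ τ(w) − 1 for all
-- T-joins F, so subtracting 1 from w on δ(D) lowers the minimum τ(w) by at most 1
-- and w·X by at least 4.
module Submission where

open import Defs
open import Data.Nat using (ℕ)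
open import Data.Integer using (+_)
open import Data.Rational using (_/_)

open import Algebra.Bundles using (CommutativeMonoid; CommutativeRing)
import Algebra.Properties.CommutativeMonoid.Sum as MonoidSum
import Algebra.Properties.Semiring.Sum as SemiringSum
open import Data.Bool using (Bool; true; false; if_then_else_; _xor_; _∧_; _∨_; not; T)
import Data.Bool.Properties as 𝔹ₚ
open import Data.Bool.Solver using (module xor-∧-Solver)
open import Data.Fin as Fin
  using (Fin; zero; suc; toℕ; fromℕ; inject₁; punchIn; punchOut; _↑ˡ_; _↑ʳ_; combine; remQuot)
open import Data.Fin.Induction using (<-weakInduction)
import Data.Fin.Properties as Finₚ
open import Data.Fin.Subset using (Subset)
open import Data.Fin.Subset.Properties using (anySubset?)
open import Data.Integer as ℤ using (ℤ; -[1+_]; +[1+_]; 0ℤ; 1ℤ; ∣_∣)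
import Data.Integer.Properties as ℤₚ
open import Data.Integer.Tactic.RingSolver using () renaming (solve-∀ to ℤ-solve-∀)
open import Data.List as List
  using (List; []; _∷_; _++_; map; length; filter; allFin; cartesianProductWith)
open import Data.List.Membership.Propositional using (_∈_)
open import Data.List.Membership.Propositional.Properties
  using (∈-filter⁺; ∈-filter⁻; ∈-map⁺; ∈-map⁻; ∈-++⁺ˡ; ∈-++⁺ʳ; ∈-++⁻;
         ∈-cartesianProductWith⁺; ∈-cartesianProductWith⁻)
import Data.List.Properties as Listₚ
open import Data.List.Relation.Unary.All as All using (All; []; _∷_)
import Data.List.Relation.Unary.All.Properties as Allₚ
open import Data.List.Relation.Unary.Any using (here; there)
open import Data.Nat as ℕ using (zero; suc; _+_; _*_; _∸_; _≤_; _<_; z≤n; s≤s)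
import Data.Nat.ListAction as ListAction
import Data.Nat.Properties as ℕₚ
open import Data.Nat.Tactic.RingSolver using (solve-∀)
open import Data.Product using (Σ; ∃; ∃-syntax; _×_; _,_; proj₁; proj₂)
open import Data.Rational as ℚ using (ℚ; 0ℚ; toℚᵘ)
import Data.Rational.Properties as ℚₚ
open import Data.Rational.Unnormalised as ℚᵘ using (mkℚᵘ; *≡*; _≃_)
import Data.Rational.Unnormalised.Properties as ℚᵘₚ
open import Data.Sum as Sum using (_⊎_; inj₁; inj₂; [_,_]′)
open import Data.Vec using ([]; _∷_; lookup; tabulate)
import Data.Vec.Properties as Vecₚ
open import Function using (_∘_; case_of_; id; Injective)
open import Relation.Binary using (tri<; tri≈; tri>)
open import Relation.Binary.Construct.Closure.ReflexiveTransitive as Star using (Star; ε; _◅_; _◅◅_)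
open import Relation.Binary.PropositionalEquality
open import Relation.Nullary using (¬_; Dec; yes; no; does; contradiction)
open import Relation.Nullary.Decidable using (map′; _×-dec_; dec-true; dec-false)

-- The cut δ(D) comes from relaxing the set T of odd vertices. Among all vertices `a`, `b` and all
-- joins whose odd set is T changed at `a` and `b`, let `K` be lightest; D consists of the vertices
-- at distance zero from `b`. Because the pair varies too, a join with the odd set of `K` that uses
-- δ(D) is heavier than `K`: dropping a crossing edge and adding a path of weight zero moves `b` to
-- the outer end of that edge. Evenness of the weights is lost when 1 is subtracted on a cut. What
-- persists is that the edges of odd weight form a cut, and this already fixes the parity of the
-- weight of a join with given odd vertices. So heavier means heavier by at least 2, which pays for
-- the at most two crossing edges lost in an exchange. There are infinitely many tours, so Farkas'
-- lemma is applied to a finite list: H and sums F + J of two edge sets, over all pairs, so that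
-- every outcome of the tree and join constructions is among them. The lemma is proved by
-- Fourier-Motzkin elimination over the integers. Edges are indexed by ordered pairs of vertices,
-- which accounts for extra factors 2.

module ℕΣ = SemiringSum ℕₚ.+-*-semiring
module 𝔹Σ = SemiringSum (CommutativeRing.semiring 𝔹ₚ.xor-∧-commutativeRing)
module ℤΣ = SemiringSum ℤₚ.+-*-semiring

open ℕΣ using (sum; sum-cong-≗)
open 𝔹Σ using () renaming (sum to ⨁)

private variable
  n m : ℕ

-- Binary and integral sums

infixl 6 _⊕_
_⊕_ : {A : Set} → (A → Bool) → (A → Bool) → A → Bool
(f ⊕ g) x = f x xor g x

-- Serves both as the singleton of a vertex, in boundaries, and as the singleton of an edge, in edge
-- sets.
pt : Fin n → Fin n → Bool
pt i j = does (i Finₚ.≟ j)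

pt-refl : (i : Fin n) → pt i i ≡ true
pt-refl i = dec-true (i Finₚ.≟ i) refl

pt-≢ : {i j : Fin n} → i ≢ j → pt i j ≡ false
pt-≢ {i = i} {j} i≢j = dec-false (i Finₚ.≟ j) i≢j

pt-true : {i j : Fin n} → pt i j ≡ true → i ≡ j
pt-true {i = i} {j} eq with i Finₚ.≟ j
... | yes i≡j = i≡j

sum-mono-≤ : {f g : Fin n → ℕ} → (∀ i → f i ≤ g i) → sum f ≤ sum g
sum-mono-≤ {zero}  f≤g = z≤n
sum-mono-≤ {suc n} f≤g = ℕₚ.+-mono-≤ (f≤g zero) (sum-mono-≤ (f≤g ∘ suc))

≤-sum : (f : Fin n → ℕ) (i : Fin n) → f i ≤ sum f
≤-sum f zero    = ℕₚ.m≤m+n _ _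
≤-sum f (suc i) = ℕₚ.≤-trans (≤-sum (f ∘ suc) i) (ℕₚ.m≤n+m _ _)

sum-positive : (f : Fin n → ℕ) → 1 ≤ sum f → ∃[ i ] 1 ≤ f i
sum-positive {suc n} f p with f zero in eq
... | suc _ = zero , subst (1 ≤_) (sym eq) (s≤s z≤n)
... | zero with sum-positive (f ∘ suc) p
...   | i , q = suc i , q

⨁-true : (f : Fin n → Bool) → ⨁ f ≡ true → ∃[ i ] f i ≡ true
⨁-true {suc n} f p with f zero in eq
... | true = zero , eq
... | false with ⨁-true (f ∘ suc) p
...   | i , q = suc i , q

sum-pt : (f : Fin n → ℕ) (i : Fin n) → sum (λ j → if pt i j then f j else 0) ≡ f i
sum-pt {suc n} f zero    = trans (cong (_+_ (f zero)) (ℕΣ.sum-replicate-zero n)) (ℕₚ.+-identityʳ _)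
sum-pt {suc n} f (suc i) = sum-pt (f ∘ suc) i

⨁-pt : (f : Fin n → Bool) (i : Fin n) → ⨁ (λ j → pt i j ∧ f j) ≡ f i
⨁-pt {suc n} f zero    = trans (cong (f zero xor_) (𝔹Σ.sum-replicate-zero n)) (𝔹ₚ.xor-identityʳ _)
⨁-pt {suc n} f (suc i) = ⨁-pt (f ∘ suc) i

odd : ℕ → Bool
odd zero    = false
odd (suc k) = not (odd k)

odd-+ : ∀ a b → odd (a + b) ≡ odd a xor odd b
odd-+ zero    b = refl
odd-+ (suc a) b = trans (cong not (odd-+ a b)) (𝔹ₚ.not-distribˡ-xor (odd a) (odd b))

odd-sum : (f : Fin n → ℕ) → odd (sum f) ≡ ⨁ (odd ∘ f)
odd-sum {zero}  f = refl
odd-sum {suc n} f = trans (odd-+ (f zero) _) (cong (odd (f zero) xor_) (odd-sum (f ∘ suc)))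

odd-suc : ∀ {a b} → odd a ≡ odd b → a < b → suc (suc a) ≤ b
odd-suc {a} {suc b} eq (s≤s a≤b) with ℕₚ.m≤n⇒m<n∨m≡n a≤b
... | inj₁ a<b  = s≤s a<b
... | inj₂ refl = contradiction eq (𝔹ₚ.not-¬ refl)

-- The search runs over bit vectors. A set given as a function agrees with its table only pointwise,
-- hence the requirement that P respect `≗`.
anyPredicate? : {P : (Fin m → Bool) → Set} → (∀ {F G} → F ≗ G → P F → P G) →
                (∀ F → Dec (P F)) → Dec (∃ P)
anyPredicate? resp P? = map′ (λ (v , p) → lookup v , p)
  (λ (F , p) → tabulate F , resp (sym ∘ Vecₚ.lookup∘tabulate F) p)
  (anySubset? (P? ∘ lookup))

minimal : {A : Set} (f : A → ℕ) → (∀ k → Dec (∃[ a ] f a < k)) → A →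
          ∃[ a ] (∀ b → f a ≤ f b)
minimal {A} f below? a₀ = go (f a₀) a₀ ℕₚ.≤-refl
  where
  go : ∀ k a → f a ≤ k → ∃[ a ] (∀ b → f a ≤ f b)
  go k a fa≤k with below? (f a)
  ... | no ¬b = a , λ b → ℕₚ.≮⇒≥ λ fb<fa → ¬b (b , fb<fa)
  go zero    a fa≤k | yes (b , fb<fa) = contradiction (ℕₚ.<-≤-trans fb<fa fa≤k) ℕₚ.n≮0
  go (suc k) a fa≤k | yes (b , fb<fa) = go k b (ℕₚ.≤-pred (ℕₚ.<-≤-trans fb<fa fa≤k))

-- Multigraphs: boundaries modulo 2, weights and cuts

module Multigraph {n m : ℕ} (s t : Fin m → Fin n) where

  Ends : Fin m → Fin n → Fin n → Set
  Ends i x y = (s i ≡ x × t i ≡ y) ⊎ (s i ≡ y × t i ≡ x)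

  inc : Fin m → Fin n → Bool
  inc i v = pt (s i) v xor pt (t i) v

  -- The boundary over the field with two elements: `∂ F` is the set of vertices of odd degree in F,
  -- and a T-join is an F with `∂ F ≗ T`. A loop cancels in `inc`.
  ∂ : (Fin m → Bool) → Fin n → Bool
  ∂ F v = ⨁ λ i → F i ∧ inc i v

  restrict : (Fin m → ℕ) → (Fin m → Bool) → Fin m → ℕ
  restrict W F i = if F i then W i else 0

  wt : (Fin m → ℕ) → (Fin m → Bool) → ℕ
  wt W F = sum (restrict W F)

  crosses : (Fin n → Bool) → Fin m → Bool
  crosses D i = D (s i) xor D (t i)

  χ : (Fin n → Bool) → Fin m → ℕ
  χ D i = if crosses D i then 1 else 0

  infix 4 _⊆_
  _⊆_ : (Fin m → Bool) → (Fin m → Bool) → Set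
  F ⊆ G = ∀ i → F i ≡ true → G i ≡ true

  inc-ends : ∀ {i x y} → Ends i x y → ∀ v → inc i v ≡ pt x v xor pt y v
  inc-ends (inj₁ (refl , refl)) v = refl
  inc-ends {i} (inj₂ (refl , refl)) v = 𝔹ₚ.xor-comm (pt (s i) v) (pt (t i) v)

  crosses-ends : ∀ {i x y} → Ends i x y → ∀ D → crosses D i ≡ D x xor D y
  crosses-ends (inj₁ (refl , refl)) D = refl
  crosses-ends {i} (inj₂ (refl , refl)) D = 𝔹ₚ.xor-comm (D (s i)) (D (t i))

  inc-true : ∀ i x → inc i x ≡ true → ∃[ y ] (x ≢ y × Ends i x y)
  inc-true i x eq with s i Finₚ.≟ x | t i Finₚ.≟ x
  ... | yes si≡x | no ti≢x  = t i , ti≢x ∘ sym , inj₁ (si≡x , refl)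
  ... | no si≢x  | yes ti≡x = s i , si≢x ∘ sym , inj₂ (refl , ti≡x)

  crosses-true : ∀ D i → crosses D i ≡ true → ∃[ d ] ∃[ x ] (D d ≡ true × D x ≡ false × Ends i d x)
  crosses-true D i eq with D (s i) in Ds | D (t i) in Dt
  ... | true  | false = s i , t i , Ds , Dt , inj₁ (refl , refl)
  ... | false | true  = t i , s i , Dt , Ds , inj₂ (refl , refl)

  ∂-cong : ∀ {F G} → F ≗ G → ∂ F ≗ ∂ G
  ∂-cong F≗G v = 𝔹Σ.sum-cong-≗ (λ i → cong (_∧ inc i v) (F≗G i))

  wt-cong : ∀ {W F G} → F ≗ G → wt W F ≡ wt W G
  wt-cong {W} F≗G = sum-cong-≗ (λ i → cong (if_then W i else 0) (F≗G i))

  ∂-⊕ : ∀ F G → ∂ (F ⊕ G) ≗ ∂ F ⊕ ∂ G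
  ∂-⊕ F G v = trans (𝔹Σ.sum-cong-≗ λ i → 𝔹ₚ.∧-distribʳ-xor (inc i v) (F i) (G i))
                    (𝔹Σ.∑-distrib-+ (λ i → F i ∧ inc i v) (λ i → G i ∧ inc i v))

  ∂-pt : ∀ i → ∂ (pt i) ≗ inc i
  ∂-pt i v = ⨁-pt (λ j → inc j v) i

  ∂-∅ : ∂ (λ _ → false) ≗ λ _ → false
  ∂-∅ v = 𝔹Σ.sum-replicate-zero m

  wt-pt : ∀ W i → wt W (pt i) ≡ W i
  wt-pt W i = sum-pt W i

  wt-⊕-≤ : ∀ W F G → wt W (F ⊕ G) ≤ wt W F + wt W G
  wt-⊕-≤ W F G = ℕₚ.≤-trans (sum-mono-≤ pointwise) (ℕₚ.≤-reflexive (ℕΣ.∑-distrib-+ (restrict W F) (restrict W G)))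
    where
    pointwise : ∀ i → (if F i xor G i then W i else 0) ≤ (if F i then W i else 0) + (if G i then W i else 0)
    pointwise i with F i | G i
    ... | true  | true  = z≤n
    ... | true  | false = ℕₚ.m≤m+n _ _
    ... | false | true  = ℕₚ.≤-refl
    ... | false | false = z≤n

  -- G may leave F along edges of weight zero. With `χ D` for W this covers a set that is contained
  -- in F only as far as δ(D) is concerned.
  wt-difference : ∀ W F G → (∀ i → G i ≡ true → F i ≡ true ⊎ W i ≡ 0) → wt W (F ⊕ G) + wt W G ≡ wt W F
  wt-difference W F G G⊆F = trans (sym (ℕΣ.∑-distrib-+ (restrict W (F ⊕ G)) (restrict W G))) (sum-cong-≗ pointwise)
    where
    pointwise : ∀ i → (if F i xor G i then W i else 0) + (if G i then W i else 0) ≡ (if F i then W i else 0)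
    pointwise i with F i | G i | G⊆F i
    ... | true  | true  | _ = refl
    ... | true  | false | _ = ℕₚ.+-identityʳ _
    ... | false | false | _ = refl
    ... | false | true  | q with q refl
    ...   | inj₂ eq rewrite eq = refl

  wt-remove : ∀ W F {i} → F i ≡ true → wt W (F ⊕ pt i) + W i ≡ wt W F
  wt-remove W F {i} Fi = trans (cong (_+_ (wt W (F ⊕ pt i))) (sym (wt-pt W i)))
    (wt-difference W F (pt i) λ j eq → inj₁ (subst (λ k → F k ≡ true) (pt-true eq) Fi))

  ≤-wt : ∀ W F {i} → F i ≡ true → W i ≤ wt W F
  ≤-wt W F {i} Fi = subst (W i ≤_) (wt-remove W F Fi) (ℕₚ.m≤n+m _ _)

  wt-positive : ∀ W F → 1 ≤ wt W F → ∃[ i ] (F i ≡ true × 1 ≤ W i)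
  wt-positive W F p with sum-positive _ p
  ... | i , q with F i in eq
  ...   | true = i , eq , q

  χ-true : ∀ {D i} → crosses D i ≡ true → χ D i ≡ 1
  χ-true eq rewrite eq = refl

  χ-positive : ∀ {D i} → 1 ≤ χ D i → crosses D i ≡ true
  χ-positive {D} {i} p with crosses D i
  ... | true = refl

  -- Double counting: modulo 2 an edge of F contributes p at both of its ends, so the total collects
  -- p over the vertices of odd degree. With `χ D` and D for W and p it follows that a set without
  -- boundary meets every cut evenly.
  parity-wt : ∀ W (p : Fin n → Bool) → (∀ i → odd (W i) ≡ crosses p i) →
              ∀ F → odd (wt W F) ≡ ⨁ λ v → ∂ F v ∧ p v
  parity-wt W p parity F = begin
    odd (wt W F)
      ≡⟨ odd-sum (λ i → if F i then W i else 0) ⟩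
    ⨁ (λ i → odd (if F i then W i else 0))
      ≡⟨ 𝔹Σ.sum-cong-≗ term ⟩
    ⨁ (λ i → ⨁ λ v → F i ∧ inc i v ∧ p v)
      ≡⟨ 𝔹Σ.∑-comm (λ i v → F i ∧ inc i v ∧ p v) ⟩
    ⨁ (λ v → ⨁ λ i → F i ∧ inc i v ∧ p v)
      ≡⟨ 𝔹Σ.sum-cong-≗ (λ v → trans (𝔹Σ.sum-cong-≗ λ i → sym (𝔹ₚ.∧-assoc (F i) (inc i v) (p v)))
                                      (sym (𝔹Σ.*-distribʳ-sum (p v) (λ i → F i ∧ inc i v)))) ⟩
    ⨁ (λ v → ∂ F v ∧ p v) ∎
    where
    open ≡-Reasoning
    ends : ∀ i → ⨁ (λ v → inc i v ∧ p v) ≡ crosses p i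
    ends i = trans (𝔹Σ.sum-cong-≗ λ v → 𝔹ₚ.∧-distribʳ-xor (p v) (pt (s i) v) (pt (t i) v))
      (trans (𝔹Σ.∑-distrib-+ (λ v → pt (s i) v ∧ p v) (λ v → pt (t i) v ∧ p v))
             (cong₂ _xor_ (⨁-pt p (s i)) (⨁-pt p (t i))))
    term : ∀ i → odd (if F i then W i else 0) ≡ ⨁ (λ v → F i ∧ inc i v ∧ p v)
    term i with F i
    ... | true  = trans (parity i) (sym (ends i))
    ... | false = sym (𝔹Σ.sum-replicate-zero n)

  same-parity : ∀ W (p : Fin n → Bool) → (∀ i → odd (W i) ≡ crosses p i) →
                ∀ {F G} → ∂ F ≗ ∂ G → odd (wt W F) ≡ odd (wt W G)
  same-parity W p parity {F} {G} eq = trans (parity-wt W p parity F)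
    (trans (𝔹Σ.sum-cong-≗ λ v → cong (_∧ p v) (eq v)) (sym (parity-wt W p parity G)))

-- Walks between vertices of odd degree

module Walks {n m : ℕ} (s t : Fin m → Fin n) where
  open Multigraph s t
  open xor-∧-Solver using (solve; _:+_; _:=_)

  size : (Fin m → Bool) → ℕ
  size = wt (λ _ → 1)

  cnt : (Fin n → Bool) → (Fin m → Bool) → ℕ
  cnt D = wt (χ D)

  Joins : (Fin m → Bool) → Fin n → Fin n → Set
  Joins J x y = ∂ J ≗ pt x ⊕ pt y

  joins-pt : ∀ {i x y} → Ends i x y → Joins (pt i) x y
  joins-pt {i} ends v = trans (∂-pt i v) (inc-ends ends v)

  joins-trans : ∀ {J K} x y z → Joins J x y → Joins K y z → Joins (J ⊕ K) x z
  joins-trans {J} {K} x y z jJ jK v = trans (∂-⊕ J K v) (trans (cong₂ _xor_ (jJ v) (jK v))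
    (solve 3 (λ a b c → (a :+ b) :+ (b :+ c) := a :+ c) refl (pt x v) (pt y v) (pt z v)))

  cnt-pt : ∀ D {i x y} → Ends i x y → D x ≡ false → D y ≡ false → cnt D (pt i) ≡ 0
  cnt-pt D {i} {x} {y} ends Dx Dy = trans (wt-pt (χ D) i) eq
    where
    eq : χ D i ≡ 0
    eq rewrite crosses-ends ends D | Dx | Dy = refl

  cnt-pt-≤1 : ∀ D i → cnt D (pt i) ≤ 1
  cnt-pt-≤1 D i = subst (_≤ 1) (sym (wt-pt (χ D) i)) bound
    where
    bound : χ D i ≤ 1
    bound with crosses D i
    ... | true  = ℕₚ.≤-refl
    ... | false = z≤n

  -- A walk in Z from a vertex of odd degree outside D, stopped at the first
  -- vertex that lies in D or is another vertex of odd degree.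
  record Walk (D : Fin n → Bool) (Z : Fin m → Bool) (x : Fin n) : Set where
    constructor walk
    field
      edges : Fin m → Bool
      end   : Fin n
      sub   : edges ⊆ Z
      joins : Joins edges x end
      stop  : (D end ≡ true × cnt D edges ≤ 1) ⊎
              (D end ≡ false × ∂ Z end ≡ true × end ≢ x × cnt D edges ≤ 0)

  ∧-true : ∀ {a b} → a ∧ b ≡ true → a ≡ true × b ≡ true
  ∧-true {true} {true} _ = refl , refl

  pt-⊆ : ∀ Z {i} → Z i ≡ true → pt i ⊆ Z
  pt-⊆ Z Zi j eq = subst (λ k → Z k ≡ true) (pt-true eq) Zi

  ⊕-⊆ : ∀ F G Z → F ⊆ Z → G ⊆ Z → F ⊕ G ⊆ Z
  ⊕-⊆ F G Z F⊆Z G⊆Z i eq with F i in Fi | G i in Gi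
  ... | true  | _    = F⊆Z i Fi
  ... | false | true = G⊆Z i Gi

  remove-⊆ : ∀ Z {i} → Z i ≡ true → Z ⊕ pt i ⊆ Z
  remove-⊆ Z {i} Zi = ⊕-⊆ Z (pt i) Z (λ _ eq → eq) (pt-⊆ Z Zi)

  -- Deleting the edge from x to y makes x even, and y odd if it was even before; so unless y stops
  -- the walk, it can be continued from y in the remainder. It never ends in x, which is now even,
  -- so an end outside D that is odd in the remainder is odd in Z as well. The number k bounds the
  -- edges still available.
  findWalk : ∀ D k Z x → size Z ≤ k → D x ≡ false → ∂ Z x ≡ true → Walk D Z x
  findWalk D k Z x Z≤k Dx odd-x with ⨁-true (λ i → Z i ∧ inc i x) odd-x
  ... | i , eq with ∧-true {Z i} eq
  ... | Zi , inc-x with inc-true i x inc-x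
  ... | y , x≢y , ends with D y in Dy
  ... | true  = walk (pt i) y (pt-⊆ Z Zi) (joins-pt ends) (inj₁ (Dy , cnt-pt-≤1 D i))
  ... | false with ∂ Z y in odd-y
  ...   | true = walk (pt i) y (pt-⊆ Z Zi) (joins-pt ends)
                   (inj₂ (Dy , odd-y , x≢y ∘ sym , ℕₚ.≤-reflexive (cnt-pt D ends Dx Dy)))
  ...   | false = continue k Z≤k
    where
    Z′ = Z ⊕ pt i
    ∂Z′ : ∀ v → ∂ Z′ v ≡ ∂ Z v xor (pt x v xor pt y v)
    ∂Z′ v = trans (∂-⊕ Z (pt i) v) (cong (∂ Z v xor_) (joins-pt ends v))
    odd′-y : ∂ Z′ y ≡ true
    odd′-y = trans (∂Z′ y) (trans (cong₂ _xor_ odd-y (cong₂ _xor_ (pt-≢ x≢y) (pt-refl y))) refl)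
    even′-x : ∂ Z′ x ≡ false
    even′-x = trans (∂Z′ x) (trans (cong₂ _xor_ odd-x (cong₂ _xor_ (pt-refl x) (pt-≢ (x≢y ∘ sym)))) refl)
    continue : ∀ k → size Z ≤ k → Walk D Z x
    continue zero Z≤0 = contradiction (ℕₚ.≤-trans (≤-wt (λ _ → 1) Z Zi) Z≤0) ℕₚ.1+n≰n
    continue (suc k) Z≤k with findWalk D k Z′ y smaller Dy odd′-y
      where
      smaller : size Z′ ≤ k
      smaller = ℕₚ.≤-pred (ℕₚ.≤-trans (ℕₚ.≤-reflexive (trans (ℕₚ.+-comm 1 _) (wt-remove (λ _ → 1) Z Zi))) Z≤k)
    ... | walk J z J⊆Z′ jJ stop = walk (pt i ⊕ J) z
            (⊕-⊆ (pt i) J Z (pt-⊆ Z Zi) (λ j Jj → remove-⊆ Z Zi j (J⊆Z′ j Jj)))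
            (joins-trans x y z (joins-pt ends) jJ) (extend stop)
      where
      cnt-≤ : ∀ {c} → cnt D J ≤ c → cnt D (pt i ⊕ J) ≤ c
      cnt-≤ J≤c = ℕₚ.≤-trans (wt-⊕-≤ (χ D) (pt i) J)
        (subst (λ c → c + cnt D J ≤ _) (sym (cnt-pt D ends Dx Dy)) J≤c)
      extend : (D z ≡ true × cnt D J ≤ 1) ⊎ (D z ≡ false × ∂ Z′ z ≡ true × z ≢ y × cnt D J ≤ 0) →
               (D z ≡ true × cnt D (pt i ⊕ J) ≤ 1) ⊎
               (D z ≡ false × ∂ Z z ≡ true × z ≢ x × cnt D (pt i ⊕ J) ≤ 0)
      extend (inj₁ (Dz , J≤1)) = inj₁ (Dz , cnt-≤ J≤1)
      extend (inj₂ (Dz , odd-z , z≢y , J≤0)) = inj₂ (Dz , odd′-z , z≢x , cnt-≤ J≤0)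
        where
        z≢x : z ≢ x
        z≢x refl = case trans (sym even′-x) odd-z of λ ()
        odd′-z : ∂ Z z ≡ true
        odd′-z = trans (sym (trans (cong (∂ Z z xor_) (cong₂ _xor_ (pt-≢ (z≢x ∘ sym)) (pt-≢ (z≢y ∘ sym))))
                                   (𝔹ₚ.xor-identityʳ _)))
                       (trans (sym (∂Z′ z)) odd-z)

-- Minimum weight joins

does-true : {A : Set} (A? : Dec A) → does A? ≡ true → A
does-true (yes x) _ = x

module Distance {n m : ℕ} (s t : Fin m → Fin n) (W : Fin m → ℕ) (b : Fin n) where
  open Multigraph s t
  open Walks s t

  -- Distance zero from `b`. A join of `b` and v stands for a path between them: it may carry
  -- further cycles of weight zero, which do no harm.
  Near : Fin n → Set
  Near v = ∃[ Z ] (Joins Z b v × wt W Z ≤ 0)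

  abstract
    near? : ∀ v → Dec (Near v)
    near? v = anyPredicate?
      (λ {F} {G} F≗G (j , z) → (λ u → trans (sym (∂-cong {F} {G} F≗G u)) (j u)) , subst (_≤ 0) (wt-cong {W} {F} {G} F≗G) z)
      (λ F → Finₚ.all? (λ u → ∂ F u 𝔹ₚ.≟ (pt b ⊕ pt v) u) ×-dec (wt W F ℕₚ.≤? 0))

    D : Fin n → Bool
    D v = does (near? v)

    D⇒near : ∀ v → D v ≡ true → Near v
    D⇒near v = does-true (near? v)

    near⇒D : ∀ v → Near v → D v ≡ true
    near⇒D v nv = dec-true (near? v) nv

module Exchange {n m : ℕ} (s t : Fin m → Fin n)
  (W : Fin m → ℕ) (p : Fin n → Bool) (parity : ∀ i → odd (W i) ≡ Multigraph.crosses s t p i)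
  (T : Fin n → Bool) (a b : Fin n) (K : Fin m → Bool)
  (∂K : Multigraph.∂ s t K ≗ T ⊕ pt a ⊕ pt b)
  (K-minimal : ∀ F x y → Multigraph.∂ s t F ≗ T ⊕ pt x ⊕ pt y →
               Multigraph.wt s t W K ≤ Multigraph.wt s t W F)
  (K-lighter : ∀ F → Multigraph.∂ s t F ≗ T → Multigraph.wt s t W K < Multigraph.wt s t W F)
  where
  open Multigraph s t
  open Walks s t
  open Distance s t W b
  open xor-∧-Solver using (solve; _:+_; _:=_; con)

  b∈D : D b ≡ true
  b∈D = near⇒D b ((λ _ → false) , (λ v → trans (∂-∅ v) (sym (𝔹ₚ.xor-same (pt b v)))) ,
                  ℕₚ.≤-reflexive (ℕΣ.sum-replicate-zero m))

  light : ∀ Z i → Z i ≡ true → wt W Z ≤ 0 → W i ≡ 0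
  light Z i Zi Z≤0 = ℕₚ.n≤0⇒n≡0 (ℕₚ.≤-trans (≤-wt W Z Zi) Z≤0)

  -- Otherwise a weightless join of `b` and `a`, added to `K`, would cancel both changes of parity
  -- and give a T-join no heavier than `K`.
  a∉D : D a ≡ false
  a∉D with D a in Da
  ... | false = refl
  ... | true with D⇒near a Da
  ...   | Z , jZ , Z≤0 = contradiction
          (ℕₚ.<-≤-trans (K-lighter (K ⊕ Z) ∂KZ) (ℕₚ.≤-trans (wt-⊕-≤ W K Z)
            (ℕₚ.≤-trans (ℕₚ.+-monoʳ-≤ (wt W K) Z≤0) (ℕₚ.≤-reflexive (ℕₚ.+-identityʳ _)))))
          (ℕₚ.<-irrefl refl)
    where
    ∂KZ : ∂ (K ⊕ Z) ≗ T
    ∂KZ v = trans (∂-⊕ K Z v) (trans (cong₂ _xor_ (∂K v) (jZ v))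
      (solve 3 (λ t a b → ((t :+ a) :+ b) :+ (b :+ a) := t) refl (T v) (pt a v) (pt b v)))

  crossing-positive : ∀ i → crosses D i ≡ true → 1 ≤ W i
  crossing-positive i ci with W i in Wi
  ... | suc _ = s≤s z≤n
  ... | zero with crosses-true D i ci
  ...   | d , x , Dd , Dx , ends with D⇒near d Dd
  ...     | Z , jZ , Z≤0 = case trans (sym Dx) (near⇒D x (Z ⊕ pt i , joins-trans b d x jZ (joins-pt ends) , bound)) of λ ()
    where
    bound : wt W (Z ⊕ pt i) ≤ 0
    bound = ℕₚ.≤-trans (wt-⊕-≤ W Z (pt i)) (ℕₚ.+-mono-≤ Z≤0 (ℕₚ.≤-reflexive (trans (wt-pt W i) Wi)))

  χ≤W : ∀ i → χ D i ≤ W i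
  χ≤W i with crosses D i in ci
  ... | false = z≤n
  ... | true  = crossing-positive i ci

  cnt≤wt : ∀ F → cnt D F ≤ wt W F
  cnt≤wt F = sum-mono-≤ pointwise
    where
    pointwise : ∀ i → restrict (χ D) F i ≤ restrict W F i
    pointwise i with F i
    ... | true  = χ≤W i
    ... | false = z≤n

  -- Drop the crossing edge and add a weightless path from `b` to its inner end d. The odd vertex
  -- `b` has moved to the outer end x, so minimality over all pairs bounds the result from below,
  -- although it has lost the positive weight of the edge.
  crossing-heavy : ∀ F → ∂ F ≗ T ⊕ pt a ⊕ pt b → ∀ i → F i ≡ true → crosses D i ≡ true → wt W K < wt W F
  crossing-heavy F ∂F i Fi ci with crosses-true D i ci
  ... | d , x , Dd , Dx , ends with D⇒near d Dd
  ...   | Z , jZ , Z≤0 = begin-strict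
      wt W K                        ≤⟨ K-minimal ((F ⊕ pt i) ⊕ Z) a x ∂F′ ⟩
      wt W ((F ⊕ pt i) ⊕ Z)         ≤⟨ wt-⊕-≤ W (F ⊕ pt i) Z ⟩
      wt W (F ⊕ pt i) + wt W Z      ≤⟨ ℕₚ.+-monoʳ-≤ (wt W (F ⊕ pt i)) Z≤0 ⟩
      wt W (F ⊕ pt i) + 0           <⟨ ℕₚ.+-monoʳ-< (wt W (F ⊕ pt i)) (crossing-positive i ci) ⟩
      wt W (F ⊕ pt i) + W i         ≡⟨ wt-remove W F Fi ⟩
      wt W F                        ∎
    where
    open ℕₚ.≤-Reasoning
    ∂F′ : ∂ ((F ⊕ pt i) ⊕ Z) ≗ T ⊕ pt a ⊕ pt x
    ∂F′ v = trans (∂-⊕ (F ⊕ pt i) Z v) (trans (cong₂ _xor_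
      (trans (∂-⊕ F (pt i) v) (cong₂ _xor_ (∂F v) (joins-pt ends v))) (jZ v))
      (solve 5 (λ t a b d x → (((t :+ a) :+ b) :+ (d :+ x)) :+ (b :+ d) := (t :+ a) :+ x) refl
        (T v) (pt a v) (pt b v) (pt d v) (pt x v)))

  crossing-heavier : ∀ F → ∂ F ≗ T ⊕ pt a ⊕ pt b → ∀ i → F i ≡ true → crosses D i ≡ true → 2 + wt W K ≤ wt W F
  crossing-heavier F ∂F i Fi ci =
    odd-suc (same-parity W p parity {K} {F} λ v → trans (∂K v) (sym (∂F v))) (crossing-heavy F ∂F i Fi ci)

  K-avoids : ∀ i → crosses D i ≡ true → K i ≡ false
  K-avoids i ci with K i in Ki
  ... | false = refl
  ... | true  = contradiction (crossing-heavy K ∂K i Ki ci) (ℕₚ.<-irrefl refl)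

  -- A set to be exchanged between F and `K`. It changes neither boundary, and apart from weightless
  -- edges it consists of edges in exactly one of the two. Through `edge` the set K ⊕ C uses δ(D)
  -- and is expensive; `few` limits what F loses on δ(D).
  record Swap (F : Fin m → Bool) : Set where
    constructor swap
    field
      C        : Fin m → Bool
      even     : ∂ C ≗ λ _ → false
      sub      : ∀ i → C i ≡ true → (F ⊕ K) i ≡ true ⊎ W i ≡ 0
      few      : cnt D C ≤ 2
      edge     : Fin m
      edge∈C   : C edge ≡ true
      crossing : crosses D edge ≡ true

  module _ (F : Fin m → Bool) (∂F : ∂ F ≗ T) where

    Z = F ⊕ K

    -- The odd vertices of Z are `a` and `b`, and `b` lies in D.
    ∂Z : ∀ v → D v ≡ false → ∂ Z v ≡ pt a v
    ∂Z v Dv = trans (∂-⊕ F K v) (trans (cong₂ _xor_ (∂F v) (∂K v))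
      (trans (solve 3 (λ t a b → t :+ ((t :+ a) :+ b) := a :+ b) refl (T v) (pt a v) (pt b v))
      (trans (cong (pt a v xor_) (pt-≢ b≢v)) (𝔹ₚ.xor-identityʳ _))))
      where
      b≢v : b ≢ v
      b≢v refl = case trans (sym b∈D) Dv of λ ()

    Z-crossing : ∀ {i} → F i ≡ true → crosses D i ≡ true → Z i ≡ true
    Z-crossing {i} Fi ci rewrite Fi | K-avoids i ci = refl

    -- A closed walk: from `b` to d for free, across e to x, along J to y, and back to `b` for free.
    -- The free parts avoid δ(D), since `χ D` is at most W; this leaves e and at most one crossing
    -- edge of J.
    close : ∀ {e d x y J} → F e ≡ true → crosses D e ≡ true → Ends e d x → D d ≡ true →
            J ⊆ Z → J e ≡ false → Joins J x y → D y ≡ true → cnt D J ≤ 1 → Swap F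
    close {e} {d} {x} {y} {J} Fe ce ends Dd J⊆Z J∌e jJ Dy J≤1 with D⇒near d Dd | D⇒near y Dy
    ... | L , jL , L≤0 | M , jM , M≤0 = swap C even sub few e e∈C ce
      where
      C = (pt e ⊕ J) ⊕ (L ⊕ M)
      LM≤0 : wt W (L ⊕ M) ≤ 0
      LM≤0 = ℕₚ.≤-trans (wt-⊕-≤ W L M) (ℕₚ.+-mono-≤ L≤0 M≤0)
      even : ∂ C ≗ λ _ → false
      even v = trans (∂-⊕ (pt e ⊕ J) (L ⊕ M) v) (trans (cong₂ _xor_
        (trans (∂-⊕ (pt e) J v) (cong₂ _xor_ (joins-pt ends v) (jJ v)))
        (trans (∂-⊕ L M v) (cong₂ _xor_ (jL v) (jM v))))
        (solve 4 (λ b d x y → ((d :+ x) :+ (x :+ y)) :+ ((b :+ d) :+ (b :+ y)) := con false) refl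
          (pt b v) (pt d v) (pt x v) (pt y v)))
      sub : ∀ i → C i ≡ true → Z i ≡ true ⊎ W i ≡ 0
      sub i Ci with (L ⊕ M) i in LMi
      ... | true  = inj₂ (light (L ⊕ M) i LMi LM≤0)
      ... | false = inj₁ (⊕-⊆ (pt e) J Z (pt-⊆ Z Ze) J⊆Z i
                           (trans (sym (𝔹ₚ.xor-identityʳ _)) Ci))
        where Ze = Z-crossing Fe ce
      few : cnt D C ≤ 2
      few = ℕₚ.≤-trans (wt-⊕-≤ (χ D) (pt e ⊕ J) (L ⊕ M))
        (ℕₚ.+-mono-≤ {y = 2} {v = 0}
          (ℕₚ.≤-trans (wt-⊕-≤ (χ D) (pt e) J) (ℕₚ.+-mono-≤ (cnt-pt-≤1 D e) J≤1))
          (ℕₚ.≤-trans (cnt≤wt (L ⊕ M)) LM≤0))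
      LM∌e : (L ⊕ M) e ≡ false
      LM∌e with (L ⊕ M) e in LMe
      ... | false = refl
      ... | true  = contradiction (subst (1 ≤_) (light (L ⊕ M) e LMe LM≤0) (crossing-positive e ce)) λ ()
      e∈C : C e ≡ true
      e∈C = cong₂ _xor_ (cong₂ _xor_ (pt-refl e) J∌e) LM∌e

    crossing-ends-≢ : ∀ {d x} → D d ≡ true → D x ≡ false → d ≢ x
    crossing-ends-≢ Dd Dx refl = case trans (sym Dd) Dx of λ ()

    ∂-remove : ∀ Y {e d x} → Ends e d x → ∀ v → ∂ (Y ⊕ pt e) v ≡ ∂ Y v xor (pt d v xor pt x v)
    ∂-remove Y {e} ends v = trans (∂-⊕ Y (pt e) v) (cong (∂ Y v xor_) (joins-pt ends v))

    ∉-remove : ∀ Y J {e} → Y e ≡ true → J ⊆ Y ⊕ pt e → J e ≡ false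
    ∉-remove Y J {e} Ye J⊆ with J e in Je
    ... | false = refl
    ... | true  = case trans (sym (J⊆ e Je)) (cong₂ _xor_ Ye (pt-refl e)) of λ ()

    -- Once e is deleted, its outer end x is the only odd vertex of Y outside D, so a walk from x
    -- cannot stop before it is back in D.
    returnFromEven : ∀ Y → Y ⊆ Z → (∀ v → D v ≡ false → ∂ Y v ≡ false) →
                     ∀ {e} → F e ≡ true → crosses D e ≡ true → Y e ≡ true → Swap F
    returnFromEven Y Y⊆Z ∂Y {e} Fe ce Ye with crosses-true D e ce
    ... | d , x , Dd , Dx , ends with findWalk D _ (Y ⊕ pt e) x ℕₚ.≤-refl Dx
          (trans (∂-remove Y ends x) (cong₂ _xor_ (∂Y x Dx) (cong₂ _xor_ (pt-≢ (crossing-ends-≢ Dd Dx)) (pt-refl x))))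
    ...   | walk J y J⊆ jJ (inj₁ (Dy , J≤1)) =
            close Fe ce ends Dd (λ i Ji → Y⊆Z i (remove-⊆ Y Ye i (J⊆ i Ji))) (∉-remove Y J Ye J⊆) jJ Dy J≤1
    ...   | walk J y J⊆ jJ (inj₂ (Dy , odd-y , y≢x , J≤0)) = case trans (sym odd-y) even-y of λ ()
      where
      even-y : ∂ (Y ⊕ pt e) y ≡ false
      even-y = trans (∂-remove Y ends y)
        (cong₂ _xor_ (∂Y y Dy) (cong₂ _xor_ (pt-≢ (crossing-ends-≢ Dd Dy)) (pt-≢ (y≢x ∘ sym))))

    second : ∀ {e} → F e ≡ true → 2 ≤ cnt D F → ∃[ e′ ] (e ≢ e′ × F e′ ≡ true × crosses D e′ ≡ true)
    second {e} Fe F≥2 with wt-positive (χ D) (F ⊕ pt e) (ℕₚ.+-cancelʳ-≤ 1 1 _ (begin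
        2                             ≤⟨ F≥2 ⟩
        cnt D F                       ≡⟨ wt-remove (χ D) F Fe ⟨
        cnt D (F ⊕ pt e) + χ D e      ≤⟨ ℕₚ.+-monoʳ-≤ _ (subst (_≤ 1) (wt-pt (χ D) e) (cnt-pt-≤1 D e)) ⟩
        cnt D (F ⊕ pt e) + 1          ∎))
      where open ℕₚ.≤-Reasoning
    ... | e′ , Fe′ , χ≥1 = e′ , e≢e′ , remove-⊆ F Fe e′ Fe′ , χ-positive {D} χ≥1
      where
      e≢e′ : e ≢ e′
      e≢e′ refl = case trans (sym Fe′) (cong₂ _xor_ Fe (pt-refl e)) of λ ()

    module _ {e e′ d x} (Fe : F e ≡ true) (ce : crosses D e ≡ true) (ends : Ends e d x)
             (Dd : D d ≡ true) (Dx : D x ≡ false)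
             (e≢e′ : e ≢ e′) (Fe′ : F e′ ≡ true) (ce′ : crosses D e′ ≡ true) where

      Ze : Z e ≡ true
      Ze = Z-crossing Fe ce

      ∂Z-remove : ∀ v → D v ≡ false → ∂ (Z ⊕ pt e) v ≡ pt a v xor pt x v
      ∂Z-remove v Dv = trans (∂-remove Z ends v)
        (cong₂ _xor_ (∂Z v Dv) (cong (_xor pt x v) (pt-≢ (crossing-ends-≢ Dd Dv))))

      -- Deleting e makes `a` even, so what is left of Z is even outside D and the second crossing
      -- edge can be used.
      startAtEnd : a ≡ x → Swap F
      startAtEnd a≡x = returnFromEven (Z ⊕ pt e) (remove-⊆ Z Ze)
        (λ v Dv → trans (∂Z-remove v Dv) (trans (cong (λ u → pt u v xor pt x v) a≡x) (𝔹ₚ.xor-same (pt x v))))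
        Fe′ ce′ (cong₂ _xor_ (Z-crossing Fe′ ce′) (pt-≢ e≢e′))

      -- Outside D only `a` and x are odd after the deletion of e, so the walk has ended in `a`.
      -- Removing it leaves a set that is even outside D and still contains e′, because J does not
      -- meet δ(D).
      absorbed : ∀ J y → J ⊆ Z ⊕ pt e → Joins J x y → D y ≡ false → ∂ (Z ⊕ pt e) y ≡ true →
                 y ≢ x → cnt D J ≤ 0 → Swap F
      absorbed J y J⊆ jJ Dy odd-y y≢x J≤0 = returnFromEven Y Y⊆Z ∂Y Fe′ ce′ Ye′
        where
        Y : Fin m → Bool
        Y = (Z ⊕ pt e) ⊕ J
        a≡y : a ≡ y
        a≡y = pt-true (trans (sym (trans (∂Z-remove y Dy)
          (trans (cong (pt a y xor_) (pt-≢ (y≢x ∘ sym))) (𝔹ₚ.xor-identityʳ _)))) odd-y)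
        Y⊆Z : Y ⊆ Z
        Y⊆Z = ⊕-⊆ (Z ⊕ pt e) J Z (remove-⊆ Z Ze) (λ i Ji → remove-⊆ Z Ze i (J⊆ i Ji))
        ∂Y : ∀ v → D v ≡ false → ∂ Y v ≡ false
        ∂Y v Dv = trans (∂-⊕ (Z ⊕ pt e) J v) (trans (cong₂ _xor_ (∂Z-remove v Dv)
          (trans (jJ v) (cong (λ u → pt x v xor pt u v) (sym a≡y))))
          (solve 2 (λ a x → (a :+ x) :+ (x :+ a) := con false) refl (pt a v) (pt x v)))
        J∌e′ : J e′ ≡ false
        J∌e′ = 𝔹ₚ.¬-not λ Je′ →
          contradiction (ℕₚ.≤-trans (subst (_≤ cnt D J) (χ-true {D} ce′) (≤-wt (χ D) J Je′)) J≤0) λ ()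
        Ye′ : Y e′ ≡ true
        Ye′ = cong₂ _xor_ (cong₂ _xor_ (Z-crossing Fe′ ce′) (pt-≢ e≢e′)) J∌e′

      startElsewhere : a ≢ x → Swap F
      startElsewhere a≢x = finish (findWalk D (size (Z ⊕ pt e)) (Z ⊕ pt e) x ℕₚ.≤-refl Dx
          (trans (∂Z-remove x Dx) (cong₂ _xor_ (pt-≢ a≢x) (pt-refl x))))
        where
        finish : Walk D (Z ⊕ pt e) x → Swap F
        finish (walk J y J⊆ jJ (inj₁ (Dy , J≤1))) =
          close Fe ce ends Dd (λ i Ji → remove-⊆ Z Ze i (J⊆ i Ji)) (∉-remove Z J Ze J⊆) jJ Dy J≤1
        finish (walk J y J⊆ jJ (inj₂ (Dy , odd-y , y≢x , J≤0))) = absorbed J y J⊆ jJ Dy odd-y y≢x J≤0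

    -- A walk in Z leaving D either comes back to D or is absorbed at a; in the
    -- latter case what remains of Z is even outside D, so a second one comes back.
    findSwap : 2 ≤ cnt D F → Swap F
    findSwap F≥2 =
      let e , Fe , χe≥1 = wt-positive (χ D) F (ℕₚ.≤-trans (s≤s z≤n) F≥2)
          ce = χ-positive {D} χe≥1
          d , x , Dd , Dx , ends = crosses-true D e ce
          e′ , e≢e′ , Fe′ , ce′ = second Fe F≥2
      in case a Finₚ.≟ x of λ
        { (yes a≡x) → startAtEnd Fe ce ends Dd Dx e≢e′ Fe′ ce′ a≡x
        ; (no a≢x)  → startElsewhere Fe ce ends Dd Dx e≢e′ Fe′ ce′ a≢x }

  -- An edge of positive weight in C lies in exactly one of F and `K`, and adding C to both hands it
  -- to the other.
  exchange-wt : ∀ F C → (∀ i → C i ≡ true → (F ⊕ K) i ≡ true ⊎ W i ≡ 0) →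
                wt W (F ⊕ C) + wt W (K ⊕ C) ≡ wt W F + wt W K
  exchange-wt F C sub = begin
    wt W (F ⊕ C) + wt W (K ⊕ C)
      ≡⟨ ℕΣ.∑-distrib-+ (restrict W (F ⊕ C)) (restrict W (K ⊕ C)) ⟨
    sum (λ i → restrict W (F ⊕ C) i + restrict W (K ⊕ C) i)
      ≡⟨ sum-cong-≗ pointwise ⟩
    sum (λ i → restrict W F i + restrict W K i)
      ≡⟨ ℕΣ.∑-distrib-+ (restrict W F) (restrict W K) ⟩
    wt W F + wt W K ∎
    where
    open ≡-Reasoning
    pointwise : ∀ i → restrict W (F ⊕ C) i + restrict W (K ⊕ C) i ≡ restrict W F i + restrict W K i
    pointwise i with F i | K i | C i | sub i
    ... | f     | k     | false | _ rewrite 𝔹ₚ.xor-identityʳ f | 𝔹ₚ.xor-identityʳ k = refl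
    ... | true  | false | true  | _ = sym (ℕₚ.+-identityʳ _)
    ... | false | true  | true  | _ = ℕₚ.+-identityʳ _
    ... | true  | true  | true  | q with q refl
    ...   | inj₂ eq rewrite eq = refl
    pointwise i | false | false | true | q with q refl
    ...   | inj₂ eq rewrite eq = refl

  -- Induction on the number of crossing edges. An exchange costs F at most 2 of them, while its
  -- weight drops by at least 2: the total weight of F and `K` is unchanged, and K ⊕ C, which uses
  -- δ(D), exceeds `K` by 2. When at most one crossing edge is left, the 1 on the right pays for it.
  gap : ∀ k L → (∀ F → ∂ F ≗ T → L ≤ wt W F) → ∀ F → ∂ F ≗ T → cnt D F ≤ k → L + cnt D F ≤ 1 + wt W F
  gap k L L≤ F ∂F F≤k with 2 ℕₚ.≤? cnt D F
  ... | no  F≱2 = subst (_≤ 1 + wt W F) (ℕₚ.+-comm (cnt D F) L)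
                    (ℕₚ.+-mono-≤ (ℕₚ.≤-pred (ℕₚ.≰⇒> F≱2)) (L≤ F ∂F))
  ... | yes F≥2 with findSwap F ∂F F≥2
  ...   | swap C even sub few e Ce ce = step k F≤k
    where
    ∂FC : ∂ (F ⊕ C) ≗ T
    ∂FC v = trans (∂-⊕ F C v) (trans (cong₂ _xor_ (∂F v) (even v)) (𝔹ₚ.xor-identityʳ _))
    ∂KC : ∂ (K ⊕ C) ≗ T ⊕ pt a ⊕ pt b
    ∂KC v = trans (∂-⊕ K C v) (trans (cong₂ _xor_ (∂K v) (even v)) (𝔹ₚ.xor-identityʳ _))
    crossing-sub : ∀ i → crosses D i ≡ true → C i ≡ true → F i ≡ true
    crossing-sub i ci Ci with sub i Ci
    ... | inj₁ Zi = trans (sym (trans (cong (F i xor_) (K-avoids i ci)) (𝔹ₚ.xor-identityʳ _))) Zi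
    ... | inj₂ Wi = contradiction (subst (1 ≤_) Wi (crossing-positive i ci)) λ ()
    C⊆F : ∀ i → C i ≡ true → F i ≡ true ⊎ χ D i ≡ 0
    C⊆F i Ci with crosses D i in ci
    ... | true  = inj₁ (crossing-sub i ci Ci)
    ... | false = inj₂ refl
    cnt-FC : cnt D (F ⊕ C) + cnt D C ≡ cnt D F
    cnt-FC = wt-difference (χ D) F C C⊆F
    KC-edge : (K ⊕ C) e ≡ true
    KC-edge = cong₂ _xor_ (K-avoids e ce) Ce
    saving : 2 + wt W (F ⊕ C) ≤ wt W F
    saving = ℕₚ.+-cancelʳ-≤ (wt W K) _ _ (begin
      2 + wt W (F ⊕ C) + wt W K       ≡⟨ cong (_+ wt W K) (ℕₚ.+-comm 2 (wt W (F ⊕ C))) ⟩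
      wt W (F ⊕ C) + 2 + wt W K       ≡⟨ ℕₚ.+-assoc (wt W (F ⊕ C)) 2 (wt W K) ⟩
      wt W (F ⊕ C) + (2 + wt W K)     ≤⟨ ℕₚ.+-monoʳ-≤ (wt W (F ⊕ C)) (crossing-heavier (K ⊕ C) ∂KC e KC-edge ce) ⟩
      wt W (F ⊕ C) + wt W (K ⊕ C)     ≡⟨ exchange-wt F C sub ⟩
      wt W F + wt W K                 ∎)
      where open ℕₚ.≤-Reasoning
    C≥1 : 1 ≤ cnt D C
    C≥1 = subst (_≤ cnt D C) (χ-true {D} ce) (≤-wt (χ D) C Ce)
    step : ∀ k → cnt D F ≤ k → L + cnt D F ≤ 1 + wt W F
    step zero    F≤0 = contradiction (ℕₚ.≤-trans F≥2 F≤0) λ ()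
    step (suc k) F≤k = begin
      L + cnt D F                     ≡⟨ cong (_+_ L) cnt-FC ⟨
      L + (cnt D (F ⊕ C) + cnt D C)   ≤⟨ ℕₚ.+-monoʳ-≤ L (ℕₚ.+-monoʳ-≤ (cnt D (F ⊕ C)) few) ⟩
      L + (cnt D (F ⊕ C) + 2)         ≡⟨ ℕₚ.+-assoc L (cnt D (F ⊕ C)) 2 ⟨
      L + cnt D (F ⊕ C) + 2           ≤⟨ ℕₚ.+-monoˡ-≤ 2 (gap k L L≤ (F ⊕ C) ∂FC smaller) ⟩
      1 + wt W (F ⊕ C) + 2            ≡⟨ cong suc (ℕₚ.+-comm (wt W (F ⊕ C)) 2) ⟩
      1 + (2 + wt W (F ⊕ C))          ≤⟨ s≤s saving ⟩
      1 + wt W F                      ∎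
      where
      open ℕₚ.≤-Reasoning
      smaller : cnt D (F ⊕ C) ≤ k
      smaller = ℕₚ.≤-pred (begin
        1 + cnt D (F ⊕ C)             ≤⟨ ℕₚ.+-monoˡ-≤ (cnt D (F ⊕ C)) C≥1 ⟩
        cnt D C + cnt D (F ⊕ C)       ≡⟨ ℕₚ.+-comm (cnt D C) _ ⟩
        cnt D (F ⊕ C) + cnt D C       ≡⟨ cnt-FC ⟩
        cnt D F                       ≤⟨ F≤k ⟩
        suc k                         ∎)

-- Light joins by repeated reduction of the weights

infix 7 _∙_
_∙_ : (Fin m → ℕ) → (Fin m → ℕ) → ℕ
X ∙ W = sum λ i → X i * W i

∙-+ : (X A B : Fin m → ℕ) → X ∙ (λ i → A i + B i) ≡ X ∙ A + X ∙ B
∙-+ X A B = trans (sum-cong-≗ λ i → ℕₚ.*-distribˡ-+ (X i) (A i) (B i))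
                  (ℕΣ.∑-distrib-+ (λ i → X i * A i) (λ i → X i * B i))

∙-cong : {X X′ W W′ : Fin m → ℕ} → X ≗ X′ → W ≗ W′ → X ∙ W ≡ X′ ∙ W′
∙-cong eq eq′ = sum-cong-≗ λ i → cong₂ _*_ (eq i) (eq′ i)

module _ {n m : ℕ} (s t : Fin m → Fin n) where
  open Multigraph s t
  open Walks s t

  minimumJoin : ∀ W (T : Fin n → Bool) F₀ → ∂ F₀ ≗ T →
                ∃[ F ] (∂ F ≗ T × (∀ G → ∂ G ≗ T → wt W F ≤ wt W G))
  minimumJoin W T F₀ ∂F₀ =
    let (F , ∂F) , least = minimal (λ (F , _) → wt W F) below? (F₀ , ∂F₀)
    in F , ∂F , λ G ∂G → least (G , ∂G)
    where
    below? : ∀ k → Dec (∃[ a ] wt W (proj₁ {B = λ F → ∂ F ≗ T} a) < k)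
    below? k = map′ (λ (F , ∂F , w) → (F , ∂F) , w) (λ ((F , ∂F) , w) → F , ∂F , w)
      (anyPredicate?
        (λ {F} {G} F≗G (∂F , w) → (λ v → trans (sym (∂-cong {F} {G} F≗G v)) (∂F v)) ,
                                  subst (_< k) (wt-cong {W} {F} {G} F≗G) w)
        (λ F → Finₚ.all? (λ v → ∂ F v 𝔹ₚ.≟ T v) ×-dec (wt W F ℕₚ.<? k)))

  Twisted : (Fin n → Bool) → Set
  Twisted T = ∃[ a ] ∃[ b ] ∃[ F ] ∂ F ≗ T ⊕ pt a ⊕ pt b

  twistedWt : ∀ W T → Twisted T → ℕ
  twistedWt W T (a , b , F , _) = wt W F

  minimumTwisted : ∀ W T (τ₀ : Twisted T) → ∃[ τ ] (∀ σ → twistedWt W T τ ≤ twistedWt W T σ)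
  minimumTwisted W T τ₀ = minimal (twistedWt W T) below? τ₀
    where
    below? : ∀ k → Dec (∃[ τ ] twistedWt W T τ < k)
    below? k = map′ (λ (a , b , F , ∂F , w) → (a , b , F , ∂F) , w) (λ ((a , b , F , ∂F) , w) → a , b , F , ∂F , w)
      (Finₚ.any? λ a → Finₚ.any? λ b → anyPredicate?
        (λ {F} {G} F≗G (∂F , w) → (λ v → trans (sym (∂-cong {F} {G} F≗G v)) (∂F v)) ,
                                  subst (_< k) (wt-cong {W} {F} {G} F≗G) w)
        (λ F → Finₚ.all? (λ v → ∂ F v 𝔹ₚ.≟ (T ⊕ pt a ⊕ pt b) v) ×-dec (wt W F ℕₚ.<? k)))

  wt-+ : ∀ A B F → wt (λ i → A i + B i) F ≡ wt A F + wt B F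
  wt-+ A B F = trans (sum-cong-≗ pointwise) (ℕΣ.∑-distrib-+ (restrict A F) (restrict B F))
    where
    pointwise : ∀ i → restrict (λ i → A i + B i) F i ≡ restrict A F i + restrict B F i
    pointwise i with F i
    ... | true  = refl
    ... | false = refl

  wt-congʷ : ∀ {A B} F → A ≗ B → wt A F ≡ wt B F
  wt-congʷ F A≗B = sum-cong-≗ λ i → cong (λ w → if F i then w else 0) (A≗B i)

  odd-χ : ∀ D i → odd (χ D i) ≡ crosses D i
  odd-χ D i with crosses D i
  ... | true  = refl
  ... | false = refl

  crosses-⊕ : ∀ p D i → crosses (p ⊕ D) i ≡ crosses p i xor crosses D i
  crosses-⊕ p D i = solve 4 (λ a b c d → (a :+ b) :+ (c :+ d) := (a :+ c) :+ (b :+ d)) refl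
    (p (s i)) (D (s i)) (p (t i)) (D (t i))
    where open xor-∧-Solver using (solve; _:+_; _:=_)

  -- A cut δ(D) such that lowering W by one on it lowers the minimum weight L of
  -- a T-join by at most one.
  record Reduction (W : Fin m → ℕ) (L : ℕ) (T : Fin n → Bool) : Set where
    field
      D      : Fin n → Bool
      inside outside : Fin n
      in-D   : D inside ≡ true
      out-D  : D outside ≡ false
      χ≤W    : ∀ i → χ D i ≤ W i
      gap    : ∀ F → ∂ F ≗ T → L + cnt D F ≤ 1 + wt W F

  reduction : ∀ W p → (∀ i → odd (W i) ≡ crosses p i) → ∀ T F → ∂ F ≗ T →
              (∀ G → ∂ G ≗ T → wt W F ≤ wt W G) → 1 ≤ wt W F → Reduction W (wt W F) T
  reduction W p parity T F ∂F least F≥1 = build (minimumTwisted W T τ₀)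
    where
    heavyEdge = wt-positive W F F≥1
    i  = proj₁ heavyEdge
    Fi = proj₁ (proj₂ heavyEdge)
    -- Dropping an edge of positive weight from the minimum join F shows that the lightest twisted
    -- join is strictly lighter than every T-join.
    τ₀ : Twisted T
    τ₀ = s i , t i , F ⊕ pt i , λ v → trans (∂-⊕ F (pt i) v)
      (trans (cong₂ _xor_ (∂F v) (∂-pt i v)) (sym (𝔹ₚ.xor-assoc (T v) (pt (s i) v) (pt (t i) v))))
    τ₀-lighter : twistedWt W T τ₀ < wt W F
    τ₀-lighter = subst (wt W (F ⊕ pt i) <_) (wt-remove W F Fi)
      (subst (_≤ wt W (F ⊕ pt i) + W i) (ℕₚ.+-comm _ 1)
        (ℕₚ.+-monoʳ-≤ (wt W (F ⊕ pt i)) (proj₂ (proj₂ heavyEdge))))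
    build : ∃[ τ ] (∀ σ → twistedWt W T τ ≤ twistedWt W T σ) → Reduction W (wt W F) T
    build ((a , b , K , ∂K) , K-least) = record
      { D = D ; inside = b ; outside = a ; in-D = E.b∈D ; out-D = E.a∉D ; χ≤W = E.χ≤W
      ; gap = λ G ∂G → E.gap _ (wt W F) least G ∂G ℕₚ.≤-refl }
      where
      open Distance s t W b using (D)
      module E = Exchange s t W p parity T a b K ∂K (λ G x y ∂G → K-least (x , y , G , ∂G))
                   (λ G ∂G → ℕₚ.<-≤-trans (ℕₚ.≤-<-trans (K-least τ₀) τ₀-lighter) (least G ∂G))

  module _ (X : Fin m → ℕ) (k : ℕ)
           (cut : ∀ D u v → D u ≡ true → D v ≡ false → suc k ≤ X ∙ χ D) where

    -- The edges of odd weight form the cut of p; lowering W on δ(D) replaces p by p ⊕ D. Each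
    -- reduction lowers X ∙ W by at least suc k, thus by at least 1, so a bound on X ∙ W bounds the
    -- number of reductions.
    joinBound : ∀ fuel W p → (∀ i → odd (W i) ≡ crosses p i) → ∀ T F₀ → ∂ F₀ ≗ T → X ∙ W ≤ fuel →
                ∃[ F ] (∂ F ≗ T × suc k * wt W F ≤ X ∙ W)
    joinBound fuel W p parity T F₀ ∂F₀ W≤fuel =
      let F , ∂F , least = minimumJoin W T F₀ ∂F₀
      in F , ∂F , bound F ∂F least (1 ℕₚ.≤? wt W F) fuel W≤fuel
      where
      bound : ∀ F → ∂ F ≗ T → (∀ G → ∂ G ≗ T → wt W F ≤ wt W G) → Dec (1 ≤ wt W F) →
              ∀ fuel → X ∙ W ≤ fuel → suc k * wt W F ≤ X ∙ W
      bound F ∂F least (no F≱1) _ _ rewrite ℕₚ.n<1⇒n≡0 (ℕₚ.≰⇒> F≱1) | ℕₚ.*-zeroʳ k = z≤n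
      bound F ∂F least (yes F≥1) fuel W≤fuel = reduced fuel W≤fuel
        where
        open Reduction (reduction W p parity T F ∂F least F≥1)
        W′ : Fin m → ℕ
        W′ i = W i ∸ χ D i
        split : ∀ i → W i ≡ W′ i + χ D i
        split i = sym (ℕₚ.m∸n+n≡m (χ≤W i))
        parity′ : ∀ i → odd (W′ i) ≡ crosses (p ⊕ D) i
        parity′ i = begin
          odd (W′ i)                                       ≡⟨ 𝔹ₚ.xor-identityʳ _ ⟨
          odd (W′ i) xor false                             ≡⟨ cong (odd (W′ i) xor_) (𝔹ₚ.xor-same (odd (χ D i))) ⟨
          odd (W′ i) xor (odd (χ D i) xor odd (χ D i))     ≡⟨ 𝔹ₚ.xor-assoc (odd (W′ i)) _ _ ⟨
          (odd (W′ i) xor odd (χ D i)) xor odd (χ D i)     ≡⟨ cong₂ _xor_ (trans (sym (odd-+ (W′ i) (χ D i))) (cong odd (sym (split i)))) (odd-χ D i) ⟩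
          odd (W i) xor crosses D i                        ≡⟨ cong (_xor crosses D i) (parity i) ⟩
          crosses p i xor crosses D i                      ≡⟨ crosses-⊕ p D i ⟨
          crosses (p ⊕ D) i                                ∎
          where open ≡-Reasoning
        X∙W : X ∙ W ≡ X ∙ W′ + X ∙ χ D
        X∙W = trans (∙-cong {X = X} (λ _ → refl) split) (∙-+ X W′ (χ D))
        cut-D : suc k ≤ X ∙ χ D
        cut-D = cut D inside outside in-D out-D
        reduced : ∀ fuel → X ∙ W ≤ fuel → suc k * wt W F ≤ X ∙ W
        reduced zero W≤0 = contradiction (ℕₚ.≤-trans (ℕₚ.≤-trans cut-D (ℕₚ.m≤n+m _ _))
          (ℕₚ.≤-trans (ℕₚ.≤-reflexive (sym X∙W)) W≤0)) λ ()
        reduced (suc fuel) W≤fuel =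
          let G , ∂G , G-bound = joinBound fuel W′ (p ⊕ D) parity′ T F₀ ∂F₀ smaller
          in begin
            suc k * wt W F            ≤⟨ ℕₚ.*-monoʳ-≤ (suc k) (F≤ G ∂G) ⟩
            suc k * (wt W′ G + 1)     ≡⟨ trans (ℕₚ.*-distribˡ-+ (suc k) (wt W′ G) 1) (cong (_+_ (suc k * wt W′ G)) (ℕₚ.*-identityʳ (suc k))) ⟩
            suc k * wt W′ G + suc k   ≤⟨ ℕₚ.+-mono-≤ G-bound cut-D ⟩
            X ∙ W′ + X ∙ χ D          ≡⟨ X∙W ⟨
            X ∙ W                     ∎
          where
          open ℕₚ.≤-Reasoning
          smaller : X ∙ W′ ≤ fuel
          smaller = ℕₚ.+-cancelʳ-≤ 1 _ _ (begin
            X ∙ W′ + 1                ≤⟨ ℕₚ.+-monoʳ-≤ (X ∙ W′) (ℕₚ.≤-trans (s≤s z≤n) cut-D) ⟩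
            X ∙ W′ + X ∙ χ D          ≡⟨ X∙W ⟨
            X ∙ W                     ≤⟨ W≤fuel ⟩
            suc fuel                  ≡⟨ ℕₚ.+-comm 1 fuel ⟩
            fuel + 1                  ∎)
          F≤ : ∀ G → ∂ G ≗ T → wt W F ≤ wt W′ G + 1
          F≤ G ∂G = ℕₚ.+-cancelʳ-≤ (cnt D G) _ _ (begin
            wt W F + cnt D G          ≤⟨ gap G ∂G ⟩
            1 + wt W G                ≡⟨ cong suc (trans (wt-congʷ G split) (wt-+ W′ (χ D) G)) ⟩
            1 + (wt W′ G + cnt D G)   ≡⟨ cong (_+ cnt D G) (ℕₚ.+-comm 1 (wt W′ G)) ⟩
            wt W′ G + 1 + cnt D G     ∎)

    -- Doubling the weights makes them all even, so that the empty cut can serve as the set of odd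
    -- edges; both sides are halved afterwards.
    lightJoin : ∀ W F₀ → ∃[ F ] (∂ F ≗ ∂ F₀ × suc k * wt W F ≤ X ∙ W)
    lightJoin W F₀ =
      let F , ∂F , bound = joinBound (X ∙ (λ i → W i + W i)) (λ i → W i + W i) (λ _ → false)
                             (λ i → trans (odd-+ (W i) (W i)) (𝔹ₚ.xor-same (odd (W i)))) (∂ F₀) F₀ (λ _ → refl) ℕₚ.≤-refl
      in F , ∂F , halve (subst₂ _≤_ (trans (cong (suc k *_) (wt-+ W W F)) (ℕₚ.*-distribˡ-+ (suc k) (wt W F) (wt W F)))
                                  (∙-+ X W W) bound)
      where
      halve : ∀ {x y} → x + x ≤ y + y → x ≤ y
      halve {x} {y} le = ℕₚ.≮⇒≥ λ y<x → ℕₚ.<⇒≱ (ℕₚ.+-mono-< y<x y<x) le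

-- Spanning trees

-- Contraction of two classes: p receives the index that q has once p is removed, and all other
-- classes close ranks.
merge : ∀ {c} {p q : Fin (suc (suc c))} → p ≢ q → Fin (suc (suc c)) → Fin (suc c)
merge {p = p} p≢q x with p Finₚ.≟ x
... | yes _  = punchOut p≢q
... | no p≢x = punchOut p≢x

merge-punchIn : ∀ {c} {p q : Fin (suc (suc c))} (p≢q : p ≢ q) r → merge p≢q (punchIn p r) ≡ r
merge-punchIn {p = p} p≢q r with p Finₚ.≟ punchIn p r
... | yes p≡ = contradiction (sym p≡) (Finₚ.punchInᵢ≢i p r)
... | no _   = trans (Finₚ.punchOut-cong p refl) (Finₚ.punchOut-punchIn p)

merge-eq : ∀ {c} {p q : Fin (suc (suc c))} (p≢q : p ≢ q) x y → merge p≢q x ≡ merge p≢q y →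
           x ≡ y ⊎ (x ≡ p × y ≡ q) ⊎ (x ≡ q × y ≡ p)
merge-eq {p = p} p≢q x y eq with p Finₚ.≟ x | p Finₚ.≟ y
... | yes p≡x | yes p≡y = inj₁ (trans (sym p≡x) p≡y)
... | yes p≡x | no p≢y  = inj₂ (inj₁ (sym p≡x , sym (Finₚ.punchOut-injective p≢q p≢y eq)))
... | no p≢x  | yes p≡y = inj₂ (inj₂ (Finₚ.punchOut-injective p≢x p≢q eq , sym p≡y))
... | no p≢x  | no p≢y  = inj₁ (Finₚ.punchOut-injective p≢x p≢y eq)

Fin1-unique : (x y : Fin 1) → x ≡ y
Fin1-unique zero zero = refl

module Spanning {n m : ℕ} (s t : Fin m → Fin n) where
  open Multigraph s t
  open Walks s t using (size)

  Link : (Fin m → Bool) → Fin n → Fin n → Set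
  Link F u v = ∃[ i ] (F i ≡ true × Ends i u v)

  sep : ∀ {c} → (Fin n → Fin c) → Fin m → Bool
  sep lab i = not (pt (lab (s i)) (lab (t i)))

  sep-true : ∀ {c} (lab : Fin n → Fin c) i → sep lab i ≡ true → lab (s i) ≢ lab (t i)
  sep-true lab i eq same = case trans (sym eq) (cong not (trans (cong (pt (lab (s i))) (sym same)) (pt-refl (lab (s i))))) of λ ()

  sep-false : ∀ {c} (lab : Fin n → Fin c) i → sep lab i ≡ false → lab (s i) ≡ lab (t i)
  sep-false lab i eq = pt-true (trans (sym (𝔹ₚ.not-involutive _)) (cong not eq))

  class : ∀ {c} → (Fin n → Fin c) → Fin c → Fin n → Bool
  class lab r v = pt (lab v) r

  module Merging {c} (lab : Fin n → Fin (suc (suc c))) (rep : Fin (suc (suc c)) → Fin n)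
                 (lab-rep : ∀ r → lab (rep r) ≡ r) (i : Fin m) (i-sep : sep lab i ≡ true) where

    lab′ : Fin n → Fin (suc c)
    lab′ v = merge (sep-true lab i i-sep) (lab v)

    rep′ : Fin (suc c) → Fin n
    rep′ r = rep (punchIn (lab (s i)) r)

    lab′-rep′ : ∀ r → lab′ (rep′ r) ≡ r
    lab′-rep′ r = trans (cong (merge (sep-true lab i i-sep)) (lab-rep (punchIn (lab (s i)) r)))
                        (merge-punchIn (sep-true lab i i-sep) r)

    connect : ∀ {R : Fin n → Fin n → Set} → (∀ u v → lab u ≡ lab v → Star R u v) →
              R (s i) (t i) → R (t i) (s i) → ∀ u v → lab′ u ≡ lab′ v → Star R u v
    connect same st ts u v eq with merge-eq (sep-true lab i i-sep) (lab u) (lab v) eq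
    ... | inj₁ u~v = same u v u~v
    ... | inj₂ (inj₁ (u~s , v~t)) = same u (s i) u~s ◅◅ st ◅ same (t i) v (sym v~t)
    ... | inj₂ (inj₂ (u~t , v~s)) = same u (t i) u~t ◅◅ ts ◅ same (s i) v (sym v~s)

  Closed : (Fin m → Bool) → Set
  Closed F = ∃[ D ] ∃[ u ] ∃[ v ] (D u ≡ true × D v ≡ false × (∀ i → F i ≡ true → crosses D i ≡ false))

  -- Contract edges of F as long as one joins two classes. In the end there is a single class, or F
  -- leaves none of the remaining classes.
  connectedOrClosed : ∀ F c (lab : Fin n → Fin (suc c)) (rep : Fin (suc c) → Fin n) →
                      (∀ r → lab (rep r) ≡ r) → (∀ u v → lab u ≡ lab v → Star (Link F) u v) →
                      (∀ u v → Star (Link F) u v) ⊎ Closed F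
  connectedOrClosed F zero    lab rep lab-rep same = inj₁ λ u v → same u v (Fin1-unique (lab u) (lab v))
  connectedOrClosed F (suc c) lab rep lab-rep same = split (Finₚ.any? λ i → (F i 𝔹ₚ.≟ true) ×-dec (sep lab i 𝔹ₚ.≟ true))
    where
    split : Dec (∃[ i ] (F i ≡ true × sep lab i ≡ true)) → (∀ u v → Star (Link F) u v) ⊎ Closed F
    split (yes (i , Fi , i-sep)) = connectedOrClosed F c M.lab′ M.rep′ M.lab′-rep′
      (M.connect same (i , Fi , inj₁ (refl , refl)) (i , Fi , inj₂ (refl , refl)))
      where module M = Merging lab rep lab-rep i i-sep
    split (no none) = inj₂ (class lab zero , rep zero , rep (suc zero) ,
      trans (cong (λ r → pt r zero) (lab-rep zero)) refl ,
      trans (cong (λ r → pt r zero) (lab-rep (suc zero))) refl ,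
      λ i Fi → trans (cong (λ r → class lab zero (s i) xor pt r zero)
                  (sym (sep-false lab i (𝔹ₚ.¬-not λ i-sep → none (i , Fi , i-sep)))))
                  (𝔹ₚ.xor-same (class lab zero (s i))))

  closed-invariant : ∀ {F} ((D , _) : Closed F) → ∀ {u v} → Star (Link F) u v → D u ≡ D v
  closed-invariant _ ε = refl
  closed-invariant cl@(D , _ , _ , _ , _ , noCross) ((i , Fi , ends) ◅ rest) =
    trans (xor-false (trans (sym (crosses-ends ends D)) (noCross i Fi))) (closed-invariant cl rest)
    where
    xor-false : ∀ {a b} → a xor b ≡ false → a ≡ b
    xor-false {true}  {true}  _ = refl
    xor-false {false} {false} _ = refl

  module _ (X : Fin m → ℕ) (k : ℕ)
           (cut : ∀ D u v → D u ≡ true → D v ≡ false → suc k ≤ X ∙ χ D) where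

    -- Each class is one side of a genuine cut, as `rep` supplies a vertex in it and one in another
    -- class. Summing the cut bound over the classes counts every separating edge at most twice.
    sep-bound : ∀ {c} (lab : Fin n → Fin (suc (suc c))) (rep : Fin (suc (suc c)) → Fin n) →
                (∀ r → lab (rep r) ≡ r) → suc (suc c) * suc k ≤ 2 * (X ∙ restrict (λ _ → 1) (sep lab))
    sep-bound {c} lab rep lab-rep = begin
      suc (suc c) * suc k
        ≡⟨ sum-const (suc (suc c)) ⟨
      sum {suc (suc c)} (λ _ → suc k)
        ≤⟨ sum-mono-≤ (λ r → cut (class lab r) (rep r) (rep (punchIn r zero))
             (trans (cong (λ x → pt x r) (lab-rep r)) (pt-refl r))
             (trans (cong (λ x → pt x r) (lab-rep (punchIn r zero))) (pt-≢ (Finₚ.punchInᵢ≢i r zero)))) ⟩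
      sum (λ r → sum λ i → X i * χ (class lab r) i)
        ≡⟨ ℕΣ.∑-comm (λ r i → X i * χ (class lab r) i) ⟩
      sum (λ i → sum λ r → X i * χ (class lab r) i)
        ≡⟨ sum-cong-≗ (λ i → sym (ℕΣ.*-distribˡ-sum (X i) (λ r → χ (class lab r) i))) ⟩
      sum (λ i → X i * sum λ r → χ (class lab r) i)
        ≤⟨ sum-mono-≤ (λ i → ℕₚ.*-monoʳ-≤ (X i) (sides i)) ⟩
      sum (λ i → X i * (2 * restrict (λ _ → 1) (sep lab) i))
        ≡⟨ sum-cong-≗ (λ i → swap-* (X i) (restrict (λ _ → 1) (sep lab) i)) ⟩
      sum (λ i → 2 * (X i * restrict (λ _ → 1) (sep lab) i))
        ≡⟨ ℕΣ.*-distribˡ-sum 2 (λ i → X i * restrict (λ _ → 1) (sep lab) i) ⟨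
      2 * (X ∙ restrict (λ _ → 1) (sep lab)) ∎
      where
      open ℕₚ.≤-Reasoning
      swap-* : ∀ x y → x * (2 * y) ≡ 2 * (x * y)
      swap-* = solve-∀
      sum-const : ∀ l → sum {l} (λ _ → suc k) ≡ l * suc k
      sum-const zero    = refl
      sum-const (suc l) = cong (_+_ (suc k)) (sum-const l)
      one : ∀ x → sum (λ r → if pt x r then 1 else 0) ≡ 1
      one x = sum-pt (λ _ → 1) x
      sides : ∀ i → sum (λ r → χ (class lab r) i) ≤ 2 * restrict (λ _ → 1) (sep lab) i
      sides i with sep lab i in eq
      ... | false = ℕₚ.≤-reflexive (trans (sum-cong-≗ λ r → cong (if_then 1 else 0)
                      (trans (cong (λ x → pt (lab (s i)) r xor pt x r) (sym (sep-false lab i eq)))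
                             (𝔹ₚ.xor-same (pt (lab (s i)) r)))) (ℕΣ.sum-replicate-zero (suc (suc c))))
      ... | true  = begin
        sum (λ r → χ (class lab r) i)
          ≤⟨ sum-mono-≤ (λ r → term (pt (lab (s i)) r) (pt (lab (t i)) r)) ⟩
        sum (λ r → (if pt (lab (s i)) r then 1 else 0) + (if pt (lab (t i)) r then 1 else 0))
          ≡⟨ ℕΣ.∑-distrib-+ (λ r → if pt (lab (s i)) r then 1 else 0) (λ r → if pt (lab (t i)) r then 1 else 0) ⟩
        sum (λ r → if pt (lab (s i)) r then 1 else 0) + sum (λ r → if pt (lab (t i)) r then 1 else 0)
          ≡⟨ cong₂ _+_ (one (lab (s i))) (one (lab (t i))) ⟩
        2 ∎
        where
        term : ∀ a b → (if a xor b then 1 else 0) ≤ (if a then 1 else 0) + (if b then 1 else 0)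
        term true  true  = z≤n
        term true  false = ℕₚ.≤-refl
        term false true  = ℕₚ.≤-refl
        term false false = z≤n

    lightestSep : ∀ {c} (lab : Fin n → Fin (suc (suc c))) (rep : Fin (suc (suc c)) → Fin n) →
                  (∀ r → lab (rep r) ≡ r) → (W : Fin m → ℕ) →
                  ∃[ i ] (sep lab i ≡ true × (∀ j → sep lab j ≡ true → W i ≤ W j))
    lightestSep lab rep lab-rep W =
      let (i , i-sep) , least = minimal (λ (i , _) → W i) below? (start (X ∙ restrict (λ _ → 1) (sep lab)) refl)
      in i , i-sep , λ j j-sep → least (j , j-sep)
      where
      below? : ∀ l → Dec (∃[ a ] W (proj₁ {B = λ i → sep lab i ≡ true} a) < l)
      below? l = map′ (λ (i , e , w) → (i , e) , w) (λ ((i , e) , w) → i , e , w)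
        (Finₚ.any? λ i → (sep lab i 𝔹ₚ.≟ true) ×-dec (W i ℕₚ.<? l))
      -- A separating edge exists, because by `sep-bound` the separating edges have positive total
      -- capacity.
      start : ∀ x → X ∙ restrict (λ _ → 1) (sep lab) ≡ x → ∃[ i ] sep lab i ≡ true
      start zero eq = contradiction (subst (λ x → _ ≤ 2 * x) eq (sep-bound lab rep lab-rep)) λ ()
      start (suc x) eq =
        let i , p = sum-positive (λ i → X i * restrict (λ _ → 1) (sep lab) i) (subst (1 ≤_) (sym eq) (s≤s z≤n))
        in i , positive i (sep lab i) refl p
        where
        positive : ∀ i b → sep lab i ≡ b → 1 ≤ X i * restrict (λ _ → 1) (sep lab) i → sep lab i ≡ true
        positive i true  eq p = eq
        positive i false eq p = contradiction
          (subst (1 ≤_) (trans (cong (λ b → X i * (if b then 1 else 0)) eq) (ℕₚ.*-zeroʳ (X i))) p) λ ()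

    -- Steps of a walk along F when moving inside a class is free. For the labelling by `id` this is
    -- connectivity by F itself.
    Bridge : ∀ {c} → (Fin m → Bool) → (Fin n → Fin c) → Fin n → Fin n → Set
    Bridge F lab u v = lab u ≡ lab v ⊎ Link F u v

    -- Kruskal's algorithm; every component has at least suc k units of X on its
    -- boundary, so lowering all separating weights by the least of them lowers
    -- the tree by at most c times that amount and 2 (X ∙ W) by at least
    -- (suc c) (suc k) times it.
    kruskal : ∀ c (lab : Fin n → Fin (suc c)) (rep : Fin (suc c) → Fin n) → (∀ r → lab (rep r) ≡ r) → ∀ W →
              ∃[ F ] (size F ≤ c × (∀ u v → Star (Bridge F lab) u v) ×
                      suc k * wt W F ≤ 2 * (X ∙ restrict W (sep lab)))
    kruskal zero lab rep lab-rep W = (λ _ → false) , ℕₚ.≤-reflexive (ℕΣ.sum-replicate-zero m) ,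
      (λ u v → inj₁ (Fin1-unique (lab u) (lab v)) ◅ ε) ,
      subst (_≤ 2 * (X ∙ restrict W (sep lab))) (sym (trans (cong (suc k *_) (ℕΣ.sum-replicate-zero m)) (ℕₚ.*-zeroʳ (suc k)))) z≤n
    kruskal (suc c) lab rep lab-rep W = F , size-F , connected , bound
      where
      lightest = lightestSep lab rep lab-rep W
      i = proj₁ lightest
      i-sep = proj₁ (proj₂ lightest)
      i-least = proj₂ (proj₂ lightest)
      module M = Merging lab rep lab-rep i i-sep
      -- The subtraction may truncate on edges inside a class. The estimate of the tree only needs W
      -- j ≤ W′ j + W i, and the capacity side counts separating edges, where the subtraction is
      -- exact.
      W′ : Fin m → ℕ
      W′ j = W j ∸ W i
      rec = kruskal c M.lab′ M.rep′ M.lab′-rep′ W′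
      F′ = proj₁ rec
      size-F′ = proj₁ (proj₂ rec)
      connected′ = proj₁ (proj₂ (proj₂ rec))
      bound′ = proj₂ (proj₂ (proj₂ rec))
      F : Fin m → Bool
      F j = F′ j ∨ pt i j
      wt-F : ∀ A → wt A F ≤ wt A F′ + A i
      wt-F A = subst (λ x → wt A F ≤ wt A F′ + x) (wt-pt A i)
        (ℕₚ.≤-trans (sum-mono-≤ pointwise) (ℕₚ.≤-reflexive (ℕΣ.∑-distrib-+ (restrict A F′) (restrict A (pt i)))))
        where
        pointwise : ∀ j → restrict A F j ≤ restrict A F′ j + restrict A (pt i) j
        pointwise j with F′ j | pt i j
        ... | true  | _     = ℕₚ.m≤m+n _ _
        ... | false | true  = ℕₚ.≤-refl
        ... | false | false = z≤n
      size-F : size F ≤ suc c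
      size-F = ℕₚ.≤-trans (wt-F (λ _ → 1)) (subst (size F′ + 1 ≤_) (ℕₚ.+-comm c 1) (ℕₚ.+-monoˡ-≤ 1 size-F′))
      Fi : F i ≡ true
      Fi = trans (cong (F′ i ∨_) (pt-refl i)) (𝔹ₚ.∨-zeroʳ (F′ i))
      lift : ∀ {u v} → Bridge F′ M.lab′ u v → Star (Bridge F lab) u v
      lift {u} {v} (inj₁ eq) = M.connect (λ u v eq → inj₁ eq ◅ ε)
        (inj₂ (i , Fi , inj₁ (refl , refl))) (inj₂ (i , Fi , inj₂ (refl , refl))) u v eq
      lift (inj₂ (j , F′j , ends)) = inj₂ (j , cong (_∨ pt i j) F′j , ends) ◅ ε
      connected : ∀ u v → Star (Bridge F lab) u v
      connected u v = Star.concat (Star.map lift (connected′ u v))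
      wt-W : wt W F′ ≤ wt W′ F′ + W i * c
      wt-W = begin
        wt W F′                                        ≤⟨ sum-mono-≤ pointwise ⟩
        sum (λ j → restrict W′ F′ j + W i * restrict (λ _ → 1) F′ j)
          ≡⟨ ℕΣ.∑-distrib-+ (restrict W′ F′) (λ j → W i * restrict (λ _ → 1) F′ j) ⟩
        wt W′ F′ + sum (λ j → W i * restrict (λ _ → 1) F′ j)
          ≡⟨ cong (_+_ (wt W′ F′)) (ℕΣ.*-distribˡ-sum (W i) (restrict (λ _ → 1) F′)) ⟨
        wt W′ F′ + W i * size F′                       ≤⟨ ℕₚ.+-monoʳ-≤ (wt W′ F′) (ℕₚ.*-monoʳ-≤ (W i) size-F′) ⟩
        wt W′ F′ + W i * c                             ∎
        where
        open ℕₚ.≤-Reasoning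
        pointwise : ∀ j → restrict W F′ j ≤ restrict W′ F′ j + W i * restrict (λ _ → 1) F′ j
        pointwise j with F′ j
        ... | false = z≤n
        ... | true  = subst (λ x → W j ≤ W′ j + x) (sym (ℕₚ.*-identityʳ (W i)))
                        (subst (W j ≤_) (ℕₚ.+-comm (W i) (W′ j)) (ℕₚ.m≤n+m∸n (W j) (W i)))
      sep-mono : ∀ j → sep M.lab′ j ≡ true → sep lab j ≡ true
      sep-mono j eq = 𝔹ₚ.¬-not λ eq′ →
        sep-true M.lab′ j eq (cong (merge (sep-true lab i i-sep)) (sep-false lab j eq′))
      X∙W : X ∙ restrict W′ (sep M.lab′) + W i * (X ∙ restrict (λ _ → 1) (sep lab)) ≤ X ∙ restrict W (sep lab)
      X∙W = begin
        X ∙ restrict W′ (sep M.lab′) + W i * (X ∙ restrict (λ _ → 1) (sep lab))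
          ≡⟨ cong (_+_ (X ∙ restrict W′ (sep M.lab′))) (ℕΣ.*-distribˡ-sum (W i) (λ j → X j * restrict (λ _ → 1) (sep lab) j)) ⟩
        X ∙ restrict W′ (sep M.lab′) + sum (λ j → W i * (X j * restrict (λ _ → 1) (sep lab) j))
          ≡⟨ ℕΣ.∑-distrib-+ (λ j → X j * restrict W′ (sep M.lab′) j) (λ j → W i * (X j * restrict (λ _ → 1) (sep lab) j)) ⟨
        sum (λ j → X j * restrict W′ (sep M.lab′) j + W i * (X j * restrict (λ _ → 1) (sep lab) j))
          ≤⟨ sum-mono-≤ pointwise ⟩
        X ∙ restrict W (sep lab) ∎
        where
        open ℕₚ.≤-Reasoning
        factor : ∀ x w y z → x * w + y * (x * z) ≡ x * (w + y * z)
        factor = solve-∀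
        inner : ∀ j → restrict W′ (sep M.lab′) j + W i * restrict (λ _ → 1) (sep lab) j ≤ restrict W (sep lab) j
        inner j with sep lab j in eq | sep M.lab′ j in eq′
        ... | true  | true  = ℕₚ.≤-reflexive (trans (cong (_+_ (W′ j)) (ℕₚ.*-identityʳ (W i))) (ℕₚ.m∸n+n≡m (i-least j eq)))
        ... | true  | false = ℕₚ.≤-trans (ℕₚ.≤-reflexive (ℕₚ.*-identityʳ (W i))) (i-least j eq)
        ... | false | true  = case trans (sym eq) (sep-mono j eq′) of λ ()
        ... | false | false = ℕₚ.≤-reflexive (ℕₚ.*-zeroʳ (W i))
        pointwise : ∀ j → X j * restrict W′ (sep M.lab′) j + W i * (X j * restrict (λ _ → 1) (sep lab) j) ≤ X j * restrict W (sep lab) j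
        pointwise j = ℕₚ.≤-trans (ℕₚ.≤-reflexive (factor (X j) _ (W i) _)) (ℕₚ.*-monoʳ-≤ (X j) (inner j))
      bound : suc k * wt W F ≤ 2 * (X ∙ restrict W (sep lab))
      bound = begin
        suc k * wt W F
          ≤⟨ ℕₚ.*-monoʳ-≤ (suc k) (ℕₚ.≤-trans (wt-F W) (ℕₚ.+-monoˡ-≤ (W i) wt-W)) ⟩
        suc k * (wt W′ F′ + W i * c + W i)
          ≡⟨ regroup (suc k) (wt W′ F′) (W i) c ⟩
        suc k * wt W′ F′ + W i * (suc c * suc k)
          ≤⟨ ℕₚ.+-mono-≤ bound′ (ℕₚ.*-monoʳ-≤ (W i) (ℕₚ.≤-trans (ℕₚ.*-monoˡ-≤ (suc k) (ℕₚ.n≤1+n (suc c))) (sep-bound lab rep lab-rep))) ⟩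
        2 * (X ∙ restrict W′ (sep M.lab′)) + W i * (2 * (X ∙ restrict (λ _ → 1) (sep lab)))
          ≡⟨ factor₂ (X ∙ restrict W′ (sep M.lab′)) (W i) (X ∙ restrict (λ _ → 1) (sep lab)) ⟩
        2 * (X ∙ restrict W′ (sep M.lab′) + W i * (X ∙ restrict (λ _ → 1) (sep lab)))
          ≤⟨ ℕₚ.*-monoʳ-≤ 2 X∙W ⟩
        2 * (X ∙ restrict W (sep lab)) ∎
        where
        open ℕₚ.≤-Reasoning
        regroup : ∀ k x w c → k * (x + w * c + w) ≡ k * x + w * ((1 + c) * k)
        regroup = solve-∀
        factor₂ : ∀ x w y → 2 * x + w * (2 * y) ≡ 2 * (x + w * y)
        factor₂ = solve-∀

-- Farkas' lemma

0<* : ∀ {a b} → 0ℤ ℤ.< a → 0ℤ ℤ.< b → 0ℤ ℤ.< a ℤ.* b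
0<* {+[1+ a ]} {+[1+ b ]} _ _ = ℤ.+<+ (s≤s z≤n)
0<* {+ zero} (ℤ.+<+ ())
0<* {+[1+ a ]} {+ zero} _ (ℤ.+<+ ())

0≤* : ∀ {a b} → 0ℤ ℤ.≤ a → 0ℤ ℤ.≤ b → 0ℤ ℤ.≤ a ℤ.* b
0≤* {+ a} {+ b} _ _ = subst (0ℤ ℤ.≤_) (ℤₚ.pos-* a b) (ℤ.+≤+ z≤n)

0≤*-cancel : ∀ {a b} → 0ℤ ℤ.< a → 0ℤ ℤ.≤ a ℤ.* b → 0ℤ ℤ.≤ b
0≤*-cancel {+[1+ a ]} {+ b}      _ _ = ℤ.+≤+ z≤n
0≤*-cancel {+ zero} (ℤ.+<+ ())
0≤*-cancel {+[1+ a ]} { -[1+ b ]} _ ()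

0≤-neg : ∀ {a} → a ℤ.< 0ℤ → 0ℤ ℤ.≤ ℤ.- a
0≤-neg = ℤₚ.neg-mono-≤ ∘ ℤₚ.<⇒≤

-- A constraint in homogeneous form: x is the entry at the coordinate being eliminated, y the value
-- on the remaining coordinates, and t / s the weight sought for the eliminated one.
value : ℤ → ℤ → ℤ × ℤ → ℤ
value t s (x , y) = t ℤ.* x ℤ.+ s ℤ.* y

-- t / s is the largest lower bound − y / x coming from a list of constraints
-- t x + s y ≥ 0 with x > 0, or 0; it obeys every strict upper bound.
raise : (Ps Ns : List (ℤ × ℤ)) → All (λ (x , y) → 0ℤ ℤ.< x) Ps → All (λ (x , y) → x ℤ.≤ 0ℤ × 0ℤ ℤ.< y) Ns →
        All (λ (x , y) → All (λ (x′ , y′) → 0ℤ ℤ.< value (ℤ.- y) x (x′ , y′)) Ns) Ps →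
        ∃[ t ] ∃[ s ] (0ℤ ℤ.≤ t × 0ℤ ℤ.< s × All (λ q → 0ℤ ℤ.≤ value t s q) Ps × All (λ q → 0ℤ ℤ.< value t s q) Ns)
raise [] Ns _ N-pos _ = 0ℤ , 1ℤ , ℤₚ.≤-refl , ℤ.+<+ (s≤s z≤n) , [] ,
  All.map (λ {(x , y)} (_ , y>0) → subst (0ℤ ℤ.<_) (ident x y) y>0) N-pos
  where
  ident : ∀ x y → y ≡ 0ℤ ℤ.* x ℤ.+ 1ℤ ℤ.* y
  ident = ℤ-solve-∀
raise ((x , y) ∷ Ps) Ns (x>0 ∷ P-pos) N-pos (compat ∷ compats) with raise Ps Ns P-pos N-pos compats
... | t , s , t≥0 , s>0 , P-ok , N-ok with 0ℤ ℤ.≤? value t s (x , y)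
...   | yes ok = t , s , t≥0 , s>0 , ok ∷ P-ok , N-ok
...   | no ¬ok = ℤ.- y , x , -y≥0 , x>0 , ℤₚ.≤-reflexive (self x y) ∷ All.zipWith improve (P-pos , P-ok) , compat
  where
  deficit : 0ℤ ℤ.≤ ℤ.- value t s (x , y)
  deficit = 0≤-neg (ℤₚ.≰⇒> ¬ok)
  self : ∀ x y → 0ℤ ≡ ℤ.- y ℤ.* x ℤ.+ x ℤ.* y
  self = ℤ-solve-∀
  ident₁ : ∀ t s x y → ℤ.- (t ℤ.* x ℤ.+ s ℤ.* y) ℤ.+ t ℤ.* x ≡ s ℤ.* ℤ.- y
  ident₁ = ℤ-solve-∀
  -y≥0 : 0ℤ ℤ.≤ ℤ.- y
  -y≥0 = 0≤*-cancel s>0 (subst (0ℤ ℤ.≤_) (ident₁ t s x y) (ℤₚ.+-mono-≤ deficit (0≤* t≥0 (ℤₚ.<⇒≤ x>0))))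
  ident₂ : ∀ t s x y x′ y′ → x ℤ.* (t ℤ.* x′ ℤ.+ s ℤ.* y′) ℤ.+ x′ ℤ.* ℤ.- (t ℤ.* x ℤ.+ s ℤ.* y) ≡
                             s ℤ.* (ℤ.- y ℤ.* x′ ℤ.+ x ℤ.* y′)
  ident₂ = ℤ-solve-∀
  improve : ∀ {q} → 0ℤ ℤ.< proj₁ q × 0ℤ ℤ.≤ value t s q → 0ℤ ℤ.≤ value (ℤ.- y) x q
  improve {x′ , y′} (x′>0 , ok) = 0≤*-cancel s>0 (subst (0ℤ ℤ.≤_) (ident₂ t s x y x′ y′)
    (ℤₚ.+-mono-≤ (0≤* (ℤₚ.<⇒≤ x>0) ok) (0≤* (ℤₚ.<⇒≤ x′>0) deficit)))

lowerBound : (L : List (ℤ × ℤ)) → ∃[ N ] (0ℤ ℤ.< N × All (λ (x , _) → 0ℤ ℤ.< N ℤ.+ x) L)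
lowerBound [] = 1ℤ , ℤ.+<+ (s≤s z≤n) , []
lowerBound ((x , _) ∷ L) with lowerBound L
... | N , N>0 , ok = N ℤ.+ + ∣ x ∣ , ℤₚ.+-mono-<-≤ N>0 (ℤ.+≤+ z≤n) ,
  subst (0ℤ ℤ.<_) (sym (ℤₚ.+-assoc N (+ ∣ x ∣) x)) (ℤₚ.+-mono-<-≤ N>0 (abs x)) ∷
  All.map (λ {(x′ , _)} p → subst (0ℤ ℤ.<_) (ident N (+ ∣ x ∣) x′) (ℤₚ.+-mono-<-≤ p (ℤ.+≤+ z≤n))) ok
  where
  ident : ∀ a b c → (a ℤ.+ c) ℤ.+ b ≡ (a ℤ.+ b) ℤ.+ c
  ident = ℤ-solve-∀
  abs : ∀ x → 0ℤ ℤ.≤ + ∣ x ∣ ℤ.+ x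
  abs (+ n) = ℤ.+≤+ z≤n
  abs -[1+ n ] = ℤₚ.≤-reflexive (sym (ℤₚ.+-inverseʳ (+ suc n)))

-- The constraints with x > 0 hold only weakly after `raise`. Increasing t / s by 1 / (N s) makes
-- them strict, and a large N keeps the other constraints strict.
select : (Ps Ns : List (ℤ × ℤ)) → All (λ (x , y) → 0ℤ ℤ.< x) Ps → All (λ (x , y) → x ℤ.≤ 0ℤ × 0ℤ ℤ.< y) Ns →
         All (λ (x , y) → All (λ (x′ , y′) → 0ℤ ℤ.< value (ℤ.- y) x (x′ , y′)) Ns) Ps →
         ∃[ t ] ∃[ s ] (0ℤ ℤ.≤ t × 0ℤ ℤ.≤ s × All (λ q → 0ℤ ℤ.< value t s q) Ps × All (λ q → 0ℤ ℤ.< value t s q) Ns)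
select Ps Ns P-pos N-pos compat with raise Ps Ns P-pos N-pos compat | lowerBound Ns
... | t , s , t≥0 , s>0 , P-ok , N-ok | N , N>0 , N-bound =
  N ℤ.* t ℤ.+ 1ℤ , N ℤ.* s ,
  ℤₚ.+-mono-≤ (0≤* (ℤₚ.<⇒≤ N>0) t≥0) (ℤ.+≤+ z≤n) , ℤₚ.<⇒≤ (0<* N>0 s>0) ,
  All.zipWith (λ {(x , y)} (ok , x>0) → subst (0ℤ ℤ.<_) (ident N t s x y)
    (ℤₚ.+-mono-≤-< (0≤* (ℤₚ.<⇒≤ N>0) ok) x>0)) (P-ok , P-pos) ,
  All.zipWith (λ {(x , y)} (ok , b) → subst (0ℤ ℤ.<_) (ident N t s x y) (strict ok b)) (N-ok , N-bound)
  where
  ident : ∀ N t s x y → N ℤ.* (t ℤ.* x ℤ.+ s ℤ.* y) ℤ.+ x ≡ (N ℤ.* t ℤ.+ 1ℤ) ℤ.* x ℤ.+ (N ℤ.* s) ℤ.* y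
  ident = ℤ-solve-∀
  ident₃ : ∀ N v x → (N ℤ.+ x) ℤ.+ N ℤ.* (v ℤ.+ ℤ.- 1ℤ) ≡ N ℤ.* v ℤ.+ x
  ident₃ = ℤ-solve-∀
  -- An integer v > 0 is at least 1, so N v + x is at least N + x.
  strict : ∀ {v x} → 0ℤ ℤ.< v → 0ℤ ℤ.< N ℤ.+ x → 0ℤ ℤ.< N ℤ.* v ℤ.+ x
  strict {v} {x} v>0 b = subst (0ℤ ℤ.<_) (ident₃ N v x)
    (ℤₚ.+-mono-<-≤ b (0≤* (ℤₚ.<⇒≤ N>0) (ℤₚ.+-monoˡ-≤ (ℤ.- 1ℤ) (ℤₚ.i<j⇒suc[i]≤j v>0))))

pair : ∀ {d} → (Fin d → ℕ) → (Fin d → ℤ) → ℤ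
pair w v = ℤΣ.sum λ i → + w i ℤ.* v i

-- Fourier-Motzkin elimination of the first coordinate. P plays the role of a cone; closure under
-- addition yields all positive integral multiples, and the elimination never divides.
module Elimination {d} (P : (Fin (suc d) → ℤ) → Set) (P-resp : ∀ {u v} → u ≗ v → P u → P v)
                   (P-+ : ∀ {u v} → P u → P v → P (λ i → u i ℤ.+ v i)) where

  P-scale : ∀ k {v} → P v → P (λ i → +[1+ k ] ℤ.* v i)
  P-scale zero    {v} Pv = P-resp (λ i → sym (ℤₚ.*-identityˡ (v i))) Pv
  P-scale (suc k) {v} Pv = P-resp (λ i → sym (ℤₚ.suc-* +[1+ k ] (v i))) (P-+ Pv (P-scale k Pv))

  -- The condition on `u zero` ensures that a nonpositive vector found in the projection lifts to
  -- one that is nonpositive in all coordinates.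
  Projected : (Fin d → ℤ) → Set
  Projected v = ∃[ u ] (P u × u zero ℤ.≤ 0ℤ × (u ∘ suc) ≗ v)

  Projected-+ : ∀ {u v} → Projected u → Projected v → Projected (λ i → u i ℤ.+ v i)
  Projected-+ (u , Pu , u≤0 , u≗) (v , Pv , v≤0 , v≗) =
    _ , P-+ Pu Pv , ℤₚ.+-mono-≤ u≤0 v≤0 , λ i → cong₂ ℤ._+_ (u≗ i) (v≗ i)

  Projected-resp : ∀ {u v} → u ≗ v → Projected u → Projected v
  Projected-resp u≗v (u , Pu , u≤0 , u≗) = u , Pu , u≤0 , λ i → trans (u≗ i) (u≗v i)

  cancelHead : (Fin (suc d) → ℤ) → (Fin (suc d) → ℤ) → Fin d → ℤ
  cancelHead p q i = + ∣ q zero ∣ ℤ.* p (suc i) ℤ.+ + ∣ p zero ∣ ℤ.* q (suc i)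

  Projected-cancelHead : ∀ {p q} → P p → P q → 0ℤ ℤ.< p zero → q zero ℤ.< 0ℤ → Projected (cancelHead p q)
  Projected-cancelHead {p} {q} Pp Pq p>0 q<0 with p zero in p₀ | q zero in q₀
  ... | +[1+ a ] | -[1+ b ] = (λ i → +[1+ b ] ℤ.* p i ℤ.+ +[1+ a ] ℤ.* q i) ,
      P-+ (P-scale b Pp) (P-scale a Pq) ,
      ℤₚ.≤-reflexive (trans (cong₂ (λ x y → +[1+ b ] ℤ.* x ℤ.+ +[1+ a ] ℤ.* y) p₀ q₀) (cancel +[1+ b ] +[1+ a ])) ,
      λ i → refl
    where
    cancel : ∀ x y → x ℤ.* y ℤ.+ y ℤ.* (ℤ.- x) ≡ 0ℤ
    cancel = ℤ-solve-∀
  ... | +[1+ a ] | + b = contradiction q<0 λ { (ℤ.+<+ ()) }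
  ... | + zero | _ = contradiction p>0 λ { (ℤ.+<+ ()) }
  ... | -[1+ a ] | _ = contradiction p>0 λ ()

  positives nonpositives negatives : List (Fin (suc d) → ℤ) → List (Fin (suc d) → ℤ)
  positives    = filter (λ v → 0ℤ ℤ.<? v zero)
  nonpositives = filter (λ v → v zero ℤ.≤? 0ℤ)
  negatives    = filter (λ v → v zero ℤ.<? 0ℤ)

  -- Vectors with first entry zero are among `nonpositives` but not among `negatives`: they are kept
  -- and take part in no cancellation.
  eliminate : List (Fin (suc d) → ℤ) → List (Fin d → ℤ)
  eliminate L = map (_∘ suc) (nonpositives L) ++ cartesianProductWith cancelHead (positives L) (negatives L)

  All-Projected : ∀ L → All P L → All Projected (eliminate L)
  All-Projected L allP = All.tabulate λ v∈ → from (∈-++⁻ (map (_∘ suc) (nonpositives L)) v∈)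
    where
    from : ∀ {v} → v ∈ map (_∘ suc) (nonpositives L) ⊎ v ∈ cartesianProductWith cancelHead (positives L) (negatives L) → Projected v
    from (inj₁ v∈) with ∈-map⁻ (_∘ suc) v∈
    ... | u , u∈ , refl with ∈-filter⁻ (λ v → v zero ℤ.≤? 0ℤ) {xs = L} u∈
    ...   | u∈L , u≤0 = u , All.lookup allP u∈L , u≤0 , λ _ → refl
    from (inj₂ v∈) with ∈-cartesianProductWith⁻ cancelHead (positives L) (negatives L) v∈
    ... | p , q , p∈ , q∈ , refl with ∈-filter⁻ (λ v → 0ℤ ℤ.<? v zero) {xs = L} p∈ | ∈-filter⁻ (λ v → v zero ℤ.<? 0ℤ) {xs = L} q∈
    ...   | p∈L , p>0 | q∈L , q<0 = Projected-cancelHead (All.lookup allP p∈L) (All.lookup allP q∈L) p>0 q<0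

  pair-cancelHead : ∀ w p q → pair w (cancelHead p q) ≡ + ∣ q zero ∣ ℤ.* pair w (p ∘ suc) ℤ.+ + ∣ p zero ∣ ℤ.* pair w (q ∘ suc)
  pair-cancelHead w p q = begin
    pair w (cancelHead p q)
      ≡⟨ ℤΣ.sum-cong-≗ (λ i → distribute (+ w i) (+ ∣ q zero ∣) (p (suc i)) (+ ∣ p zero ∣) (q (suc i))) ⟩
    ℤΣ.sum (λ i → + ∣ q zero ∣ ℤ.* (+ w i ℤ.* p (suc i)) ℤ.+ + ∣ p zero ∣ ℤ.* (+ w i ℤ.* q (suc i)))
      ≡⟨ ℤΣ.∑-distrib-+ (λ i → + ∣ q zero ∣ ℤ.* (+ w i ℤ.* p (suc i))) (λ i → + ∣ p zero ∣ ℤ.* (+ w i ℤ.* q (suc i))) ⟩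
    ℤΣ.sum (λ i → + ∣ q zero ∣ ℤ.* (+ w i ℤ.* p (suc i))) ℤ.+ ℤΣ.sum (λ i → + ∣ p zero ∣ ℤ.* (+ w i ℤ.* q (suc i)))
      ≡⟨ cong₂ ℤ._+_ (ℤΣ.*-distribˡ-sum (+ ∣ q zero ∣) (λ i → + w i ℤ.* p (suc i)))
                     (ℤΣ.*-distribˡ-sum (+ ∣ p zero ∣) (λ i → + w i ℤ.* q (suc i))) ⟨
    + ∣ q zero ∣ ℤ.* pair w (p ∘ suc) ℤ.+ + ∣ p zero ∣ ℤ.* pair w (q ∘ suc) ∎
    where
    open ≡-Reasoning
    distribute : ∀ w a x b y → w ℤ.* (a ℤ.* x ℤ.+ b ℤ.* y) ≡ a ℤ.* (w ℤ.* x) ℤ.+ b ℤ.* (w ℤ.* y)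
    distribute = ℤ-solve-∀

  scaled : ℤ → ℤ → (Fin d → ℕ) → Fin (suc d) → ℕ
  scaled t s w zero    = ∣ t ∣
  scaled t s w (suc i) = ∣ s ∣ ℕ.* w i

  pair-scale : ∀ t s (w : Fin d → ℕ) v → 0ℤ ℤ.≤ t → 0ℤ ℤ.≤ s →
               pair (scaled t s w) v ≡ value t s (v zero , pair w (v ∘ suc))
  pair-scale (+ t) (+ s) w v _ _ = cong (λ x → + t ℤ.* v zero ℤ.+ x) (begin
    ℤΣ.sum (λ i → + (s ℕ.* w i) ℤ.* v (suc i))
      ≡⟨ ℤΣ.sum-cong-≗ (λ i → trans (cong (ℤ._* v (suc i)) (ℤₚ.pos-* s (w i))) (ℤₚ.*-assoc (+ s) (+ w i) (v (suc i)))) ⟩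
    ℤΣ.sum (λ i → + s ℤ.* (+ w i ℤ.* v (suc i)))
      ≡⟨ ℤΣ.*-distribˡ-sum (+ s) (λ i → + w i ℤ.* v (suc i)) ⟨
    + s ℤ.* pair w (v ∘ suc) ∎)
    where open ≡-Reasoning

  -- The inequalities for the cancelled pairs say that every lower bound for the weight of the first
  -- coordinate lies below every upper bound. A value t / s between them exists, and `scaled` clears
  -- its denominator.
  extend : ∀ L w → All (λ v → 0ℤ ℤ.< pair w v) (eliminate L) →
           ∃[ w′ ] All (λ v → 0ℤ ℤ.< pair {suc d} w′ v) L
  extend L w ok = finish (select (map f (positives L)) (map f (nonpositives L)) Ps-pos Ns-pos compat)
    where
    f : (Fin (suc d) → ℤ) → ℤ × ℤ
    f v = v zero , pair w (v ∘ suc)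
    fromPositive : ∀ {z} → z ∈ map f (positives L) → ∃[ v ] (v ∈ positives L × 0ℤ ℤ.< v zero × z ≡ f v)
    fromPositive z∈ with ∈-map⁻ f z∈
    ... | v , v∈ , eq = v , v∈ , proj₂ (∈-filter⁻ (λ v → 0ℤ ℤ.<? v zero) {xs = L} v∈) , eq
    fromNonpositive : ∀ {z} → z ∈ map f (nonpositives L) → ∃[ v ] (v ∈ L × v ∈ nonpositives L × v zero ℤ.≤ 0ℤ × z ≡ f v)
    fromNonpositive z∈ with ∈-map⁻ f z∈
    ... | v , v∈ , eq = let v∈L , v≤0 = ∈-filter⁻ (λ v → v zero ℤ.≤? 0ℤ) {xs = L} v∈ in v , v∈L , v∈ , v≤0 , eq
    Ps-pos : All (λ (x , y) → 0ℤ ℤ.< x) (map f (positives L))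
    Ps-pos = All.tabulate λ z∈ → let v , _ , v>0 , eq = fromPositive z∈ in subst (λ z → 0ℤ ℤ.< proj₁ z) (sym eq) v>0
    old : ∀ {v} → v ∈ nonpositives L → 0ℤ ℤ.< pair w (v ∘ suc)
    old v∈ = All.lookup ok (∈-++⁺ˡ (∈-map⁺ (_∘ suc) v∈))
    new : ∀ {p q} → p ∈ positives L → q ∈ negatives L → 0ℤ ℤ.< pair w (cancelHead p q)
    new p∈ q∈ = All.lookup ok (∈-++⁺ʳ (map (_∘ suc) (nonpositives L)) (∈-cartesianProductWith⁺ cancelHead p∈ q∈))
    Ns-pos : All (λ (x , y) → x ℤ.≤ 0ℤ × 0ℤ ℤ.< y) (map f (nonpositives L))
    Ns-pos = All.tabulate λ z∈ → let v , _ , v∈ , v≤0 , eq = fromNonpositive z∈ in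
      subst (λ z → proj₁ z ℤ.≤ 0ℤ × 0ℤ ℤ.< proj₂ z) (sym eq) (v≤0 , old v∈)
    crossed : ∀ {p q} → p ∈ positives L → q ∈ L → 0ℤ ℤ.< p zero → q zero ℤ.≤ 0ℤ → 0ℤ ℤ.< pair w (q ∘ suc) →
              0ℤ ℤ.< value (ℤ.- pair w (p ∘ suc)) (p zero) (f q)
    crossed {p} {q} p∈ q∈ p>0 q≤0 σ>0 with q zero ℤ.<? 0ℤ
    ... | yes q<0 = subst (0ℤ ℤ.<_) (trans (pair-cancelHead w p q) (trans
            (cong₂ (λ a b → a ℤ.* pair w (p ∘ suc) ℤ.+ b ℤ.* pair w (q ∘ suc)) (negated q≤0) (ℤₚ.0≤i⇒+∣i∣≡i (ℤₚ.<⇒≤ p>0)))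
            (flip (q zero) (pair w (p ∘ suc)) (p zero) (pair w (q ∘ suc)))))
            (new p∈ (∈-filter⁺ (λ v → v zero ℤ.<? 0ℤ) q∈ q<0))
      where
      negated : ∀ {i} → i ℤ.≤ 0ℤ → + ∣ i ∣ ≡ ℤ.- i
      negated { + zero } _ = refl
      negated { -[1+ n ] } _ = refl
      negated { +[1+ n ] } (ℤ.+≤+ ())
      flip : ∀ a b c e → ℤ.- a ℤ.* b ℤ.+ c ℤ.* e ≡ ℤ.- b ℤ.* a ℤ.+ c ℤ.* e
      flip = ℤ-solve-∀
    ... | no q≮0 = subst (0ℤ ℤ.<_) (trans (vanish (pair w (p ∘ suc)) (p zero ℤ.* pair w (q ∘ suc)))
            (cong (λ a → ℤ.- pair w (p ∘ suc) ℤ.* a ℤ.+ p zero ℤ.* pair w (q ∘ suc)) (ℤₚ.≤-antisym (ℤₚ.≮⇒≥ q≮0) q≤0)))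
            (0<* p>0 σ>0)
      where
      vanish : ∀ a b → b ≡ ℤ.- a ℤ.* 0ℤ ℤ.+ b
      vanish = ℤ-solve-∀
    compat : All (λ (x , y) → All (λ (x′ , y′) → 0ℤ ℤ.< value (ℤ.- y) x (x′ , y′)) (map f (nonpositives L))) (map f (positives L))
    compat = All.tabulate λ z∈ → All.tabulate λ z′∈ →
      let p , p∈ , p>0 , eq = fromPositive z∈ ; q , q∈L , q∈ , q≤0 , eq′ = fromNonpositive z′∈ in
      subst₂ (λ z z′ → 0ℤ ℤ.< value (ℤ.- proj₂ z) (proj₁ z) z′) (sym eq) (sym eq′) (crossed p∈ q∈L p>0 q≤0 (old q∈))
    finish : ∃[ t ] ∃[ s ] (0ℤ ℤ.≤ t × 0ℤ ℤ.≤ s × All (λ q → 0ℤ ℤ.< value t s q) (map f (positives L)) ×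
                            All (λ q → 0ℤ ℤ.< value t s q) (map f (nonpositives L))) →
             ∃[ w′ ] All (λ v → 0ℤ ℤ.< pair {suc d} w′ v) L
    finish (t , s , t≥0 , s≥0 , P-ok , N-ok) = scaled t s w , All.tabulate λ {v} v∈ →
      subst (0ℤ ℤ.<_) (sym (pair-scale t s w v t≥0 s≥0)) (positive v v∈)
      where
      positive : ∀ v → v ∈ L → 0ℤ ℤ.< value t s (f v)
      positive v v∈ with v zero ℤ.≤? 0ℤ
      ... | yes v≤0 = All.lookup N-ok (∈-map⁺ f (∈-filter⁺ (λ v → v zero ℤ.≤? 0ℤ) v∈ v≤0))
      ... | no v≰0  = All.lookup P-ok (∈-map⁺ f (∈-filter⁺ (λ v → 0ℤ ℤ.<? v zero) v∈ (ℤₚ.≰⇒> v≰0)))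

-- Without coordinates every vector is nonpositive, so only the empty list calls for weights.
-- Otherwise the eliminated list decides: its first alternative lifts by the definition of
-- `Projected`, its second by `extend`.
farkas : ∀ d (P : (Fin d → ℤ) → Set) → (∀ {u v} → u ≗ v → P u → P v) →
         (∀ {u v} → P u → P v → P (λ i → u i ℤ.+ v i)) → ∀ L → All P L →
         (∃[ v ] (P v × ∀ i → v i ℤ.≤ 0ℤ)) ⊎ (∃[ w ] All (λ v → 0ℤ ℤ.< pair w v) L)
farkas zero    P P-resp P-+ []      _        = inj₂ ((λ ()) , [])
farkas zero    P P-resp P-+ (v ∷ _) (Pv ∷ _) = inj₁ (v , Pv , λ ())
farkas (suc d) P P-resp P-+ L allP with farkas d Projected Projected-resp Projected-+ (eliminate L) (All-Projected L allP)
  where open Elimination P P-resp P-+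
... | inj₁ (v , (u , Pu , u₀≤0 , u≗v) , v≤0) = inj₁ (u , Pu , λ { zero → u₀≤0 ; (suc i) → subst (ℤ._≤ 0ℤ) (sym (u≗v i)) (v≤0 i) })
... | inj₂ (w , ok) = inj₂ (Elimination.extend P P-resp P-+ L w ok)

-- Symmetric matrices as edge multisets

module PairSum {c ℓ} (M : CommutativeMonoid c ℓ) where
  open CommutativeMonoid M using (Carrier; _≈_; identityˡ; assoc)
    renaming (_∙_ to _⊹_; ∙-congˡ to ⊹-congˡ; trans to ≈-trans; refl to ≈-refl; sym to ≈-sym)
  open MonoidSum M renaming (sum to ∑)

  sum-split : ∀ a {b} (f : Fin (a + b) → Carrier) → ∑ f ≈ ∑ (f ∘ (_↑ˡ b)) ⊹ ∑ (f ∘ (a ↑ʳ_))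
  sum-split zero    f = ≈-sym (identityˡ _)
  sum-split (suc a) f = ≈-trans (⊹-congˡ (sum-split a (f ∘ suc))) (≈-sym (assoc _ _ _))

  sum-combine : ∀ a {b} (f : Fin (a * b) → Carrier) → ∑ f ≈ ∑ λ u → ∑ λ v → f (combine {a} {b} u v)
  sum-combine zero        f = ≈-refl
  sum-combine (suc a) {b} f = ≈-trans (sum-split b f) (⊹-congˡ (sum-combine a (f ∘ (b ↑ʳ_))))

module ℕ-PairSum = PairSum ℕₚ.+-0-commutativeMonoid
module 𝔹-PairSum = PairSum (CommutativeRing.+-commutativeMonoid 𝔹ₚ.xor-∧-commutativeRing)

even-from-odd : ∀ k → odd k ≡ false → Even k
even-from-odd zero          _  = 0 , refl
even-from-odd (suc (suc k)) eq with even-from-odd k (trans (sym (𝔹ₚ.not-involutive (odd k))) eq)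
... | j , refl = suc j , cong suc (sym (ℕₚ.+-suc j j))

sum-allFin : ∀ {m} (f : Fin m → ℕ) → ListAction.sum (List.map f (allFin m)) ≡ sum f
sum-allFin {m} f = trans (cong ListAction.sum (Listₚ.map-tabulate id f)) (go f)
  where
  go : ∀ {m} (f : Fin m → ℕ) → ListAction.sum (List.tabulate f) ≡ sum f
  go {zero}  f = refl
  go {suc m} f = cong (_+_ (f zero)) (go (f ∘ suc))

Matrix : ℕ → Set
Matrix n = Fin n → Fin n → ℕ

module _ {n : ℕ} where

  sum₂ : Matrix n → ℕ
  sum₂ A = sum λ u → sum λ v → A u v

  sum₂-cong : ∀ {A B : Matrix n} → (∀ u v → A u v ≡ B u v) → sum₂ A ≡ sum₂ B
  sum₂-cong eq = sum-cong-≗ λ u → sum-cong-≗ (eq u)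

  sum₂-+ : ∀ (A B : Matrix n) → sum₂ (λ u v → A u v + B u v) ≡ sum₂ A + sum₂ B
  sum₂-+ A B = trans (sum-cong-≗ λ u → ℕΣ.∑-distrib-+ (A u) (B u))
                     (ℕΣ.∑-distrib-+ (λ u → sum (A u)) (λ u → sum (B u)))

  sum₂-* : ∀ k (A : Matrix n) → sum₂ (λ u v → k * A u v) ≡ k * sum₂ A
  sum₂-* k A = trans (sum-cong-≗ λ u → sym (ℕΣ.*-distribˡ-sum k (A u)))
                     (sym (ℕΣ.*-distribˡ-sum k (λ u → sum (A u))))

  -- The multiset of unordered pairs given by A, read on ordered pairs again. The diagonal is
  -- cleared because `mult` vanishes there.
  symmetrize : Matrix n → Matrix n
  symmetrize A u v = if pt u v then 0 else A u v + A v u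

  pt-sym : ∀ (u v : Fin n) → pt u v ≡ pt v u
  pt-sym u v with u Finₚ.≟ v
  ... | yes refl = sym (pt-refl u)
  ... | no u≢v   = sym (pt-≢ (u≢v ∘ sym))

  symmetrize-sym : ∀ A u v → symmetrize A u v ≡ symmetrize A v u
  symmetrize-sym A u v rewrite pt-sym u v with pt v u
  ... | true  = refl
  ... | false = ℕₚ.+-comm (A u v) (A v u)

  symmetrize-fixed : ∀ B → (∀ u v → B u v ≡ B v u) → (∀ u → B u u ≡ 0) → ∀ u v → symmetrize B u v ≡ 2 * B u v
  symmetrize-fixed B B-sym B-diag u v with u Finₚ.≟ v
  ... | yes refl = sym (cong (2 *_) (B-diag u))
  ... | no _     = cong (_+_ (B u v)) (trans (B-sym v u) (sym (ℕₚ.+-identityʳ (B u v))))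

  symmetrize-swap : ∀ A B → sum₂ (λ u v → A u v * symmetrize B u v) ≡ sum₂ (λ u v → symmetrize A u v * B u v)
  symmetrize-swap A B = begin
    sum₂ (λ u v → A u v * symmetrize B u v)
      ≡⟨ sum₂-cong (λ u v → expandʳ u v (pt u v)) ⟩
    sum₂ (λ u v → off u v (A u v * B u v) + off u v (A u v * B v u))
      ≡⟨ sum₂-+ (λ u v → off u v (A u v * B u v)) (λ u v → off u v (A u v * B v u)) ⟩
    sum₂ (λ u v → off u v (A u v * B u v)) + sum₂ (λ u v → off u v (A u v * B v u))
      ≡⟨ cong (_+_ (sum₂ (λ u v → off u v (A u v * B u v)))) (trans (ℕΣ.∑-comm (λ u v → off u v (A u v * B v u)))
           (sum₂-cong λ u v → cong (λ b → if b then 0 else A v u * B u v) (pt-sym v u))) ⟩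
    sum₂ (λ u v → off u v (A u v * B u v)) + sum₂ (λ u v → off u v (A v u * B u v))
      ≡⟨ sum₂-+ (λ u v → off u v (A u v * B u v)) (λ u v → off u v (A v u * B u v)) ⟨
    sum₂ (λ u v → off u v (A u v * B u v) + off u v (A v u * B u v))
      ≡⟨ sum₂-cong (λ u v → expandˡ u v (pt u v)) ⟨
    sum₂ (λ u v → symmetrize A u v * B u v) ∎
    where
    open ≡-Reasoning
    off : Fin n → Fin n → ℕ → ℕ
    off u v x = if pt u v then 0 else x
    expandʳ : ∀ u v b → A u v * (if b then 0 else B u v + B v u) ≡
              (if b then 0 else A u v * B u v) + (if b then 0 else A u v * B v u)
    expandʳ u v true  = ℕₚ.*-zeroʳ (A u v)
    expandʳ u v false = ℕₚ.*-distribˡ-+ (A u v) (B u v) (B v u)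
    expandˡ : ∀ u v b → (if b then 0 else A u v + A v u) * B u v ≡
              (if b then 0 else A u v * B u v) + (if b then 0 else A v u * B u v)
    expandˡ u v true  = refl
    expandˡ u v false = ℕₚ.*-distribʳ-+ (B u v) (A u v) (A v u)

  -- The source of the factors 2 between sums over ordered pairs and sums over edges of the complete
  -- graph.
  symmetrize-double : ∀ A B → (∀ u v → B u v ≡ B v u) → (∀ u → B u u ≡ 0) →
                      sum₂ (λ u v → symmetrize A u v * B u v) ≡ 2 * sum₂ (λ u v → A u v * B u v)
  symmetrize-double A B B-sym B-diag = begin
    sum₂ (λ u v → symmetrize A u v * B u v)   ≡⟨ symmetrize-swap A B ⟨
    sum₂ (λ u v → A u v * symmetrize B u v)   ≡⟨ sum₂-cong (λ u v → trans (cong (A u v *_) (symmetrize-fixed B B-sym B-diag u v))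
                                                   (swap-* (A u v) (B u v))) ⟩
    sum₂ (λ u v → 2 * (A u v * B u v))        ≡⟨ sum₂-* 2 (λ u v → A u v * B u v) ⟩
    2 * sum₂ (λ u v → A u v * B u v)          ∎
    where
    open ≡-Reasoning
    swap-* : ∀ x y → x * (2 * y) ≡ 2 * (x * y)
    swap-* = solve-∀

  edgeMap : Matrix n → Edge n → ℕ
  edgeMap A (u , v , _) = A u v + A v u

  mult-edgeMap : ∀ A u v → mult (edgeMap A) u v ≡ symmetrize A u v
  mult-edgeMap A u v with u Finₚ.<? v | v Finₚ.<? u
  ... | yes p | _     = cong (if_then 0 else A u v + A v u) (sym (pt-≢ (Finₚ.<⇒≢ p)))
  ... | no _  | yes q = trans (ℕₚ.+-comm (A v u) (A u v))
                          (cong (if_then 0 else A u v + A v u) (sym (pt-≢ (Finₚ.<⇒≢ q ∘ sym))))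
  ... | no ¬p | no ¬q with Finₚ.<-cmp u v
  ...   | tri< p _ _ = contradiction p ¬p
  ...   | tri> _ _ q = contradiction q ¬q
  ...   | tri≈ _ u≡v _ = cong (if_then 0 else A u v + A v u) (sym (trans (cong (pt u) (sym u≡v)) (pt-refl u)))

  mult-edge : ∀ J ((u , v , p) : Edge n) → mult J u v ≡ J (u , v , p)
  mult-edge J (u , v , p) with u Finₚ.<? v | v Finₚ.<? u
  ... | yes p′ | _ = cong (λ q → J (u , v , q)) (ℕₚ.<-irrelevant p′ p)
  ... | no ¬p | _ = contradiction p ¬p

  mult-cong : ∀ {J K : Edge n → ℕ} → (∀ e → J e ≡ K e) → ∀ u v → mult J u v ≡ mult K u v
  mult-cong J≗K u v with u Finₚ.<? v | v Finₚ.<? u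
  ... | yes p | _     = J≗K _
  ... | no _  | yes q = J≗K _
  ... | no _  | no _  = refl

  mult-+ : ∀ (J K : Edge n → ℕ) u v → mult (λ e → J e + K e) u v ≡ mult J u v + mult K u v
  mult-+ J K u v with u Finₚ.<? v | v Finₚ.<? u
  ... | yes p | _     = refl
  ... | no _  | yes q = refl
  ... | no _  | no _  = refl

  upper : (Edge n → ℕ) → Matrix n
  upper J u v with u Finₚ.<? v
  ... | yes p = J (u , v , p)
  ... | no _  = 0

  upper-< : ∀ J {u v} (p : u Fin.< v) → upper J u v ≡ J (u , v , p)
  upper-< J {u} {v} p with u Finₚ.<? v
  ... | yes p′ = cong (λ q → J (u , v , q)) (ℕₚ.<-irrelevant p′ p)
  ... | no ¬p  = contradiction p ¬p

  upper-≮ : ∀ J {u v} → ¬ (u Fin.< v) → upper J u v ≡ 0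
  upper-≮ J {u} {v} ¬p with u Finₚ.<? v
  ... | yes p = contradiction p ¬p
  ... | no _  = refl

  edgeMap-upper : ∀ J e → edgeMap (upper J) e ≡ J e
  edgeMap-upper J (u , v , p) = trans (cong₂ _+_ (upper-< J p) (upper-≮ J (Finₚ.<-asym p))) (ℕₚ.+-identityʳ _)

  mult-upper : ∀ J u v → mult J u v ≡ symmetrize (upper J) u v
  mult-upper J u v = trans (sym (mult-cong (edgeMap-upper J) u v)) (mult-edgeMap (upper J) u v)

  even-deg : ∀ (A : Matrix n) → (∀ v → ⨁ (λ u → odd (A v u) xor odd (A u v)) ≡ false) →
             ∀ v → Even (deg (edgeMap A) v)
  even-deg A even v = even-from-odd _ (begin
    odd (deg (edgeMap A) v)                     ≡⟨ cong odd (sum-allFin (mult (edgeMap A) v)) ⟩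
    odd (sum (mult (edgeMap A) v))              ≡⟨ odd-sum (mult (edgeMap A) v) ⟩
    ⨁ (λ u → odd (mult (edgeMap A) v u))        ≡⟨ 𝔹Σ.sum-cong-≗ (λ u → trans (cong odd (mult-edgeMap A v u)) (term u)) ⟩
    ⨁ (λ u → odd (A v u) xor odd (A u v))       ≡⟨ even v ⟩
    false                                       ∎)
    where
    open ≡-Reasoning
    term : ∀ u → odd (symmetrize A v u) ≡ odd (A v u) xor odd (A u v)
    term u with v Finₚ.≟ u
    ... | yes refl = sym (𝔹ₚ.xor-same (odd (A v v)))
    ... | no _     = odd-+ (A v u) (A u v)

  adj-edgeMap : ∀ A {u v} → u ≢ v → 0 < A u v + A v u → Adj (λ e → 0 < edgeMap A e) u v
  adj-edgeMap A {u} {v} u≢v pos with Finₚ.<-cmp u v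
  ... | tri< p _ _ = inj₁ (p , pos)
  ... | tri> _ _ q = inj₂ (q , subst (0 <_) (ℕₚ.+-comm (A u v) (A v u)) pos)
  ... | tri≈ _ u≡v _ = contradiction u≡v u≢v

  -- Every ordered pair is an edge of the multigraph. An edge of the complete graph thus has two
  -- parallel copies, and each vertex has a loop, which crosses no cut and has symmetrized weight 0.
  edge : Fin n → Fin n → Fin (n * n)
  edge = combine

  source target : Fin (n * n) → Fin n
  source i = proj₁ (remQuot {n} n i)
  target i = proj₂ (remQuot {n} n i)

  source-edge : ∀ u v → source (edge u v) ≡ u
  source-edge u v = cong proj₁ (Finₚ.remQuot-combine {n} {n} u v)

  target-edge : ∀ u v → target (edge u v) ≡ v
  target-edge u v = cong proj₂ (Finₚ.remQuot-combine {n} {n} u v)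

  open Multigraph source target

  ∙-matrix : ∀ (A B : Matrix n) → (λ i → A (source i) (target i)) ∙ (λ i → B (source i) (target i)) ≡
             sum₂ (λ u v → A u v * B u v)
  ∙-matrix A B = trans (ℕ-PairSum.sum-combine n {n} (λ i → A (source i) (target i) * B (source i) (target i)))
    (sum₂-cong λ u v → cong₂ (λ x y → A x y * B x y) (source-edge u v) (target-edge u v))

  wt-matrix : ∀ (A : Matrix n) F → wt (λ i → A (source i) (target i)) F ≡
              sum₂ (λ u v → (if F (edge u v) then 1 else 0) * A u v)
  wt-matrix A F = trans (ℕ-PairSum.sum-combine n {n} (restrict (λ i → A (source i) (target i)) F))
    (sum₂-cong λ u v → trans (term (F (edge u v)) _)
      (cong₂ (λ x y → (if F (edge u v) then 1 else 0) * A x y) (source-edge u v) (target-edge u v)))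
    where
    term : ∀ b x → (if b then x else 0) ≡ (if b then 1 else 0) * x
    term true  x = sym (ℕₚ.+-identityʳ x)
    term false x = refl

  ∂-matrix : ∀ F v → ∂ F v ≡ ⨁ (λ u → F (edge v u) xor F (edge u v))
  ∂-matrix F v = begin
    ∂ F v
      ≡⟨ 𝔹-PairSum.sum-combine n {n} (λ i → F i ∧ inc i v) ⟩
    ⨁ (λ a → ⨁ λ b → F (edge a b) ∧ inc (edge a b) v)
      ≡⟨ 𝔹Σ.sum-cong-≗ (λ a → 𝔹Σ.sum-cong-≗ λ b → trans
           (cong₂ (λ x y → F (edge a b) ∧ (pt x v xor pt y v)) (source-edge a b) (target-edge a b))
           (trans (𝔹ₚ.∧-distribˡ-xor (F (edge a b)) (pt a v) (pt b v))
             (cong₂ _xor_ (trans (𝔹ₚ.∧-comm (F (edge a b)) (pt a v)) (cong (_∧ F (edge a b)) (pt-sym a v)))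
                          (trans (𝔹ₚ.∧-comm (F (edge a b)) (pt b v)) (cong (_∧ F (edge a b)) (pt-sym b v)))))) ⟩
    ⨁ (λ a → ⨁ λ b → (pt v a ∧ F (edge a b)) xor (pt v b ∧ F (edge a b)))
      ≡⟨ trans (𝔹Σ.sum-cong-≗ λ a → 𝔹Σ.∑-distrib-+ (λ b → pt v a ∧ F (edge a b)) (λ b → pt v b ∧ F (edge a b)))
               (𝔹Σ.∑-distrib-+ (λ a → ⨁ λ b → pt v a ∧ F (edge a b)) (λ a → ⨁ λ b → pt v b ∧ F (edge a b))) ⟩
    ⨁ (λ a → ⨁ λ b → pt v a ∧ F (edge a b)) xor ⨁ (λ a → ⨁ λ b → pt v b ∧ F (edge a b))
      ≡⟨ cong₂ _xor_ (trans (𝔹Σ.∑-comm (λ a b → pt v a ∧ F (edge a b)))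
                            (𝔹Σ.sum-cong-≗ λ b → ⨁-pt (λ a → F (edge a b)) v))
                     (𝔹Σ.sum-cong-≗ λ a → ⨁-pt (λ b → F (edge a b)) v) ⟩
    ⨁ (λ u → F (edge v u)) xor ⨁ (λ u → F (edge u v))
      ≡⟨ 𝔹Σ.∑-distrib-+ (λ u → F (edge v u)) (λ u → F (edge u v)) ⟨
    ⨁ (λ u → F (edge v u) xor F (edge u v)) ∎
    where open ≡-Reasoning

-- The Hamiltonian cycle

injective⇒inverse : (f : Fin n → Fin n) → Injective _≡_ _≡_ f →
                    ∃[ g ] ((∀ y → f (g y) ≡ y) × (∀ x → g (f x) ≡ x))
injective⇒inverse {n} f f-inj = (λ y → proj₁ (preimage y)) , (λ y → proj₂ (preimage y)) ,
                            (λ x → f-inj (proj₂ (preimage (f x))))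
  where
  missed : ∀ {n} (f : Fin n → Fin n) → Injective _≡_ _≡_ f → ∀ y → ¬ (∀ x → y ≢ f x)
  missed {suc n} f f-inj y y∉ = ℕₚ.1+n≰n (Finₚ.injective⇒≤ {f = λ x → punchOut (y∉ x)}
    (λ {a} {b} eq → f-inj (Finₚ.punchOut-injective (y∉ a) (y∉ b) eq)))
  preimage : ∀ y → ∃[ x ] f x ≡ y
  preimage y with Finₚ.any? (λ x → f x Finₚ.≟ y)
  ... | yes found = found
  ... | no none   = contradiction (λ x eq → none (x , sym eq)) (missed f f-inj y)

cyclicPred : ∀ {k} → Fin (suc k) → Fin (suc k)
cyclicPred {k} zero = fromℕ k
cyclicPred (suc j)  = inject₁ j

cyclicPred-injective : ∀ {k} → Injective _≡_ _≡_ (cyclicPred {k})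
cyclicPred-injective {k} {zero}  {zero}  eq = refl
cyclicPred-injective {k} {zero}  {suc j} eq = contradiction eq Finₚ.fromℕ≢inject₁
cyclicPred-injective {k} {suc i} {zero}  eq = contradiction (sym eq) Finₚ.fromℕ≢inject₁
cyclicPred-injective {k} {suc i} {suc j} eq = cong suc (Finₚ.inject₁-injective eq)

cyclicPred²-≢ : ∀ {k} (i : Fin (suc (suc (suc k)))) → cyclicPred (cyclicPred i) ≢ i
cyclicPred²-≢ zero ()
cyclicPred²-≢ (suc zero) ()
cyclicPred²-≢ (suc (suc j)) eq = ℕₚ.m≢1+n+m (toℕ j) {1} (begin
  toℕ j                     ≡⟨ Finₚ.toℕ-inject₁ j ⟨
  toℕ (inject₁ j)           ≡⟨ Finₚ.toℕ-inject₁ (inject₁ j) ⟨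
  toℕ (inject₁ (inject₁ j)) ≡⟨ cong toℕ eq ⟩
  suc (suc (toℕ j))         ∎)
  where open ≡-Reasoning

-- The cyclic order as a permutation with its inverse. `before²-≢` holds because there are at least
-- three vertices and prevents an edge from being traversed in both directions; `connects` is stated
-- for any symmetric relation along the cycle, so that it applies to adjacency in a multiset.
record Cycle {n : ℕ} (R : Fin n → Fin n → Set) : Set₁ where
  field
    before after : Fin n → Fin n
    before-after : ∀ u → before (after u) ≡ u
    after-before : ∀ u → after (before u) ≡ u
    before²-≢    : ∀ u → before (before u) ≢ u
    step         : ∀ u → R (before u) u
    connects     : ∀ {S : Fin n → Fin n → Set} → (∀ {u v} → S u v → S v u) →
                   (∀ u → S (before u) u) → ∀ u v → Star S u v

  before-≢ : ∀ u → before u ≢ u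
  before-≢ u eq = before²-≢ u (trans (cong before eq) eq)

hamiltonCycle : ∀ {k} (G : Graph (suc (suc (suc k)))) → Hamiltonian G → Cycle (Adj (edgeSet G))
hamiltonCycle {k} G (_ , c , c-inj , c-adj) with injective⇒inverse c c-inj | injective⇒inverse (cyclicPred {suc (suc k)}) cyclicPred-injective
... | d , c-d , d-c | next , pred-next , next-pred = record
  { before = λ u → c (cyclicPred (d u))
  ; after  = λ u → c (next (d u))
  ; before-after = λ u → trans (cong (c ∘ cyclicPred) (d-c _)) (trans (cong c (pred-next (d u))) (c-d u))
  ; after-before = λ u → trans (cong (c ∘ next) (d-c _)) (trans (cong c (next-pred (d u))) (c-d u))
  ; before²-≢ = λ u eq → cyclicPred²-≢ (d u) (trans (cong cyclicPred (sym (d-c _))) (trans (sym (d-c _)) (cong d eq)))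
  ; step = λ u → subst (Adj (edgeSet G) (c (cyclicPred (d u)))) (c-d u) (c-adj _ _ (consecutive (d u)))
  ; connects = connects }
  where
  consecutive : ∀ i → suc (toℕ (cyclicPred i)) ≡ toℕ i ⊎ (suc (toℕ (cyclicPred i)) ≡ suc (suc (suc k)) × toℕ i ≡ 0)
  consecutive zero    = inj₂ (cong suc (Finₚ.toℕ-fromℕ (suc (suc k))) , refl)
  consecutive (suc j) = inj₁ (cong suc (Finₚ.toℕ-inject₁ j))
  connects : ∀ {S : Fin (suc (suc (suc k))) → Fin (suc (suc (suc k))) → Set} → (∀ {u v} → S u v → S v u) →
             (∀ u → S (c (cyclicPred (d u))) u) → ∀ u v → Star S u v
  connects {S} S-sym S-step u v = subst₂ (Star S) (c-d u) (c-d v)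
    (Star.reverse S-sym (fromStart (d u)) ◅◅ fromStart (d v))
    where
    fromStart : ∀ i → Star S (c zero) (c i)
    fromStart = <-weakInduction (λ i → Star S (c zero) (c i)) ε λ j path →
      path ◅◅ subst (λ i → S (c (cyclicPred i)) (c (suc j))) (d-c (suc j)) (S-step (c (suc j))) ◅ ε

bit : Bool → ℕ
bit b = if b then 1 else 0

odd-bit : ∀ b → odd (bit b) ≡ b
odd-bit true  = refl
odd-bit false = refl

module HamiltonCycle {R : Fin n → Fin n → Set} (cycle : Cycle R) where
  open Cycle cycle
  open Multigraph (source {n}) target
  open Walks (source {n}) target using (cnt)

  cycleMatrix : Matrix n
  cycleMatrix u v = bit (pt u (before v))

  cycleTour : Edge n → ℕ
  cycleTour = edgeMap cycleMatrix

  -- The first sum counts only `after v`, the second only `before v`, so every vertex has degree 1 +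
  -- 1.
  balanced : ∀ v → ⨁ (λ u → pt v (before u) xor pt u (before v)) ≡ false
  balanced v = trans (𝔹Σ.∑-distrib-+ (λ u → pt v (before u)) (λ u → pt u (before v)))
    (cong₂ _xor_ (trans (𝔹Σ.sum-cong-≗ λ u → trans (shift v u) (sym (𝔹ₚ.∧-identityʳ _))) (⨁-pt (λ _ → true) (after v)))
                 (trans (𝔹Σ.sum-cong-≗ λ u → trans (pt-sym u (before v)) (sym (𝔹ₚ.∧-identityʳ _))) (⨁-pt (λ _ → true) (before v))))
    where
    shift : ∀ v u → pt v (before u) ≡ pt (after v) u
    shift v u with after v Finₚ.≟ u
    ... | yes refl = trans (cong (pt v) (before-after v)) (pt-refl v)
    ... | no av≢u  = pt-≢ λ eq → av≢u (trans (cong after eq) (after-before u))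

  cycleTour-isTour : IsTour cycleTour
  cycleTour-isTour = connects {S = Adj (λ e → 0 < cycleTour e)} adj-sym adj-step , even-deg cycleMatrix
    (λ v → trans (𝔹Σ.sum-cong-≗ λ u → cong₂ _xor_ (odd-bit (pt v (before u))) (odd-bit (pt u (before v)))) (balanced v))
    where
    adj-sym : ∀ {u v} → Adj (λ e → 0 < cycleTour e) u v → Adj (λ e → 0 < cycleTour e) v u
    adj-sym (inj₁ x) = inj₂ x
    adj-sym (inj₂ x) = inj₁ x
    adj-step : ∀ u → Adj (λ e → 0 < cycleTour e) (before u) u
    adj-step u = adj-edgeMap cycleMatrix (before-≢ u)
      (subst (λ b → 0 < bit b + cycleMatrix u (before u)) (sym (pt-refl (before u))) (s≤s z≤n))

  cycleEdges : Fin (n * n) → Bool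
  cycleEdges i = pt (source i) (before (target i))

  cycleEdges-edge : ∀ u v → cycleEdges (edge u v) ≡ pt u (before v)
  cycleEdges-edge u v = cong₂ (λ x y → pt x (before y)) (source-edge u v) (target-edge u v)

  cycle-cut-even : ∀ D → Even (cnt D cycleEdges)
  cycle-cut-even D = even-from-odd _ (trans (parity-wt (χ D) D (odd-χ source target D) cycleEdges)
    (trans (𝔹Σ.sum-cong-≗ λ v → cong (_∧ D v) (trans (∂-matrix cycleEdges v)
             (trans (𝔹Σ.sum-cong-≗ λ u → cong₂ _xor_ (cycleEdges-edge v u) (cycleEdges-edge u v)) (balanced v))))
           (𝔹Σ.sum-replicate-zero n)))

  cut-matrix : (Fin n → Bool) → Matrix n
  cut-matrix D u v = bit (D u xor D v)

  symmetrize-cut : ∀ A D → (λ i → symmetrize A (source i) (target i)) ∙ χ D ≡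
                           2 * sum₂ (λ u v → A u v * cut-matrix D u v)
  symmetrize-cut A D = trans (∙-matrix (symmetrize A) (cut-matrix D))
    (symmetrize-double A (cut-matrix D) (λ u v → cong bit (𝔹ₚ.xor-comm (D u) (D v))) (λ u → cong bit (𝔹ₚ.xor-same (D u))))

  cut-wt : ∀ F D → cnt D F ≡ sum₂ (λ u v → bit (F (edge u v)) * cut-matrix D u v)
  cut-wt F D = wt-matrix (cut-matrix D) F

module HamiltonianGraph {n} (G : Graph n) (conn : ThreeEdgeConnected G) (cycle : Cycle (Adj (edgeSet G)))
                        (e₀ : Edge n) where
  open Cycle cycle
  open HamiltonCycle cycle
  open Multigraph (source {n}) target
  open Walks (source {n}) target using (cnt)

  graphMatrix : Matrix n
  graphMatrix = upper (indicator G)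

  graphEdges : Fin (n * n) → Bool
  graphEdges i = does (graphMatrix (source i) (target i) ℕₚ.≟ 1)

  indicator-T : ∀ {e} → T (G e) → indicator G e ≡ 1
  indicator-T {e} g with G e
  ... | true = refl

  bit-graphEdges : ∀ u v → bit (graphEdges (edge u v)) ≡ graphMatrix u v
  bit-graphEdges u v = trans (cong₂ (λ x y → bit (does (graphMatrix x y ℕₚ.≟ 1))) (source-edge u v) (target-edge u v)) (go u v)
    where
    go : ∀ u v → bit (does (graphMatrix u v ℕₚ.≟ 1)) ≡ graphMatrix u v
    go u v with u Finₚ.<? v
    ... | no _ = refl
    ... | yes p with G (u , v , p)
    ...   | true  = refl
    ...   | false = refl

  graphEdges-edge : ∀ {u v p} → T (G (u , v , p)) → graphEdges (edge u v) ≡ true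
  graphEdges-edge {u} {v} {p} g = trans (cong₂ (λ x y → does (graphMatrix x y ℕₚ.≟ 1)) (source-edge u v) (target-edge u v))
    (dec-true (graphMatrix u v ℕₚ.≟ 1) (trans (upper-< (indicator G) p) (indicator-T {u , v , p} g)))

  crossing-edge : ∀ (D : Fin n → Bool) {P : Edge n → Set} {u v} → Star (Adj P) u v → D u ≡ true → D v ≡ false →
                  ∃[ e ] (P e × D (src e) xor D (tgt e) ≡ true)
  crossing-edge D ε Du Dv = case trans (sym Du) Dv of λ ()
  crossing-edge D {u = u} (_◅_ {j = x} (inj₁ (p , Pe)) path) Du Dv with D x in Dx
  ... | true  = crossing-edge D path Dx Dv
  ... | false = (u , x , p) , Pe , cong₂ _xor_ Du Dx
  crossing-edge D {u = u} (_◅_ {j = x} (inj₂ (p , Pe)) path) Du Dv with D x in Dx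
  ... | true  = crossing-edge D path Dx Dv
  ... | false = (x , u , p) , Pe , cong₂ _xor_ Dx Du

  code : Edge n → Fin (n * n)
  code (u , v , _) = edge u v

  code-injective : ∀ {e f} → ¬ SameEdge e f → code e ≢ code f
  code-injective {u , v , _} {u′ , v′ , _} distinct eq = distinct
    (trans (sym (source-edge u v)) (trans (cong source eq) (source-edge u′ v′)) ,
     trans (sym (target-edge u v)) (trans (cong target eq) (target-edge u′ v′)))

  code-crosses : ∀ (D : Fin n → Bool) e → D (src e) xor D (tgt e) ≡ true → crosses D (code e) ≡ true
  code-crosses D (u , v , _) eq = trans (cong₂ (λ x y → D x xor D y) (source-edge u v) (target-edge u v)) eq

  three-distinct : ∀ D F i j k → i ≢ j → i ≢ k → j ≢ k → F i ≡ true → F j ≡ true → F k ≡ true →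
                   crosses D i ≡ true → crosses D j ≡ true → crosses D k ≡ true → 3 ≤ cnt D F
  three-distinct D F i j k i≢j i≢k j≢k Fi Fj Fk ci cj ck = begin
    3                                                ≡⟨ cong₂ (λ x y → 1 + x + y) (χ-true {D} cj) (χ-true {D} ci) ⟨
    1 + χ D j + χ D i                                ≡⟨ cong (λ x → x + χ D j + χ D i) (χ-true {D} ck) ⟨
    χ D k + χ D j + χ D i
      ≤⟨ ℕₚ.+-monoˡ-≤ (χ D i) (ℕₚ.+-monoˡ-≤ (χ D j) (≤-wt (χ D) ((F ⊕ pt i) ⊕ pt j)
           (cong₂ _xor_ (cong₂ _xor_ Fk (pt-≢ i≢k)) (pt-≢ j≢k)))) ⟩
    cnt D ((F ⊕ pt i) ⊕ pt j) + χ D j + χ D i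
      ≡⟨ cong (_+ χ D i) (wt-remove (χ D) (F ⊕ pt i) (cong₂ _xor_ Fj (pt-≢ i≢j))) ⟩
    cnt D (F ⊕ pt i) + χ D i                         ≡⟨ wt-remove (χ D) F Fi ⟩
    cnt D F                                          ∎
    where open ℕₚ.≤-Reasoning

  -- After deletion of the crossing edges found so far, at most two, u and v are still connected, so
  -- there is a further crossing edge. At first `e₀` fills both places for deleted edges.
  graph-cut : ∀ D u v → D u ≡ true → D v ≡ false → 3 ≤ cnt D graphEdges
  graph-cut D u v Du Dv =
    let f₁ , (g₁ , _ , _) , c₁     = crossing-edge D (conn e₀ e₀ u v) Du Dv
        f₂ , (g₂ , f₂≢f₁ , _) , c₂ = crossing-edge D (conn f₁ f₁ u v) Du Dv
        f₃ , (g₃ , f₃≢f₁ , f₃≢f₂) , c₃ = crossing-edge D (conn f₁ f₂ u v) Du Dv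
    in three-distinct D graphEdges (code f₁) (code f₂) (code f₃)
         (code-injective {f₂} {f₁} f₂≢f₁ ∘ sym) (code-injective {f₃} {f₁} f₃≢f₁ ∘ sym) (code-injective {f₃} {f₂} f₃≢f₂ ∘ sym)
         (graphEdges-edge {p = proj₂ (proj₂ f₁)} g₁) (graphEdges-edge {p = proj₂ (proj₂ f₂)} g₂) (graphEdges-edge {p = proj₂ (proj₂ f₃)} g₃)
         (code-crosses D f₁ c₁) (code-crosses D f₂ c₂) (code-crosses D f₃ c₃)

  adjacent⇒1 : ∀ {u v} → Adj (edgeSet G) u v → symmetrize graphMatrix u v ≡ 1
  adjacent⇒1 {u} {v} (inj₁ (p , g)) = trans (sym (mult-upper (indicator G) u v))
    (trans (mult-edge (indicator G) (u , v , p)) (indicator-T {u , v , p} g))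
  adjacent⇒1 {u} {v} (inj₂ (p , g)) = trans (symmetrize-sym graphMatrix u v) (trans (sym (mult-upper (indicator G) v u))
    (trans (mult-edge (indicator G) (v , u , p)) (indicator-T {v , u , p} g)))

  -- An edge traversed in both directions would count twice in the cycle and once in G; `before²-≢`
  -- excludes this.
  cycle≤graph : ∀ u v → symmetrize cycleMatrix u v ≤ symmetrize graphMatrix u v
  cycle≤graph u v with u Finₚ.≟ before v | v Finₚ.≟ before u
  ... | yes u≡ | yes v≡ = contradiction (sym (trans u≡ (cong before v≡))) (before²-≢ u)
  ... | yes u≡ | no v≢  = ℕₚ.≤-trans (bounded (pt u v)) (ℕₚ.≤-reflexive (sym (adjacent⇒1 (subst (λ x → Adj (edgeSet G) x v) (sym u≡) (step v)))))
    where
    bounded : ∀ b → (if b then 0 else 1 + 0) ≤ 1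
    bounded true  = z≤n
    bounded false = ℕₚ.≤-refl
  ... | no u≢  | yes v≡ = ℕₚ.≤-trans (bounded (pt u v)) (ℕₚ.≤-reflexive (sym (trans (symmetrize-sym graphMatrix u v)
                            (adjacent⇒1 (subst (λ x → Adj (edgeSet G) x u) (sym v≡) (step u))))))
    where
    bounded : ∀ b → (if b then 0 else 0 + 1) ≤ 1
    bounded true  = z≤n
    bounded false = ℕₚ.≤-refl
  ... | no u≢  | no v≢  = ℕₚ.≤-trans (ℕₚ.≤-reflexive (vanish (pt u v))) z≤n
    where
    vanish : ∀ b → (if b then 0 else 0 + 0) ≡ 0
    vanish true  = refl
    vanish false = refl

  -- In terms of the paper, 2 χ_G − χ_H = χ_H + 2 χ_M for the perfect matching M = E ∖ H.
  -- Sums run over ordered pairs, so the bound 4 on cuts becomes 8.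
  capacity : Matrix n
  capacity u v = 2 * symmetrize graphMatrix u v ∸ symmetrize cycleMatrix u v

  capacity+cycle : ∀ u v → capacity u v + symmetrize cycleMatrix u v ≡ 2 * symmetrize graphMatrix u v
  capacity+cycle u v = ℕₚ.m∸n+n≡m (ℕₚ.≤-trans (cycle≤graph u v) (ℕₚ.m≤m+n _ _))

  X : Fin (n * n) → ℕ
  X i = capacity (source i) (target i)

  capacity-cut : ∀ D u v → D u ≡ true → D v ≡ false → 8 ≤ X ∙ χ D
  capacity-cut D u v Du Dv with cycle-cut-even D
  ... | q , h≡q+q = arithmetic q (X ∙ χ D) g x+h≡2g 6≤g h≤g
    where
    symG symH : Fin (n * n) → ℕ
    symG i = symmetrize graphMatrix (source i) (target i)
    symH i = symmetrize cycleMatrix (source i) (target i)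
    g = symG ∙ χ D
    graph-sum : g ≡ 2 * cnt D graphEdges
    graph-sum = trans (symmetrize-cut graphMatrix D) (cong (2 *_) (sym (trans (cut-wt graphEdges D)
      (sum₂-cong λ u v → cong (_* cut-matrix D u v) (bit-graphEdges u v)))))
    cycle-sum : symH ∙ χ D ≡ 4 * q
    cycle-sum = begin
      symH ∙ χ D             ≡⟨ symmetrize-cut cycleMatrix D ⟩
      2 * sum₂ (λ u v → cycleMatrix u v * cut-matrix D u v)
        ≡⟨ cong (2 *_) (trans (cut-wt cycleEdges D) (sum₂-cong λ u v → cong (λ b → bit b * cut-matrix D u v) (cycleEdges-edge u v))) ⟨
      2 * cnt D cycleEdges   ≡⟨ cong (2 *_) h≡q+q ⟩
      2 * (q + q)            ≡⟨ quadruple q ⟩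
      4 * q                  ∎
      where
      open ≡-Reasoning
      quadruple : ∀ q → 2 * (q + q) ≡ 4 * q
      quadruple = solve-∀
    x+h≡2g : X ∙ χ D + 4 * q ≡ 2 * g
    x+h≡2g = begin
      X ∙ χ D + 4 * q                        ≡⟨ cong (_+_ (X ∙ χ D)) cycle-sum ⟨
      X ∙ χ D + symH ∙ χ D                   ≡⟨ ℕΣ.∑-distrib-+ (λ i → X i * χ D i) (λ i → symH i * χ D i) ⟨
      sum (λ i → X i * χ D i + symH i * χ D i)
        ≡⟨ sum-cong-≗ (λ i → trans (sym (ℕₚ.*-distribʳ-+ (χ D i) (X i) (symH i)))
             (trans (cong (_* χ D i) (capacity+cycle (source i) (target i))) (ℕₚ.*-assoc 2 (symG i) (χ D i)))) ⟩
      sum (λ i → 2 * (symG i * χ D i))       ≡⟨ ℕΣ.*-distribˡ-sum 2 (λ i → symG i * χ D i) ⟨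
      2 * g                                  ∎
      where open ≡-Reasoning
    6≤g : 6 ≤ g
    6≤g = subst (6 ≤_) (sym graph-sum) (ℕₚ.*-monoʳ-≤ 2 (graph-cut D u v Du Dv))
    h≤g : 4 * q ≤ g
    h≤g = subst (_≤ g) cycle-sum (sum-mono-≤ λ i → ℕₚ.*-monoˡ-≤ (χ D i) (cycle≤graph (source i) (target i)))
    -- Over ordered pairs the cut has g edges of G and 4 q of H, and x = 2 g - 4 q. If q is at most
    -- 1, then x is at least 12 - 4; otherwise x is at least g, and g is at least 4 q, hence at
    -- least 8.
    arithmetic : ∀ q x g → x + 4 * q ≡ 2 * g → 6 ≤ g → 4 * q ≤ g → 8 ≤ x
    arithmetic q x g eq 6≤g h≤g with q ℕₚ.≤? 1
    ... | yes q≤1 = ℕₚ.+-cancelʳ-≤ 4 8 x (begin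
      12          ≤⟨ ℕₚ.*-monoʳ-≤ 2 6≤g ⟩
      2 * g       ≡⟨ eq ⟨
      x + 4 * q   ≤⟨ ℕₚ.+-monoʳ-≤ x (ℕₚ.*-monoʳ-≤ 4 q≤1) ⟩
      x + 4       ∎)
      where open ℕₚ.≤-Reasoning
    ... | no q≰1 = ℕₚ.≤-trans (ℕₚ.≤-trans (ℕₚ.*-monoʳ-≤ 4 (ℕₚ.≰⇒> q≰1)) h≤g) (ℕₚ.+-cancelʳ-≤ g g x (begin
      g + g       ≡⟨ cong (_+_ g) (ℕₚ.+-identityʳ g) ⟨
      2 * g       ≡⟨ eq ⟨
      x + 4 * q   ≤⟨ ℕₚ.+-monoʳ-≤ x h≤g ⟩
      x + g       ∎))
      where open ℕₚ.≤-Reasoning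

-- Tours

Tour : ℕ → Set
Tour n = Σ (Edge n → ℕ) IsTour

subsets : ∀ m → List (Subset m)
subsets zero    = [] ∷ []
subsets (suc m) = map (true ∷_) (subsets m) ++ map (false ∷_) (subsets m)

∈-subsets : ∀ {m} (v : Subset m) → v ∈ subsets m
∈-subsets []                = here refl
∈-subsets {suc m} (true  ∷ v) = ∈-++⁺ˡ (∈-map⁺ (true ∷_) (∈-subsets v))
∈-subsets {suc m} (false ∷ v) = ∈-++⁺ʳ (map (true ∷_) (subsets m)) (∈-map⁺ (false ∷_) (∈-subsets v))

module Tours {k} (G : Graph (suc k)) (conn : ThreeEdgeConnected G) (cycle : Cycle (Adj (edgeSet G)))
             (e₀ : Edge (suc k)) where

  private
    N = suc k
    M = N * N

  open HamiltonCycle cycle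
  open HamiltonianGraph G conn cycle e₀
  open Multigraph (source {N}) target
  open Spanning (source {N}) target

  pairMatrix : (Fin M → Bool) → (Fin M → Bool) → Matrix N
  pairMatrix F J u v = bit (F (edge u v)) + bit (J (edge u v))

  edge-ends : ∀ i {u v} → Ends i u v → i ≡ edge u v ⊎ i ≡ edge v u
  edge-ends i (inj₁ (refl , refl)) = inj₁ (sym (Finₚ.combine-remQuot {N} N i))
  edge-ends i (inj₂ (refl , refl)) = inj₂ (sym (Finₚ.combine-remQuot {N} N i))

  -- F alone connects, and equal boundaries make every degree of the sum F + J even.
  pairTour : ∀ F J → (∀ u v → Star (Link F) u v) → ∂ F ≗ ∂ J → IsTour (edgeMap (pairMatrix F J))
  pairTour F J connected ∂F = (λ u v → Star.concat (Star.map lift (connected u v))) , even-deg (pairMatrix F J) even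
    where
    positive : ∀ {a b c d} → a ≡ true ⊎ c ≡ true → 0 < bit a + bit b + (bit c + bit d)
    positive {b = b} (inj₁ refl) = s≤s z≤n
    positive {a} {b} {d = d} (inj₂ refl) = ℕₚ.<-≤-trans (s≤s z≤n) (ℕₚ.m≤n+m (1 + bit d) (bit a + bit b))
    lift : ∀ {u v} → Link F u v → Star (Adj (λ e → 0 < edgeMap (pairMatrix F J) e)) u v
    lift {u} {v} (i , Fi , ends) with u Finₚ.≟ v
    ... | yes refl = ε
    ... | no u≢v   = adj-edgeMap (pairMatrix F J) u≢v (positive {F (edge u v)} {J (edge u v)} {F (edge v u)} {J (edge v u)}
      (case edge-ends i ends of λ { (inj₁ eq) → inj₁ (subst (λ j → F j ≡ true) eq Fi)
                                  ; (inj₂ eq) → inj₂ (subst (λ j → F j ≡ true) eq Fi) })) ◅ ε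
    odd-pair : ∀ u v → odd (pairMatrix F J u v) ≡ (F ⊕ J) (edge u v)
    odd-pair u v = trans (odd-+ (bit (F (edge u v))) (bit (J (edge u v)))) (cong₂ _xor_ (odd-bit (F (edge u v))) (odd-bit (J (edge u v))))
    even : ∀ v → ⨁ (λ u → odd (pairMatrix F J v u) xor odd (pairMatrix F J u v)) ≡ false
    even v = trans (𝔹Σ.sum-cong-≗ λ u → cong₂ _xor_ (odd-pair v u) (odd-pair u v))
      (trans (sym (∂-matrix (F ⊕ J) v)) (trans (∂-⊕ F J v)
        (trans (cong (_xor ∂ J v) (∂F v)) (𝔹ₚ.xor-same (∂ J v)))))

  hamiltonTour : Tour N
  hamiltonTour = cycleTour , cycleTour-isTour

  decideConnected : ∀ F → (∀ u v → Star (Link F) u v) ⊎ Closed F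
  decideConnected F = connectedOrClosed F k id id (λ _ → refl) λ u v eq → subst (Star (Link F) u) eq ε

  -- Pairs that do not qualify are sent to the Hamiltonian cycle, so that a list over all pairs of
  -- edge sets contains tours only.
  choose : ∀ F J → (∀ u v → Star (Link F) u v) ⊎ Closed F → Dec (∂ F ≗ ∂ J) → Tour N
  choose F J (inj₁ connected) (yes ∂F) = edgeMap (pairMatrix F J) , pairTour F J connected ∂F
  choose F J (inj₁ _)         (no _)   = hamiltonTour
  choose F J (inj₂ _)         _        = hamiltonTour

  choose-pair : ∀ F J d e → (∀ u v → Star (Link F) u v) → ∂ F ≗ ∂ J →
                proj₁ (choose F J d e) ≡ edgeMap (pairMatrix F J)
  choose-pair F J (inj₁ _) (yes _) connected ∂F = refl
  choose-pair F J (inj₁ _) (no ≢)  connected ∂F = contradiction ∂F ≢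
  choose-pair F J (inj₂ cl@(D , u , v , Du , Dv , _)) _ connected ∂F =
    case trans (sym Du) (trans (closed-invariant {F} cl (connected u v)) Dv) of λ ()

  abstract
    candidate : Subset M → Subset M → Tour N
    candidate F J = choose (lookup F) (lookup J) (decideConnected (lookup F))
                      (Finₚ.all? (λ v → ∂ (lookup F) v 𝔹ₚ.≟ ∂ (lookup J) v))

    candidate-pair : ∀ F J → (∀ u v → Star (Link (lookup F)) u v) → ∂ (lookup F) ≗ ∂ (lookup J) →
                     proj₁ (candidate F J) ≡ edgeMap (pairMatrix (lookup F) (lookup J))
    candidate-pair F J = choose-pair (lookup F) (lookup J) (decideConnected (lookup F))
                           (Finₚ.all? (λ v → ∂ (lookup F) v 𝔹ₚ.≟ ∂ (lookup J) v))

  tours : List (Tour N)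
  tours = hamiltonTour ∷ cartesianProductWith candidate (subsets M) (subsets M)

  cost : (Fin M → ℕ) → (Edge N → ℕ) → ℕ
  cost w J = w ∙ λ i → mult J (source i) (target i)

  module _ (w : Fin M → ℕ) where

    weight : Matrix N
    weight u v = w (edge u v)

    -- Farkas' lemma yields weights on ordered pairs; adding those of the two orientations gives
    -- parallel copies equal weight.
    W : Fin M → ℕ
    W i = symmetrize weight (source i) (target i)

    cost-symmetrize : ∀ J A → (∀ u v → mult J u v ≡ symmetrize A u v) →
                      cost w J ≡ sum₂ (λ u v → weight u v * symmetrize A u v)
    cost-symmetrize J A eq = trans
      (sum-cong-≗ λ i → cong₂ _*_ (cong w (sym (Finₚ.combine-remQuot {N} N i))) (eq (source i) (target i)))
      (∙-matrix weight (symmetrize A))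

    cost-pair : ∀ F J → cost w (edgeMap (pairMatrix F J)) ≡ wt W F + wt W J
    cost-pair F J = begin
      cost w (edgeMap (pairMatrix F J))
        ≡⟨ cost-symmetrize _ (pairMatrix F J) (mult-edgeMap (pairMatrix F J)) ⟩
      sum₂ (λ u v → weight u v * symmetrize (pairMatrix F J) u v)
        ≡⟨ symmetrize-swap weight (pairMatrix F J) ⟩
      sum₂ (λ u v → symmetrize weight u v * pairMatrix F J u v)
        ≡⟨ sum₂-cong (λ u v → distribute (symmetrize weight u v) (bit (F (edge u v))) (bit (J (edge u v)))) ⟩
      sum₂ (λ u v → bit (F (edge u v)) * symmetrize weight u v + bit (J (edge u v)) * symmetrize weight u v)
        ≡⟨ sum₂-+ (λ u v → bit (F (edge u v)) * symmetrize weight u v) (λ u v → bit (J (edge u v)) * symmetrize weight u v) ⟩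
      sum₂ (λ u v → bit (F (edge u v)) * symmetrize weight u v) + sum₂ (λ u v → bit (J (edge u v)) * symmetrize weight u v)
        ≡⟨ cong₂ _+_ (wt-matrix (symmetrize weight) F) (wt-matrix (symmetrize weight) J) ⟨
      wt W F + wt W J ∎
      where
      open ≡-Reasoning
      distribute : ∀ a x y → a * (x + y) ≡ x * a + y * a
      distribute = solve-∀

    symmetrized-cost : ∀ J A → (∀ u v → mult J u v ≡ symmetrize A u v) →
                       sum₂ (λ u v → symmetrize A u v * symmetrize weight u v) ≡ 2 * cost w J
    symmetrized-cost J A eq = begin
      sum₂ (λ u v → symmetrize A u v * symmetrize weight u v)
        ≡⟨ sum₂-cong (λ u v → ℕₚ.*-comm (symmetrize A u v) (symmetrize weight u v)) ⟩
      sum₂ (λ u v → symmetrize weight u v * symmetrize A u v)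
        ≡⟨ symmetrize-double weight (symmetrize A) (symmetrize-sym A) (λ u → cong (if_then 0 else A u u + A u u) (pt-refl u)) ⟩
      2 * sum₂ (λ u v → weight u v * symmetrize A u v)
        ≡⟨ cong (2 *_) (cost-symmetrize J A eq) ⟨
      2 * cost w J ∎
      where open ≡-Reasoning

    -- The identity X + χ_H = 2 χ_G evaluated at W; with both factors symmetrized every cost appears
    -- doubled.
    capacity-cost : X ∙ W + 2 * cost w cycleTour ≡ 4 * cost w (indicator G)
    capacity-cost = begin
      X ∙ W + 2 * cost w cycleTour
        ≡⟨ cong₂ _+_ (∙-matrix capacity (symmetrize weight))
                     (sym (symmetrized-cost cycleTour cycleMatrix (mult-edgeMap cycleMatrix))) ⟩
      sum₂ (λ u v → capacity u v * symmetrize weight u v) + sum₂ (λ u v → symmetrize cycleMatrix u v * symmetrize weight u v)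
        ≡⟨ sum₂-+ (λ u v → capacity u v * symmetrize weight u v) (λ u v → symmetrize cycleMatrix u v * symmetrize weight u v) ⟨
      sum₂ (λ u v → capacity u v * symmetrize weight u v + symmetrize cycleMatrix u v * symmetrize weight u v)
        ≡⟨ sum₂-cong (λ u v → trans (sym (ℕₚ.*-distribʳ-+ (symmetrize weight u v) (capacity u v) (symmetrize cycleMatrix u v)))
             (trans (cong (_* symmetrize weight u v) (capacity+cycle u v)) (ℕₚ.*-assoc 2 (symmetrize graphMatrix u v) _))) ⟩
      sum₂ (λ u v → 2 * (symmetrize graphMatrix u v * symmetrize weight u v))
        ≡⟨ sum₂-* 2 (λ u v → symmetrize graphMatrix u v * symmetrize weight u v) ⟩
      2 * sum₂ (λ u v → symmetrize graphMatrix u v * symmetrize weight u v)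
        ≡⟨ cong (2 *_) (symmetrized-cost (indicator G) graphMatrix (mult-upper (indicator G))) ⟩
      2 * (2 * cost w (indicator G))
        ≡⟨ ℕₚ.*-assoc 2 2 (cost w (indicator G)) ⟨
      4 * cost w (indicator G) ∎
      where open ≡-Reasoning

    Cheap : ℕ → ℕ → Set
    Cheap c b = ∃[ T ] (T ∈ tours × c * cost w (proj₁ T) ≤ b)

    assemble : ∀ F J → (∀ u v → Star (Bridge X 7 capacity-cut F id) u v) → ∂ J ≗ ∂ F →
               8 * wt W F ≤ 2 * (X ∙ W) → 8 * wt W J ≤ X ∙ W → Cheap 8 (3 * (X ∙ W))
    assemble F J bridged ∂J F-bound J-bound =
      candidate F̂ Ĵ , there (∈-cartesianProductWith⁺ candidate (∈-subsets F̂) (∈-subsets Ĵ)) , (begin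
        8 * cost w (proj₁ (candidate F̂ Ĵ))
          ≡⟨ cong (λ T → 8 * cost w T) (candidate-pair F̂ Ĵ (λ u v → Star.concat (Star.map unbridge (bridged u v))) ∂F̂) ⟩
        8 * cost w (edgeMap (pairMatrix (lookup F̂) (lookup Ĵ)))
          ≡⟨ cong (8 *_) (trans (cost-pair (lookup F̂) (lookup Ĵ)) (cong₂ _+_ (wt-cong {W} F̂≗F) (wt-cong {W} Ĵ≗J))) ⟩
        8 * (wt W F + wt W J)
          ≡⟨ ℕₚ.*-distribˡ-+ 8 (wt W F) (wt W J) ⟩
        8 * wt W F + 8 * wt W J
          ≤⟨ ℕₚ.+-mono-≤ F-bound J-bound ⟩
        2 * (X ∙ W) + X ∙ W
          ≡⟨ triple (X ∙ W) ⟩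
        3 * (X ∙ W) ∎)
      where
      open ℕₚ.≤-Reasoning
      F̂ = tabulate F
      Ĵ = tabulate J
      F̂≗F : lookup F̂ ≗ F
      F̂≗F = Vecₚ.lookup∘tabulate F
      Ĵ≗J : lookup Ĵ ≗ J
      Ĵ≗J = Vecₚ.lookup∘tabulate J
      unbridge : ∀ {u v} → Bridge X 7 capacity-cut F id u v → Star (Link (lookup F̂)) u v
      unbridge (inj₁ refl) = ε
      unbridge (inj₂ (i , Fi , ends)) = (i , trans (F̂≗F i) Fi , ends) ◅ ε
      ∂F̂ : ∂ (lookup F̂) ≗ ∂ (lookup Ĵ)
      ∂F̂ v = trans (∂-cong F̂≗F v) (trans (sym (∂J v)) (sym (∂-cong Ĵ≗J v)))
      triple : ∀ x → 2 * x + x ≡ 3 * x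
      triple = solve-∀

    -- Christofides' algorithm in Wolsey's analysis: a spanning tree of weight at
    -- most X ∙ W / 4 together with a join of its odd vertices of weight at most X ∙ W / 8.
    christofides : Cheap 8 (3 * (X ∙ W))
    christofides =
      let F , _ , bridged , F-bound = kruskal X 7 capacity-cut k id id (λ _ → refl) W
          J , ∂J , J-bound          = lightJoin source target X 7 capacity-cut W F
      in assemble F J bridged ∂J (ℕₚ.≤-trans F-bound (ℕₚ.*-monoʳ-≤ 2 separated)) J-bound
      where
      restrict-≤ : ∀ b i → (if b then W i else 0) ≤ W i
      restrict-≤ true  i = ℕₚ.≤-refl
      restrict-≤ false i = z≤n
      separated : X ∙ restrict W (sep id) ≤ X ∙ W
      separated = sum-mono-≤ λ i → ℕₚ.*-monoʳ-≤ (X i) (restrict-≤ (sep id i) i)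

    cheaper : ∀ t h g x → 8 * t ≤ 3 * x → x + 2 * h ≡ 4 * g → 7 * t ≤ 6 * g ⊎ 7 * h ≤ 6 * g
    cheaper t h g x t-bound eq = [ inj₁ ∘ viaT , inj₂ ∘ viaH ]′ (ℕₚ.≤-total t h)
      where
      open ℕₚ.≤-Reasoning
      -- The coefficients of t and h add up to 14, so the smaller of the two is at most 12 / 14 of
      -- g.
      total : 8 * t + 6 * h ≤ 2 * (6 * g)
      total = begin
        8 * t + 6 * h      ≤⟨ ℕₚ.+-monoˡ-≤ (6 * h) t-bound ⟩
        3 * x + 6 * h      ≡⟨ factor x h ⟩
        3 * (x + 2 * h)    ≡⟨ cong (3 *_) eq ⟩
        3 * (4 * g)        ≡⟨ twelve g ⟩
        2 * (6 * g)        ∎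
        where
        factor : ∀ x h → 3 * x + 6 * h ≡ 3 * (x + 2 * h)
        factor = solve-∀
        twelve : ∀ g → 3 * (4 * g) ≡ 2 * (6 * g)
        twelve = solve-∀
      split : ∀ x → 2 * (7 * x) ≡ 8 * x + 6 * x
      split = solve-∀
      viaT : t ≤ h → 7 * t ≤ 6 * g
      viaT t≤h = ℕₚ.*-cancelˡ-≤ 2 (begin
        2 * (7 * t)        ≡⟨ split t ⟩
        8 * t + 6 * t      ≤⟨ ℕₚ.+-monoʳ-≤ (8 * t) (ℕₚ.*-monoʳ-≤ 6 t≤h) ⟩
        8 * t + 6 * h      ≤⟨ total ⟩
        2 * (6 * g)        ∎)
      viaH : h ≤ t → 7 * h ≤ 6 * g
      viaH h≤t = ℕₚ.*-cancelˡ-≤ 2 (begin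
        2 * (7 * h)        ≡⟨ split h ⟩
        8 * h + 6 * h      ≤⟨ ℕₚ.+-monoˡ-≤ (6 * h) (ℕₚ.*-monoʳ-≤ 8 h≤t) ⟩
        8 * t + 6 * h      ≤⟨ total ⟩
        2 * (6 * g)        ∎)

    cheapTour : Cheap 7 (6 * cost w (indicator G))
    cheapTour = finish christofides
      where
      finish : Cheap 8 (3 * (X ∙ W)) → Cheap 7 (6 * cost w (indicator G))
      finish (T , T∈ , bound) = decide (cheaper (cost w (proj₁ T)) (cost w cycleTour) (cost w (indicator G)) (X ∙ W) bound capacity-cost)
        where
        decide : 7 * cost w (proj₁ T) ≤ 6 * cost w (indicator G) ⊎ 7 * cost w cycleTour ≤ 6 * cost w (indicator G) →
                 Cheap 7 (6 * cost w (indicator G))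
        decide (inj₁ b) = T , T∈ , b
        decide (inj₂ b) = hamiltonTour , here refl , b

-- Rational convex combinations from lists of tours

module _ {n : ℕ} where

  total : List (Tour n) → Edge n → ℕ
  total []             e = 0
  total ((J , _) ∷ xs) e = J e + total xs e

  total-++ : ∀ xs ys e → total (xs ++ ys) e ≡ total xs e + total ys e
  total-++ []             ys e = refl
  total-++ ((J , _) ∷ xs) ys e = trans (cong (_+_ (J e)) (total-++ xs ys e)) (sym (ℕₚ.+-assoc (J e) _ _))

  copies : ℕ → List (Tour n) → List (Tour n)
  copies zero    xs = []
  copies (suc k) xs = xs ++ copies k xs

  total-copies : ∀ k xs e → total (copies k xs) e ≡ k * total xs e
  total-copies zero    xs e = refl
  total-copies (suc k) xs e = trans (total-++ xs (copies k xs) e) (cong (_+_ (total xs e)) (total-copies k xs e))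

  length-copies : ∀ k (xs : List (Tour n)) → length (copies k xs) ≡ k * length xs
  length-copies zero    xs = refl
  length-copies (suc k) xs = trans (Listₚ.length-++ xs) (cong (_+_ (length xs)) (length-copies k xs))

  deg-+ : ∀ (J K : Edge n → ℕ) v → deg (λ e → J e + K e) v ≡ deg J v + deg K v
  deg-+ J K v = begin
    deg (λ e → J e + K e) v                       ≡⟨ sum-allFin (mult (λ e → J e + K e) v) ⟩
    sum (mult (λ e → J e + K e) v)                ≡⟨ ℕΣ.sum-cong-≗ (mult-+ J K v) ⟩
    sum (λ u → mult J v u + mult K v u)           ≡⟨ ℕΣ.∑-distrib-+ (mult J v) (mult K v) ⟩
    sum (mult J v) + sum (mult K v)               ≡⟨ cong₂ _+_ (sum-allFin (mult J v)) (sum-allFin (mult K v)) ⟨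
    deg J v + deg K v                             ∎
    where open ≡-Reasoning

  addTwice : Tour n → (Edge n → ℕ) → Tour n
  addTwice (J , connected , even) r = J⁺ , (λ u v → Star.map lift (connected u v)) , even⁺
    where
    J⁺ : Edge n → ℕ
    J⁺ e = J e + (r e + r e)
    lift : ∀ {u v} → Adj (λ e → 0 < J e) u v → Adj (λ e → 0 < J⁺ e) u v
    lift = Sum.map (λ (p , q) → p , ℕₚ.<-≤-trans q (ℕₚ.m≤m+n _ _)) (λ (p , q) → p , ℕₚ.<-≤-trans q (ℕₚ.m≤m+n _ _))
    even⁺ : ∀ v → Even (deg J⁺ v)
    even⁺ v with even v
    ... | k , eq = k + deg r v , (begin
      deg J⁺ v                              ≡⟨ deg-+ J (λ e → r e + r e) v ⟩
      deg J v + deg (λ e → r e + r e) v     ≡⟨ cong₂ _+_ eq (deg-+ r r v) ⟩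
      (k + k) + (deg r v + deg r v)         ≡⟨ regroup k (deg r v) ⟩
      (k + deg r v) + (k + deg r v)         ∎)
      where
      open ≡-Reasoning
      regroup : ∀ a b → (a + a) + (b + b) ≡ (a + b) + (a + b)
      regroup = solve-∀

  -- Repetitions in the list stand for unequal coefficients, so all of them can be 1 / (suc M) and
  -- the sums are natural numbers over one denominator.
  module Uniform (M : ℕ) where

    q : ℚ
    q = + 1 / suc M

    weighted : List (Tour n) → List (ℚ × (Edge n → ℕ))
    weighted = map λ (J , _) → q , J

    toℚᵘ-q : toℚᵘ q ≃ mkℚᵘ (+ 1) M
    toℚᵘ-q = ℚₚ.toℚᵘ-fromℚᵘ (mkℚᵘ (+ 1) M)

    add : ∀ a b → mkℚᵘ (+ a) M ℚᵘ.+ mkℚᵘ (+ b) M ≃ mkℚᵘ (+ (a + b)) M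
    add a b = *≡* (trans (ident (+ a) (+ b) (+ suc M)) (cong₂ ℤ._*_ (sym (ℤₚ.pos-+ a b)) (sym (ℤₚ.pos-* (suc M) (suc M)))))
      where
      ident : ∀ a b m → (a ℤ.* m ℤ.+ b ℤ.* m) ℤ.* m ≡ (a ℤ.+ b) ℤ.* (m ℤ.* m)
      ident = ℤ-solve-∀

    scale : ∀ a → mkℚᵘ (+ 1) M ℚᵘ.* mkℚᵘ (+ a) 0 ≃ mkℚᵘ (+ a) M
    scale a = *≡* (cong₂ ℤ._*_ (ℤₚ.*-identityˡ (+ a)) (cong +_ (sym (ℕₚ.*-identityʳ (suc M)))))

    combo-weighted : ∀ xs e → toℚᵘ (combo (weighted xs) e) ≃ mkℚᵘ (+ total xs e) M
    combo-weighted []             e = *≡* refl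
    combo-weighted ((J , _) ∷ xs) e = begin
      toℚᵘ (q ℚ.* incidence J e ℚ.+ combo (weighted xs) e)
        ≈⟨ ℚₚ.toℚᵘ-homo-+ (q ℚ.* incidence J e) (combo (weighted xs) e) ⟩
      toℚᵘ (q ℚ.* incidence J e) ℚᵘ.+ toℚᵘ (combo (weighted xs) e)
        ≈⟨ ℚᵘₚ.+-cong (ℚᵘₚ.≃-trans (ℚₚ.toℚᵘ-homo-* q (incidence J e))
             (ℚᵘₚ.≃-trans (ℚᵘₚ.*-cong toℚᵘ-q (ℚₚ.toℚᵘ-fromℚᵘ (mkℚᵘ (+ J e) 0))) (scale (J e))))
             (combo-weighted xs e) ⟩
      mkℚᵘ (+ J e) M ℚᵘ.+ mkℚᵘ (+ total xs e) M
        ≈⟨ add (J e) (total xs e) ⟩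
      mkℚᵘ (+ (J e + total xs e)) M ∎
      where open ℚᵘₚ.≃-Reasoning

    coeffSum-weighted : ∀ xs → toℚᵘ (coeffSum (weighted xs)) ≃ mkℚᵘ (+ length xs) M
    coeffSum-weighted []       = *≡* refl
    coeffSum-weighted (x ∷ xs) = ℚᵘₚ.≃-trans (ℚₚ.toℚᵘ-homo-+ q (coeffSum (weighted xs)))
      (ℚᵘₚ.≃-trans (ℚᵘₚ.+-cong toℚᵘ-q (coeffSum-weighted xs)) (add 1 (length xs)))

    average : ∀ xs → length xs ≡ suc M → ∀ y → (∀ e → mkℚᵘ (+ total xs e) M ≃ toℚᵘ (y e)) → InTourPolytope n y
    average xs len y eq = weighted xs ,
      Allₚ.map⁺ (All.universal proj₂ xs) ,
      Allₚ.map⁺ (All.universal (λ _ → ℚₚ.nonNegative⁻¹ q {{ℚₚ.normalize-nonNeg 1 (suc M)}}) xs) ,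
      ℚₚ.toℚᵘ-injective (ℚᵘₚ.≃-trans (coeffSum-weighted xs) (*≡* (trans (cong (λ l → + l ℤ.* + 1) len) (ℤₚ.*-comm (+ suc M) (+ 1))))) ,
      λ e → ℚₚ.toℚᵘ-injective (ℚᵘₚ.≃-trans (combo-weighted xs e) (eq e))

  -- Only doubled edges can be added without spoiling even degrees. Seven copies of the list would
  -- leave the slack r; fourteen leave 2 r, which one copy of T absorbs. The total is then 12 χ_G
  -- for every 14 tours.
  fromCover : ∀ (G : Graph n) (T : Tour n) xs → (∀ e → 7 * total (T ∷ xs) e ≤ length (T ∷ xs) * (6 * indicator G e)) →
              InTourPolytope n (everywhere (+ 6 / 7) G)
  fromCover G T xs cover = Uniform.average (13 + 14 * length xs) ys length-ys (everywhere (+ 6 / 7) G) fraction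
    where
    zs = T ∷ xs
    r : Edge n → ℕ
    r e = length zs * (6 * indicator G e) ∸ 7 * total zs e
    -- The part `addTwice T r ∷ xs` is the fourteenth copy of the list.
    ys = addTwice T r ∷ xs ++ copies 13 zs
    length-ys : length ys ≡ suc (13 + 14 * length xs)
    length-ys = trans (cong suc (trans (Listₚ.length-++ xs) (cong (_+_ (length xs)) (length-copies 13 zs)))) (count (length xs))
      where
      count : ∀ l → 1 + (l + 13 * (1 + l)) ≡ 1 + (13 + 14 * l)
      count = solve-∀
    total-ys : ∀ e → total ys e ≡ 12 * (length zs * indicator G e)
    total-ys e = begin
      proj₁ T e + (r e + r e) + total (xs ++ copies 13 zs) e
        ≡⟨ cong (_+_ (proj₁ T e + (r e + r e))) (trans (total-++ xs (copies 13 zs) e) (cong (_+_ (total xs e)) (total-copies 13 zs e))) ⟩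
      proj₁ T e + (r e + r e) + (total xs e + 13 * (proj₁ T e + total xs e))
        ≡⟨ regroup (proj₁ T e) (r e) (total xs e) ⟩
      2 * (r e + 7 * total zs e)
        ≡⟨ cong (_*_ 2) (ℕₚ.m∸n+n≡m (cover e)) ⟩
      2 * (length zs * (6 * indicator G e))
        ≡⟨ twelve (length zs) (indicator G e) ⟩
      12 * (length zs * indicator G e) ∎
      where
      open ≡-Reasoning
      regroup : ∀ t r x → t + (r + r) + (x + 13 * (t + x)) ≡ 2 * (r + 7 * (t + x))
      regroup = solve-∀
      twelve : ∀ l g → 2 * (l * (6 * g)) ≡ 12 * (l * g)
      twelve = solve-∀
    fraction : ∀ e → mkℚᵘ (+ total ys e) (13 + 14 * length xs) ≃ toℚᵘ (everywhere (+ 6 / 7) G e)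
    fraction e = subst (λ t → mkℚᵘ (+ t) (13 + 14 * length xs) ≃ toℚᵘ (everywhere (+ 6 / 7) G e)) (sym (total-ys e)) (share (G e))
      where
      ratio : ∀ l → 12 * ((1 + l) * 1) * 7 ≡ 6 * (1 + (13 + 14 * l))
      ratio = solve-∀
      share : ∀ b → mkℚᵘ (+ (12 * (length zs * (if b then 1 else 0)))) (13 + 14 * length xs) ≃
                    toℚᵘ (if b then + 6 / 7 else 0ℚ)
      share true  = *≡* (begin
        + (12 * (length zs * 1)) ℤ.* + 7     ≡⟨ ℤₚ.pos-* (12 * (length zs * 1)) 7 ⟨
        + (12 * (length zs * 1) * 7)         ≡⟨ cong +_ (ratio (length xs)) ⟩
        + (6 * suc (13 + 14 * length xs))    ≡⟨ ℤₚ.pos-* 6 (suc (13 + 14 * length xs)) ⟩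
        + 6 ℤ.* + suc (13 + 14 * length xs)  ∎)
        where open ≡-Reasoning
      share false = *≡* (cong (λ x → + (12 * x) ℤ.* + 1) (ℕₚ.*-zeroʳ (length zs)))

-- Excess is the cone to which Farkas' lemma is applied: the sums of the vectors
-- 7 χ_J − 6 χ_G over nonempty lists of tours J, on ordered pairs of vertices.
module Cover {k} (G : Graph (suc k)) where
  private
    N = suc k
    M = N * N

  excess : ℕ → (Edge N → ℕ) → Fin M → ℤ
  excess k J i = + (7 * mult J (source i) (target i)) ℤ.- + (k * (6 * mult (indicator G) (source i) (target i)))

  Excess : (Fin M → ℤ) → Set
  Excess v = ∃[ T ] ∃[ xs ] (v ≗ excess (length {A = Tour N} (T ∷ xs)) (total (T ∷ xs)))

  Excess-resp : ∀ {u v} → u ≗ v → Excess u → Excess v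
  Excess-resp u≗v (T , xs , eq) = T , xs , λ i → trans (sym (u≗v i)) (eq i)

  difference-+ : ∀ a b c d → (+ a ℤ.- + b) ℤ.+ (+ c ℤ.- + d) ≡ + (a + c) ℤ.- + (b + d)
  difference-+ a b c d = trans (ident (+ a) (+ b) (+ c) (+ d)) (cong₂ ℤ._-_ (sym (ℤₚ.pos-+ a c)) (sym (ℤₚ.pos-+ b d)))
    where
    ident : ∀ a b c d → (a ℤ.- b) ℤ.+ (c ℤ.- d) ≡ (a ℤ.+ c) ℤ.- (b ℤ.+ d)
    ident = ℤ-solve-∀

  Excess-+ : ∀ {u v} → Excess u → Excess v → Excess (λ i → u i ℤ.+ v i)
  Excess-+ {u} {v} (T , xs , u≗) (S , ys , v≗) = T , xs ++ S ∷ ys , λ i →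
    trans (cong₂ ℤ._+_ (u≗ i) (v≗ i)) (trans
      (difference-+ (7 * x i) (length (T ∷ xs) * (6 * g i)) (7 * y i) (length (S ∷ ys) * (6 * g i)))
      (cong₂ (λ a b → + a ℤ.- + b) (totals i) (lengths i)))
    where
    x y g : Fin M → ℕ
    x i = mult (total (T ∷ xs)) (source i) (target i)
    y i = mult (total (S ∷ ys)) (source i) (target i)
    g i = mult (indicator G) (source i) (target i)
    totals : ∀ i → 7 * x i + 7 * y i ≡ 7 * mult (total (T ∷ xs ++ S ∷ ys)) (source i) (target i)
    totals i = trans (sym (ℕₚ.*-distribˡ-+ 7 (x i) (y i)))
      (cong (_*_ 7) (sym (trans (mult-cong (total-++ (T ∷ xs) (S ∷ ys)) (source i) (target i))
                              (mult-+ (total (T ∷ xs)) (total (S ∷ ys)) (source i) (target i)))))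
    lengths : ∀ i → length (T ∷ xs) * (6 * g i) + length (S ∷ ys) * (6 * g i) ≡ length (T ∷ xs ++ S ∷ ys) * (6 * g i)
    lengths i = trans (sym (ℕₚ.*-distribʳ-+ (6 * g i) (length (T ∷ xs)) (length (S ∷ ys))))
      (cong (_* (6 * g i)) (sym (Listₚ.length-++ (T ∷ xs))))

  Excess-single : ∀ T → Excess (excess 1 (proj₁ T))
  Excess-single T = T , [] , λ i → cong (λ x → + (7 * x) ℤ.- + (1 * (6 * mult (indicator G) (source i) (target i))))
    (sym (mult-cong (λ e → ℕₚ.+-identityʳ (proj₁ T e)) (source i) (target i)))

  sum-difference : ∀ {k} (a b : Fin k → ℕ) → ℤΣ.sum (λ i → + a i ℤ.- + b i) ≡ + sum a ℤ.- + sum b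
  sum-difference {zero}  a b = refl
  sum-difference {suc k} a b = trans (cong (ℤ._+_ (+ a zero ℤ.- + b zero)) (sum-difference (a ∘ suc) (b ∘ suc)))
    (difference-+ (a zero) (b zero) (sum (a ∘ suc)) (sum (b ∘ suc)))

  pair-excess : ∀ w J → pair w (excess 1 J) ≡ + (7 * (w ∙ (λ i → mult J (source i) (target i)))) ℤ.-
                                              + (6 * (w ∙ (λ i → mult (indicator G) (source i) (target i))))
  pair-excess w J = trans (ℤΣ.sum-cong-≗ term) (trans
    (sum-difference (λ i → 7 * (w i * j i)) (λ i → 6 * (w i * g i)))
    (cong₂ (λ x y → + x ℤ.- + y) (sym (ℕΣ.*-distribˡ-sum 7 (λ i → w i * j i))) (sym (ℕΣ.*-distribˡ-sum 6 (λ i → w i * g i)))))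
    where
    j g : Fin M → ℕ
    j i = mult J (source i) (target i)
    g i = mult (indicator G) (source i) (target i)
    ident : ∀ w x y → w ℤ.* (x ℤ.- y) ≡ w ℤ.* x ℤ.- w ℤ.* y
    ident = ℤ-solve-∀
    swap₇ : ∀ k w x → w * (k * x) ≡ k * (w * x)
    swap₇ = solve-∀
    swap₆ : ∀ k w x → w * (1 * (k * x)) ≡ k * (w * x)
    swap₆ = solve-∀
    term : ∀ i → + w i ℤ.* excess 1 J i ≡ + (7 * (w i * j i)) ℤ.- + (6 * (w i * g i))
    term i = trans (ident (+ w i) (+ (7 * j i)) (+ (1 * (6 * g i))))
      (cong₂ ℤ._-_ (trans (sym (ℤₚ.pos-* (w i) (7 * j i))) (cong +_ (swap₇ 7 (w i) (j i))))
                   (trans (sym (ℤₚ.pos-* (w i) (1 * (6 * g i)))) (cong +_ (swap₆ 6 (w i) (g i)))))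

  fromExcess : ∀ v → Excess v → (∀ i → v i ℤ.≤ 0ℤ) → InTourPolytope N (everywhere (+ 6 / 7) G)
  fromExcess v (T , xs , v≗) v≤0 = fromCover G T xs λ { e@(a , b , p) →
    subst₂ (λ x y → 7 * x ≤ length (T ∷ xs) * (6 * y)) (mult-edge (total (T ∷ xs)) e) (mult-edge (indicator G) e)
      (subst₂ (λ x y → 7 * mult (total (T ∷ xs)) x y ≤ length (T ∷ xs) * (6 * mult (indicator G) x y))
        (source-edge a b) (target-edge a b)
        (ℤₚ.drop‿+≤+ (ℤₚ.i-j≤0⇒i≤j (subst (ℤ._≤ 0ℤ) (v≗ (edge a b)) (v≤0 (edge a b)))))) }

theorem4 : (n : ℕ) (G : Graph n) → Cubic G → ThreeEdgeConnected G → Hamiltonian G →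
    InTourPolytope n (everywhere (+ 6 / 7) G)
theorem4 zero                G _ _    (() , _)
theorem4 (suc zero)          G _ _    (s≤s () , _)
theorem4 (suc (suc zero))    G _ _    (s≤s (s≤s ()) , _)
theorem4 (suc (suc (suc k))) G _ conn ham =
  -- A nonpositive sum of excess vectors bounds the average of its tours by the everywhere 6/7
  -- vector. Separating weights would make every listed tour cost more than 6/7 of the cost of G.
  [ (λ (v , Ev , v≤0) → fromExcess v Ev v≤0) , (λ (w , separates) → contradiction (cheapTour w) (unbeaten w separates)) ]′
    (farkas _ Excess Excess-resp Excess-+ vectors (Allₚ.map⁺ (All.universal Excess-single tours)))
  where
  open Tours G conn (hamiltonCycle G ham) (zero , suc zero , s≤s z≤n)
  open Cover G
  vectors : List (Fin _ → ℤ)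
  vectors = map (λ T → excess 1 (proj₁ T)) tours
  unbeaten : ∀ w → All (λ v → 0ℤ ℤ.< pair w v) vectors →
             ¬ (∃[ T ] (T ∈ tours × 7 * cost w (proj₁ T) ≤ 6 * cost w (indicator G)))
  unbeaten w separates (T , T∈ , cheap) = ℤₚ.<⇒≱ (All.lookup separates (∈-map⁺ (λ T → excess 1 (proj₁ T)) T∈))
    (subst (ℤ._≤ 0ℤ) (sym (pair-excess w (proj₁ T))) (ℤₚ.i≤j⇒i-j≤0 (ℤ.+≤+ cheap)))
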